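{- Let $G$ be a finite noncyclic $3$-group which is not isomorphic to $L_r$ for any $r\ge 4$, where \[ L_r=\langle a,b\mid a^{3^{r-1}}=b^3=1,\ bab^{ -1}=a^{1+3^{r-2}}\rangle . \] Then $G$ is colourable.
   Context: For a group $G$ and a map $\sigma\colon G\to G$ define $\Delta^{(1)}_\sigma(x)=\sigma(x)x$, $\Delta^{(2)}_\sigma(x)=x^{ -1}\sigma(x)$, $\Delta^{(3)}_\sigma(x)=x^{ -1}\sigma(x)x$. A bijection $\sigma\colon G\to G$ is a colouring bijection if $\Delta^{(1)}_\sigma,\Delta^{(2)}_\sigma,\Delta^{(3)}_\sigma$ are all bijections of $G$. A group is colourable if it admits a colouring bijection. -}

module Defs where

open import Level using (Level; _⊔_)
open import Data.Nat using (ℕ; zero; suc; _^_; _∸_; _+_)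
open import Data.Integer using (ℤ; +_; -[1+_])
open import Data.Fin using (Fin)
open import Data.Product using (Σ; ∃; ∃₂; _×_; _,_)
open import Relation.Nullary using (¬_)
open import Relation.Binary.PropositionalEquality as ≡ using (_≡_)
open import Function.Bundles using (Inverse)
open import Function.Definitions using (Congruent; Bijective)
open import Algebra.Bundles using (Group)
open import Algebra.Morphism.Structures using (module GroupMorphisms)

module _ {c ℓ : Level} (G : Group c ℓ) where
  open Group G

  pow : Carrier → ℕ → Carrier
  pow x zero    = ε
  pow x (suc n) = x ∙ pow x n

  zpow : Carrier → ℤ → Carrier
  zpow x (+ n)      = pow x n
  zpow x -[1+ n ]   = (pow x (suc n)) ⁻¹

  Δ₁ Δ₂ Δ₃ : (Carrier → Carrier) → Carrier → Carrier
  Δ₁ σ x = σ x ∙ x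
  Δ₂ σ x = x ⁻¹ ∙ σ x
  Δ₃ σ x = (x ⁻¹ ∙ σ x) ∙ x

  IsColouringBijection : (Carrier → Carrier) → Set (c ⊔ ℓ)
  IsColouringBijection σ =
    Congruent _≈_ _≈_ σ ×
    Bijective _≈_ _≈_ σ ×
    Bijective _≈_ _≈_ (Δ₁ σ) ×
    Bijective _≈_ _≈_ (Δ₂ σ) ×
    Bijective _≈_ _≈_ (Δ₃ σ)

  Colourable : Set (c ⊔ ℓ)
  Colourable = Σ (Carrier → Carrier) IsColouringBijection

  HasOrder : ℕ → Set (c ⊔ ℓ)
  HasOrder n = Inverse setoid (≡.setoid (Fin n))

  IsFinite3Group : Set (c ⊔ ℓ)
  IsFinite3Group = ∃ λ k → HasOrder (3 ^ k)

  IsCyclic : Set (c ⊔ ℓ)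
  IsCyclic = ∃ λ g → ∀ x → ∃ λ (m : ℤ) → x ≈ zpow g m

  data Gen (a b : Carrier) : Carrier → Set (c ⊔ ℓ) where
    gen-a : Gen a b a
    gen-b : Gen a b b
    gen-ε : Gen a b ε
    gen-∙ : ∀ {x y} → Gen a b x → Gen a b y → Gen a b (x ∙ y)
    gen-⁻¹ : ∀ {x} → Gen a b x → Gen a b (x ⁻¹)
    gen-≈ : ∀ {x y} → x ≈ y → Gen a b x → Gen a b y

LRelations : {c' ℓ' : Level} (H : Group c' ℓ') → ℕ → Group.Carrier H → Group.Carrier H → Set ℓ'
LRelations H r a b =
  (pow H a (3 ^ (r ∸ 1)) ≈ ε) ×
  (pow H b 3 ≈ ε) ×
  ((b ∙ a) ∙ (b ⁻¹) ≈ pow H a (1 + 3 ^ (r ∸ 2)))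
  where open Group H

-- G ≅ L_r = ⟨ a, b ∣ a^(3^(r-1)) = b^3 = 1, b a b⁻¹ = a^(1+3^(r-2)) ⟩,
-- expressed via the universal property of the presentation: G has
-- elements a, b generating G and satisfying the relations, such that for
-- every group H (in the same universe levels as G) and every pair a', b'
-- of H satisfying the relations there is a homomorphism G → H with
-- a ↦ a', b ↦ b'.
IsPresentedAsL : {c ℓ : Level} (G : Group c ℓ) → ℕ → Set (Level.suc (c ⊔ ℓ))
IsPresentedAsL {c} {ℓ} G r =
  ∃₂ λ (a b : Group.Carrier G) →
    (∀ x → Gen G a b x) ×
    LRelations G r a b ×
    ((H : Group c ℓ) → (a' b' : Group.Carrier H) → LRelations H r a' b' →
      ∃ λ (f : Group.Carrier G → Group.Carrier H) →
        GroupMorphisms.IsGroupHomomorphism (Group.rawGroup G) (Group.rawGroup H) f ×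
        Group._≈_ H (f a) a' × Group._≈_ H (f b) b')

-- The proof is by induction on the order of the group, and only the injectivity of σ, Δ₁σ, Δ₂σ and Δ₃σ has to be
-- carried along. A noncyclic 3-group G has a normal subgroup N = ⟨z⟩ × ⟨y⟩ of type C₃ × C₃ with z central in G, and
-- a colouring of G/N extends to G: on each coset of N one takes a linear map of N that depends on how the
-- representatives of the coset and of its image act on N. There remain two cases.
--
-- If G/N is cyclic, then G is N or of order 27, or isomorphic to L_r, or to C₃ᵗ × C₃, or it is an extension of some C₃ᵗ × C₃
-- by a central C₃ × C₃. The groups C₃ᵗ × C₃, whose quotients by noncyclic subgroups are cyclic, need an explicit map.
--
-- If G/N is L_r with generators a and b, r ≥ 4, then d = a^(3^(r-2)) is central in G and ⟨N, d⟩ is of type C₃³ or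
-- C₉ × C₃. Its quotient is C₃ᵗ × C₃ with t = r - 2, and again a colouring of the quotient extends to G.

module Submission where

open import Defs
open import Level using (Level; _⊔_)
open import Data.Nat using (ℕ; zero; suc; _+_; _*_; _^_; _≤_; _<_; z≤n; s≤s; NonZero; _∸_; _≡ᵇ_)
import Data.Nat.Properties as ℕ
open import Data.Nat.DivMod
open import Data.Nat.Divisibility using (_∣_; divides; _∣?_; ∣m∣n⇒∣m+n; ∣m+n∣m⇒∣n; _∣0; ∣⇒≤; ∣1⇒≡1; m∣m*n)
open import Data.Nat.Coprimality using (Coprime; coprime-divisor)
open import Data.Nat.Induction using (<-wellFounded)
open import Data.Nat.Primality using (prime?; prime⇒irreducible)
open import Data.Nat.Tactic.RingSolver using (solve-∀)
import Data.Integer as ℤ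
open import Data.Fin using (Fin; toℕ; zero; suc; combine; remQuot; fromℕ<; punchOut)
import Data.Fin.Properties as Fin
open import Data.Fin.Properties using (toℕ-injective; toℕ<n; toℕ-fromℕ<; remQuot-combine; any?; injective⇒≤; combine-injective; pigeonhole; suc-injective; punchOut-injective)
open import Data.Bool using (Bool; true; false; if_then_else_; _∧_; not; T)
open import Data.List using (List; []; _∷_)
open import Data.Unit using (tt)
open import Data.Product using (Σ; ∃; ∃₂; _×_; _,_; proj₁; proj₂)
open import Data.Sum using (_⊎_; inj₁; inj₂)
open import Data.Empty using (⊥-elim)
open import Induction.WellFounded using (Acc; acc)
open import Relation.Nullary using (¬_; Dec; yes; no)
open import Relation.Nullary.Decidable using (from-yes; does; ⌊_⌋; dec-true; dec-false; map′; toWitness; fromWitness; toWitnessFalse; fromWitnessFalse)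
open import Relation.Binary.Core using (Rel)
open import Relation.Binary.Definitions using (tri<; tri≈; tri>)
open import Relation.Binary.Structures using (IsEquivalence)
open import Relation.Binary.PropositionalEquality as ≡ using (_≡_; _≢_)
open import Function.Bundles using (Inverse)
open import Function.Definitions using (Congruent; Injective; Surjective)
open import Algebra.Bundles using (Group)
open import Algebra.Structures using (IsGroup)
open import Algebra.Morphism.Structures using (module GroupMorphisms)

-- On an abelian group a linear σ is a colouring as soon as σ, σ + 1 and σ - 1 are invertible. Over
-- C₃ × C₃ there are such matrices, and they can be adapted to the action of the cosets. On a
-- nontrivial cyclic 3-group, or on an abelian 3-group whose cubes form a nontrivial cyclic
-- subgroup, a linear σ acts on that subgroup as multiplication by some u, and one of u, u + 1, u -
-- 1 is divisible by 3. Hence the kernels are never cyclic, the kernel C₉ × C₃ is treated by a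
-- table, and C₃ᵗ × C₃ with t > 1 needs a map that is not linear. Nontrivial cyclic 3-groups have no
-- colouring at all, so the induction breaks off when G/N is cyclic, and the structure of G has to
-- be determined instead. A finite 3-group enters as a central series with factors C₃, along which
-- decidable equality and canonical coset representatives are computed.

-- Unlike pow, this depends on the operations only, so powers in a group and in its quotients agree definitionally.
opaque
  power : ∀ {c} {A : Set c} → (A → A → A) → A → A → ℕ → A
  power _∙_ ε x zero    = ε
  power _∙_ ε x (suc n) = x ∙ power _∙_ ε x n

module Powers {c ℓ : Level} (G : Group c ℓ) where
  open Group G
  open import Algebra.Properties.Group G public
    using (∙-cancelˡ; ∙-cancelʳ; ⁻¹-anti-homo-∙; inverseʳ-unique; inverseˡ-unique)
  open import Relation.Binary.Reasoning.Setoid setoid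

  infixr 9 _↑_
  _↑_ : Carrier → ℕ → Carrier
  _↑_ = power _∙_ ε

  Commute : Carrier → Carrier → Set ℓ
  Commute x y = x ∙ y ≈ y ∙ x

  Central : Carrier → Set (c ⊔ ℓ)
  Central z = ∀ x → Commute z x

  ↑-≡ : ∀ x {m n} → m ≡ n → x ↑ m ≈ x ↑ n
  ↑-≡ x ≡.refl = refl

  opaque
    unfolding power

    ↑-0 : ∀ x → x ↑ 0 ≈ ε
    ↑-0 x = refl

    ↑-suc : ∀ x n → x ↑ suc n ≈ x ∙ x ↑ n
    ↑-suc x n = refl

  ↑-cong : ∀ n {x y} → x ≈ y → x ↑ n ≈ y ↑ n
  ↑-cong zero    _   = trans (↑-0 _) (sym (↑-0 _))
  ↑-cong (suc n) x≈y = trans (↑-suc _ n) (trans (∙-cong x≈y (↑-cong n x≈y)) (sym (↑-suc _ n)))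

  ↑-1 : ∀ x → x ↑ 1 ≈ x
  ↑-1 x = trans (↑-suc x 0) (trans (∙-congˡ (↑-0 x)) (identityʳ x))

  ε-↑ : ∀ n → ε ↑ n ≈ ε
  ε-↑ zero    = ↑-0 ε
  ε-↑ (suc n) = trans (↑-suc ε n) (trans (identityˡ _) (ε-↑ n))

  ↑-+ : ∀ x m n → x ↑ (m + n) ≈ x ↑ m ∙ x ↑ n
  ↑-+ x zero    n = trans (sym (identityˡ _)) (∙-congʳ (sym (↑-0 x)))
  ↑-+ x (suc m) n = trans (↑-suc x (m + n)) (trans (∙-congˡ (↑-+ x m n))
    (trans (sym (assoc _ _ _)) (∙-congʳ (sym (↑-suc x m)))))

  ↑-* : ∀ x m n → x ↑ (m * n) ≈ (x ↑ n) ↑ m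
  ↑-* x zero    n = trans (↑-0 x) (sym (↑-0 _))
  ↑-* x (suc m) n = trans (↑-+ x n (m * n)) (trans (∙-congˡ (↑-* x m n)) (sym (↑-suc _ m)))

  ↑-*′ : ∀ x m n → x ↑ (m * n) ≈ (x ↑ m) ↑ n
  ↑-*′ x m n = trans (↑-≡ x (ℕ.*-comm m n)) (↑-* x n m)

  commute-ε : ∀ x → Commute x ε
  commute-ε x = trans (identityʳ x) (sym (identityˡ x))

  ε-central : Central ε
  ε-central x = sym (commute-ε x)

  commute-∙ : ∀ {x y z} → Commute x y → Commute x z → Commute x (y ∙ z)
  commute-∙ {x} {y} {z} p q = begin
    x ∙ (y ∙ z) ≈⟨ assoc _ _ _ ⟨
    x ∙ y ∙ z ≈⟨ ∙-congʳ p ⟩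
    y ∙ x ∙ z ≈⟨ assoc _ _ _ ⟩
    y ∙ (x ∙ z) ≈⟨ ∙-congˡ q ⟩
    y ∙ (z ∙ x) ≈⟨ assoc _ _ _ ⟨
    y ∙ z ∙ x ∎

  commute-resp : ∀ {x y z} → y ≈ z → Commute x y → Commute x z
  commute-resp e p = trans (∙-congˡ (sym e)) (trans p (∙-congʳ e))

  commute-↑ : ∀ {x y} n → Commute x y → Commute x (y ↑ n)
  commute-↑ zero    p = commute-resp (sym (↑-0 _)) (commute-ε _)
  commute-↑ (suc n) p = commute-resp (sym (↑-suc _ n)) (commute-∙ p (commute-↑ n p))

  central-↑ : ∀ {z} → Central z → ∀ n → Central (z ↑ n)
  central-↑ z-central n x = sym (commute-↑ n (sym (z-central x)))

  commute-↑↑ : ∀ {x y} m n → Commute x y → Commute (x ↑ m) (y ↑ n)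
  commute-↑↑ m n p = sym (commute-↑ m (sym (commute-↑ n p)))

  interchange : ∀ {b c} a d → Commute b c → (a ∙ b) ∙ (c ∙ d) ≈ (a ∙ c) ∙ (b ∙ d)
  interchange {b} {c} a d p = begin
    (a ∙ b) ∙ (c ∙ d) ≈⟨ assoc _ _ _ ⟩
    a ∙ (b ∙ (c ∙ d)) ≈⟨ ∙-congˡ (assoc _ _ _) ⟨
    a ∙ (b ∙ c ∙ d) ≈⟨ ∙-congˡ (∙-congʳ p) ⟩
    a ∙ (c ∙ b ∙ d) ≈⟨ ∙-congˡ (assoc _ _ _) ⟩
    a ∙ (c ∙ (b ∙ d)) ≈⟨ assoc _ _ _ ⟨
    (a ∙ c) ∙ (b ∙ d) ∎

  swapʳ : ∀ {y z} x → Commute y z → x ∙ y ∙ z ≈ x ∙ z ∙ y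
  swapʳ x p = trans (assoc _ _ _) (trans (∙-congˡ p) (sym (assoc _ _ _)))

  ∙-↑ : ∀ {x y} n → Commute x y → (x ∙ y) ↑ n ≈ x ↑ n ∙ y ↑ n
  ∙-↑ zero    p = trans (↑-0 _) (trans (sym (identityˡ ε)) (∙-cong (sym (↑-0 _)) (sym (↑-0 _))))
  ∙-↑ {x} {y} (suc n) p = begin
    (x ∙ y) ↑ suc n ≈⟨ ↑-suc _ n ⟩
    (x ∙ y) ∙ (x ∙ y) ↑ n ≈⟨ ∙-congˡ (∙-↑ n p) ⟩
    (x ∙ y) ∙ (x ↑ n ∙ y ↑ n) ≈⟨ interchange x (y ↑ n) (commute-↑ n (sym p)) ⟩
    (x ∙ x ↑ n) ∙ (y ∙ y ↑ n) ≈⟨ ∙-cong (↑-suc x n) (↑-suc y n) ⟨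
    x ↑ suc n ∙ y ↑ suc n ∎

  ↑-mult : ∀ {x} d k → x ↑ d ≈ ε → x ↑ (k * d) ≈ ε
  ↑-mult {x} d k h = trans (↑-* x k d) (trans (↑-cong k h) (ε-↑ k))

  ↑-% : ∀ {x} d .{{_ : NonZero d}} n → x ↑ d ≈ ε → x ↑ n ≈ x ↑ (n % d)
  ↑-% {x} d n h = begin
    x ↑ n ≈⟨ ↑-≡ x (m≡m%n+[m/n]*n n d) ⟩
    x ↑ (n % d + (n / d) * d) ≈⟨ ↑-+ x (n % d) _ ⟩
    x ↑ (n % d) ∙ x ↑ ((n / d) * d) ≈⟨ ∙-congˡ (↑-mult d (n / d) h) ⟩
    x ↑ (n % d) ∙ ε ≈⟨ identityʳ _ ⟩
    x ↑ (n % d) ∎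

  ↑-≡% : ∀ {x} d .{{_ : NonZero d}} {m n} → x ↑ d ≈ ε → m % d ≡ n % d → x ↑ m ≈ x ↑ n
  ↑-≡% {x} d {m} {n} h e = trans (↑-% d m h) (trans (↑-≡ x e) (sym (↑-% d n h)))

  order3-∤ : ∀ {x} → x ↑ 3 ≈ ε → ¬ x ≈ ε → ∀ n → x ↑ n ≈ ε → n % 3 ≡ 0
  order3-∤ {x} x³ x≉ n h with n % 3 | m%n<n n 3 | trans (sym (↑-% 3 n x³)) h
  ... | 0 | _ | _ = ≡.refl
  ... | 1 | _ | e = ⊥-elim (x≉ (trans (sym (↑-1 x)) e))
  ... | 2 | _ | e = ⊥-elim (x≉ (begin
    x ≈⟨ identityʳ x ⟨
    x ∙ ε ≈⟨ ∙-congˡ e ⟨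
    x ∙ x ↑ 2 ≈⟨ ↑-suc x 2 ⟨
    x ↑ 3 ≈⟨ x³ ⟩
    ε ∎))
  ... | suc (suc (suc _)) | s≤s (s≤s (s≤s ())) | _

  order3-inj : ∀ {x} → x ↑ 3 ≈ ε → ¬ x ≈ ε → ∀ m n → x ↑ m ≈ x ↑ n → m % 3 ≡ n % 3
  order3-inj {x} x³ x≉ m n h = ≡.trans (≡.sym ([m+kn]%n≡m%n m n 3)) (≡.trans (lem m n e) ([m+kn]%n≡m%n n 0 3 ))
    where
    e : (m + 2 * n) % 3 ≡ 0
    e = order3-∤ x³ x≉ (m + 2 * n) (begin
      x ↑ (m + 2 * n) ≈⟨ ↑-+ x m _ ⟩
      x ↑ m ∙ x ↑ (2 * n) ≈⟨ ∙-congʳ h ⟩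
      x ↑ n ∙ x ↑ (2 * n) ≈⟨ ↑-+ x n _ ⟨
      x ↑ (3 * n) ≈⟨ ↑-*′ x 3 n ⟩
      (x ↑ 3) ↑ n ≈⟨ ↑-cong n x³ ⟩
      ε ↑ n ≈⟨ ε-↑ n ⟩
      ε ∎)
    lem : ∀ m n → (m + 2 * n) % 3 ≡ 0 → (m + n * 3) % 3 ≡ (n + 0) % 3
    lem m n e = ≡.trans (≡.cong (_% 3) (rearr m n))
      (≡.trans (%-distribˡ-+ (m + 2 * n) n 3)
        (≡.trans (≡.cong (λ t → (t + n % 3) % 3) e) (≡.trans (m%n%n≡m%n n 3) (≡.cong (_% 3) (≡.sym (ℕ.+-identityʳ n))))))
      where rearr : ∀ m n → m + n * 3 ≡ (m + 2 * n) + n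
            rearr = solve-∀

-- Quotients by central elements of order 3, and central series

module _ {c ℓ : Level} where

  record IsCentral₃ (G : Group c ℓ) (z : Group.Carrier G) : Set (c ⊔ ℓ) where
    constructor central₃
    open Group G
    field
      central : ∀ x → z ∙ x ≈ x ∙ z
      cube    : power _∙_ ε z 3 ≈ ε

  module _ (G : Group c ℓ) {z : Group.Carrier G} (hz : IsCentral₃ G z) where
    open Group G
    open Powers G
    open IsCentral₃ hz
    open import Relation.Binary.Reasoning.Setoid setoid

    private
      z-comm : ∀ n x → Commute x (z ↑ n)
      z-comm n x = commute-↑ n (sym (central x))

      z-cube : ∀ n → z ↑ (n + 2 * n) ≈ ε
      z-cube n = trans (↑-*′ z 3 n) (trans (↑-cong n cube) (ε-↑ n))

    -- The cosets of ⟨z⟩ as a coarser equality on the same carrier. Natural exponents suffice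
    -- because z⁻¹ = z².
    _≈/_ : Rel Carrier ℓ
    x ≈/ y = ∃ λ n → x ≈ y ∙ z ↑ n

    ≈⇒≈/ : ∀ {x y} → x ≈ y → x ≈/ y
    ≈⇒≈/ e = 0 , trans e (trans (sym (identityʳ _)) (∙-congˡ (sym (↑-0 z))))

    abstract
      quotient-isGroup : IsGroup _≈/_ _∙_ ε _⁻¹
      quotient-isGroup = record
          { isMonoid = record
            { isSemigroup = record
              { isMagma = record
                { isEquivalence = record { refl = ≈⇒≈/ refl ; sym = sym/ ; trans = trans/ }
                ; ∙-cong = ∙-cong/ }
              ; assoc = λ x y w → ≈⇒≈/ (assoc x y w) }
            ; identity = (λ x → ≈⇒≈/ (identityˡ x)) , (λ x → ≈⇒≈/ (identityʳ x)) }
          ; inverse = (λ x → ≈⇒≈/ (inverseˡ x)) , (λ x → ≈⇒≈/ (inverseʳ x))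
          ; ⁻¹-cong = ⁻¹-cong/ }
        where
        sym/ : ∀ {x y} → x ≈/ y → y ≈/ x
        sym/ {x} {y} (n , e) = 2 * n , (begin
          y ≈⟨ identityʳ y ⟨
          y ∙ ε ≈⟨ ∙-congˡ (z-cube n) ⟨
          y ∙ z ↑ (n + 2 * n) ≈⟨ ∙-congˡ (↑-+ z n _) ⟩
          y ∙ (z ↑ n ∙ z ↑ (2 * n)) ≈⟨ assoc _ _ _ ⟨
          y ∙ z ↑ n ∙ z ↑ (2 * n) ≈⟨ ∙-congʳ e ⟨
          x ∙ z ↑ (2 * n) ∎)
        trans/ : ∀ {x y w} → x ≈/ y → y ≈/ w → x ≈/ w
        trans/ {x} {y} {w} (n , e) (m , f) = m + n , (begin
          x ≈⟨ e ⟩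
          y ∙ z ↑ n ≈⟨ ∙-congʳ f ⟩
          w ∙ z ↑ m ∙ z ↑ n ≈⟨ assoc _ _ _ ⟩
          w ∙ (z ↑ m ∙ z ↑ n) ≈⟨ ∙-congˡ (↑-+ z m n) ⟨
          w ∙ z ↑ (m + n) ∎)
        ∙-cong/ : ∀ {x y u v} → x ≈/ y → u ≈/ v → (x ∙ u) ≈/ (y ∙ v)
        ∙-cong/ {x} {y} {u} {v} (n , e) (m , f) = n + m , (begin
          x ∙ u ≈⟨ ∙-cong e f ⟩
          (y ∙ z ↑ n) ∙ (v ∙ z ↑ m) ≈⟨ interchange y (z ↑ m) (sym (z-comm n v)) ⟩
          (y ∙ v) ∙ (z ↑ n ∙ z ↑ m) ≈⟨ ∙-congˡ (↑-+ z n m) ⟨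
          (y ∙ v) ∙ z ↑ (n + m) ∎)
        ⁻¹-cong/ : ∀ {x y} → x ≈/ y → (x ⁻¹) ≈/ (y ⁻¹)
        ⁻¹-cong/ {x} {y} (n , e) = 2 * n , sym (inverseʳ-unique x _ (begin
          x ∙ (y ⁻¹ ∙ z ↑ (2 * n)) ≈⟨ ∙-congʳ e ⟩
          (y ∙ z ↑ n) ∙ (y ⁻¹ ∙ z ↑ (2 * n)) ≈⟨ interchange y _ (sym (z-comm n (y ⁻¹))) ⟩
          (y ∙ y ⁻¹) ∙ (z ↑ n ∙ z ↑ (2 * n)) ≈⟨ ∙-cong (inverseʳ y) (trans (sym (↑-+ z n _)) (z-cube n)) ⟩
          ε ∙ ε ≈⟨ identityˡ ε ⟩
          ε ∎))


    quotient : Group c ℓ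
    quotient = record { isGroup = quotient-isGroup }

  -- A central series with factors of order 3, kept as data: the induction on the group computes
  -- with it and counts no elements.
  Chain : ℕ → Group c ℓ → Set (c ⊔ ℓ)
  Chain zero    G = ∀ x → Group._≈_ G x (Group.ε G)
  Chain (suc k) G = Σ (Group.Carrier G) λ z → Σ (IsCentral₃ G z) λ hz →
                    ¬ Group._≈_ G z (Group.ε G) × Chain k (quotient G hz)

  module _ (G : Group c ℓ) {z : Group.Carrier G} (hz : IsCentral₃ G z) (z≉ε : ¬ Group._≈_ G z (Group.ε G)) where
    open Group G
    open Powers G
    open IsCentral₃ hz

    dec-lift : (∀ x y → Dec (Group._≈_ (quotient G hz) x y)) → ∀ x y → Dec (x ≈ y)
    dec-lift dec x y with dec x y
    ... | no x≉y = no (λ e → x≉y (≈⇒≈/ G hz e))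
    ... | yes (n , e) with n % 3 ℕ.≟ 0
    ...   | yes n≡0 = yes (trans e (trans (∙-congˡ (trans (↑-% 3 n cube) (trans (↑-≡ z n≡0) (↑-0 z)))) (identityʳ y)))
    ...   | no n≢0 = no (λ x≈y → n≢0 (order3-∤ cube z≉ε n (∙-cancelˡ y _ _ (trans (sym e) (trans x≈y (sym (identityʳ y)))))))

  Chain-dec : ∀ k (G : Group c ℓ) → Chain k G → ∀ x y → Dec (Group._≈_ G x y)
  Chain-dec zero    G triv x y = yes (trans (triv x) (sym (triv y))) where open Group G
  Chain-dec (suc k) G (z , hz , z≉ε , ch) = dec-lift G hz z≉ε (Chain-dec k _ ch)

  -- Equal elements have canonical forms identical in the sense of `≡`. A choice made at the
  -- canonical representative of a coset therefore respects `≈`, even if the choice itself does not.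
  record Canonical (G : Group c ℓ) : Set (c ⊔ ℓ) where
    open Group G
    field
      canon      : Carrier → Carrier
      canon-≈    : ∀ x → x ≈ canon x
      canon-cong : ∀ {x y} → x ≈ y → canon x ≡ canon y

  Chain-canonical : ∀ k (G : Group c ℓ) → Chain k G → Canonical G
  Chain-canonical zero    G triv = record { canon = λ _ → Group.ε G ; canon-≈ = triv ; canon-cong = λ _ → ≡.refl }
  Chain-canonical (suc k) G (z , hz , z≉ε , ch) = record
    -- The exponent of z is determined only modulo 3, so it is reduced before it enters the
    -- canonical form.
    { canon      = λ x → canon x ∙ z ↑ (exponent x % 3)
    ; canon-≈    = λ x → trans (proj₂ (canon-≈ x)) (∙-congˡ (↑-% 3 (exponent x) cube))
    ; canon-cong = λ {x} {y} x≈y →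
        let cx≡cy = canon-cong (≈⇒≈/ G hz x≈y) in
        ≡.cong₂ (λ u n → u ∙ z ↑ n) cx≡cy
          (order3-inj cube z≉ε (exponent x) (exponent y)
            (∙-cancelˡ (canon x) _ _ (trans (sym (proj₂ (canon-≈ x))) (trans x≈y (trans (proj₂ (canon-≈ y))
              (reflexive (≡.cong (_∙ z ↑ exponent y) (≡.sym cx≡cy)))))))) }
    where
    open Group G
    open Powers G
    open IsCentral₃ hz
    open Canonical (Chain-canonical k _ ch)
    exponent : Carrier → ℕ
    exponent x = proj₁ (canon-≈ x)

  _with≈_ : (G : Group c ℓ) {_≈′_ : Rel (Group.Carrier G) ℓ} → IsGroup _≈′_ (Group._∙_ G) (Group.ε G) (Group._⁻¹ G) → Group c ℓ
  G with≈ isGroup′ = record { isGroup = isGroup′ }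

  -- Quotients reached along different routes share carrier and operations and differ only in
  -- equivalent equalities; this carries a series from one to the other.
  Chain-resp : ∀ k (G : Group c ℓ) {_≈′_} (isG′ : IsGroup _≈′_ (Group._∙_ G) (Group.ε G) (Group._⁻¹ G)) →
               (∀ {x y} → Group._≈_ G x y → x ≈′ y) → (∀ {x y} → x ≈′ y → Group._≈_ G x y) →
               Chain k G → Chain k (G with≈ isG′)
  Chain-resp zero    G isG′ to from triv = λ x → to (triv x)
  Chain-resp (suc k) G isG′ to from (z , hz , z≉ε , ch) =
    z , hz′ , (λ e → z≉ε (from e)) ,
    Chain-resp k (quotient G hz) (Group.isGroup (quotient (G with≈ isG′) hz′))
      (λ (n , e) → n , to e) (λ (n , e) → n , from e) ch
    where
    open IsCentral₃ hz
    hz′ = central₃ (λ x → to (central x)) (to cube)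

  -- If z lies in ⟨z₀⟩, both generate the same subgroup. Otherwise z stays nontrivial in G/⟨z₀⟩, and
  -- recursion gives a series of (G/⟨z₀⟩)/⟨z⟩. This is (G/⟨z⟩)/⟨z₀⟩ with the two exponents
  -- exchanged.
  Chain-quotient : ∀ k (G : Group c ℓ) → Chain (suc k) G → ∀ {z} (hz : IsCentral₃ G z) → ¬ Group._≈_ G z (Group.ε G) →
                   Chain k (quotient G hz)
  Chain-quotient k G (z₀ , hz₀ , z₀≉ε , ch) {z} hz z≉ε with Chain-dec k _ ch z (Group.ε G)
  ... | yes (n , e) = Chain-resp k (quotient G hz₀) (Group.isGroup (quotient G hz)) to from ch
    where
    open Group G
    open Powers G
    open import Relation.Binary.Reasoning.Setoid setoid
    module hz  = IsCentral₃ hz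
    module hz₀ = IsCentral₃ hz₀
    z≈ : z ≈ z₀ ↑ n
    z≈ = trans e (identityˡ _)
    -- Modulo 3, n is 1 or 2 and hence its own inverse.
    z₀≈ : z₀ ≈ z ↑ n
    z₀≈ with n % 3 in eq | m%n<n n 3 | ↑-% 3 n hz₀.cube
    ... | 0 | _ | f = ⊥-elim (z≉ε (trans z≈ (trans f (↑-0 z₀))))
    ... | 1 | _ | f = begin
      z₀ ≈⟨ ↑-1 z₀ ⟨
      z₀ ↑ 1 ≈⟨ f ⟨
      z₀ ↑ n ≈⟨ z≈ ⟨
      z ≈⟨ ↑-1 z ⟨
      z ↑ 1 ≈⟨ ↑-≡% 3 {1} {n} hz.cube (≡.sym eq) ⟩
      z ↑ n ∎
    ... | 2 | _ | f = begin
      z₀ ≈⟨ ↑-1 z₀ ⟨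
      z₀ ↑ 1 ≈⟨ ↑-≡% 3 {1} {4} hz₀.cube ≡.refl ⟩
      z₀ ↑ (2 * 2) ≈⟨ ↑-*′ z₀ 2 2 ⟩
      (z₀ ↑ 2) ↑ 2 ≈⟨ ↑-cong 2 f ⟨
      (z₀ ↑ n) ↑ 2 ≈⟨ ↑-cong 2 z≈ ⟨
      z ↑ 2 ≈⟨ ↑-≡% 3 {2} {n} hz.cube (≡.sym eq) ⟩
      z ↑ n ∎
    ... | suc (suc (suc _)) | s≤s (s≤s (s≤s ())) | _
    to : ∀ {x y} → _≈/_ G hz₀ x y → _≈/_ G hz x y
    to (m , h) = n * m , trans h (∙-congˡ (trans (↑-cong m z₀≈) (sym (↑-*′ z n m))))
    from : ∀ {x y} → _≈/_ G hz x y → _≈/_ G hz₀ x y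
    from (m , h) = n * m , trans h (∙-congˡ (trans (↑-cong m z≈) (sym (↑-*′ z₀ n m))))
  Chain-quotient zero G (z₀ , hz₀ , z₀≉ε , ch) {z} hz z≉ε | no z∉ = ⊥-elim (z∉ (ch z))
  Chain-quotient (suc k) G (z₀ , hz₀ , z₀≉ε , ch) {z} hz z≉ε | no z∉ =
    z₀ , hz₀/z , z₀∉ , Chain-resp k G/z₀/z (Group.isGroup (quotient G/z hz₀/z)) to from
                         (Chain-quotient k (quotient G hz₀) ch hz/z₀ z∉)
    where
    open Group G
    open Powers G
    module hz  = IsCentral₃ hz
    module hz₀ = IsCentral₃ hz₀
    G/z = quotient G hz
    hz/z₀ : IsCentral₃ (quotient G hz₀) z
    hz/z₀ = central₃ (λ x → ≈⇒≈/ G hz₀ (hz.central x)) (≈⇒≈/ G hz₀ hz.cube)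
    hz₀/z : IsCentral₃ G/z z₀
    hz₀/z = central₃ (λ x → ≈⇒≈/ G hz (hz₀.central x)) (≈⇒≈/ G hz hz₀.cube)
    G/z₀/z = quotient (quotient G hz₀) hz/z₀
    z₀∉ : ¬ _≈/_ G hz z₀ ε
    z₀∉ (m , h) with m % 3 in eq | m%n<n m 3 | ↑-% 3 m hz.cube
    ... | 0 | _ | f = z₀≉ε (trans h (trans (identityˡ _) (trans f (↑-0 z))))
    ... | 1 | _ | f = z∉ (1 , trans (sym (↑-1 z)) (trans (sym f) (trans (sym (identityˡ _)) (trans (sym h) (trans (sym (↑-1 z₀)) (sym (identityˡ _)))))))
    ... | 2 | _ | f = z∉ (2 , (begin
        z ≈⟨ ↑-1 z ⟨
        z ↑ 1 ≈⟨ ↑-≡% 3 {1} {4} hz.cube ≡.refl ⟩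
        z ↑ (2 * 2) ≈⟨ ↑-*′ z 2 2 ⟩
        (z ↑ 2) ↑ 2 ≈⟨ ↑-cong 2 f ⟨
        (z ↑ m) ↑ 2 ≈⟨ ↑-cong 2 (trans h (identityˡ _)) ⟨
        z₀ ↑ 2 ≈⟨ identityˡ _ ⟨
        ε ∙ z₀ ↑ 2 ∎))
      where open import Relation.Binary.Reasoning.Setoid setoid
    ... | suc (suc (suc _)) | s≤s (s≤s (s≤s ())) | _
    to : ∀ {x y} → Group._≈_ G/z₀/z x y → _≈/_ G/z hz₀/z x y
    to {x} {y} (n , m , h) = m , n , trans h (swapʳ y (commute-↑↑ n m (hz.central z₀)))
    from : ∀ {x y} → _≈/_ G/z hz₀/z x y → Group._≈_ G/z₀/z x y
    from {x} {y} (m , n , h) = n , m , trans h (swapʳ y (commute-↑↑ m n (hz₀.central z)))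

-- Commutator identities

module Commutators {c ℓ : Level} (G : Group c ℓ) where
  open Group G
  open Powers G
  open import Relation.Binary.Reasoning.Setoid setoid

  -- n² ≡ 1 modulo 3 for n prime to 3.
  order3-root : ∀ {z} → z ↑ 3 ≈ ε → ∀ n → ¬ z ↑ n ≈ ε → z ≈ (z ↑ n) ↑ n
  order3-root {z} z³ n zⁿ≉ = begin
    z ≈⟨ ↑-1 z ⟨
    z ↑ 1 ≈⟨ ↑-≡% 3 {1} {n * n} z³ (≡.sym (square n (λ n%3≡0 → zⁿ≉ (trans (↑-% 3 n z³) (trans (↑-≡ z n%3≡0) (↑-0 z)))))) ⟩
    z ↑ (n * n) ≈⟨ ↑-* z n n ⟩
    (z ↑ n) ↑ n ∎
    where
    square : ∀ n → n % 3 ≢ 0 → (n * n) % 3 ≡ 1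
    square n n≢ with n % 3 in eq | m%n<n n 3
    ... | 0 | _ = ⊥-elim (n≢ ≡.refl)
    ... | 1 | _ = ≡.trans (%-distribˡ-* n n 3) (≡.cong (λ r → (r * r) % 3) eq)
    ... | 2 | _ = ≡.trans (%-distribˡ-* n n 3) (≡.cong (λ r → (r * r) % 3) eq)
    ... | suc (suc (suc _)) | s≤s (s≤s (s≤s ()))

  -- Collecting (uv)³ moves u past v three times in all, which leaves the factor ζ³.
  cube-∙ : ∀ {u v ζ} → v ∙ u ≈ (u ∙ v) ∙ ζ → Central ζ → ζ ↑ 3 ≈ ε → (u ∙ v) ↑ 3 ≈ u ↑ 3 ∙ v ↑ 3
  cube-∙ {u} {v} {ζ} vu ζ-central ζ³ = begin
    (u ∙ v) ↑ 3 ≈⟨ trans (cube (u ∙ v)) (assoc _ _ _) ⟩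
    (u ∙ v) ∙ ((u ∙ v) ∙ (u ∙ v)) ≈⟨ ∙-congˡ (trans step (assoc _ _ _)) ⟩
    (u ∙ v) ∙ ((u ∙ u) ∙ ((v ∙ v) ∙ ζ)) ≈⟨ trans (sym (assoc _ _ _)) (∙-congʳ (trans (sym (assoc _ _ _)) (∙-congʳ twist))) ⟩
    ((u ∙ (u ∙ v)) ∙ ζ ∙ u) ∙ ((v ∙ v) ∙ ζ) ≈⟨ ∙-congʳ (trans (swapʳ _ (ζ-central u)) (∙-congʳ (trans (assoc _ _ _) (trans (∙-congˡ twist) (sym (assoc _ _ _)))))) ⟩
    (u ∙ (u ∙ (u ∙ v)) ∙ ζ ∙ ζ) ∙ ((v ∙ v) ∙ ζ) ≈⟨ trans (∙-congʳ (assoc _ _ _)) (interchange _ _ (trans (assoc _ _ _)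
        (trans (∙-congˡ (ζ-central _)) (trans (sym (assoc _ _ _)) (trans (∙-congʳ (ζ-central _)) (assoc _ _ _)))))) ⟩
    (u ∙ (u ∙ (u ∙ v)) ∙ (v ∙ v)) ∙ (ζ ∙ ζ ∙ ζ) ≈⟨ ∙-cong (trans (trans (∙-congʳ (trans (∙-congˡ (sym (assoc _ _ _)))
        (trans (sym (assoc _ _ _)) (∙-congʳ (sym (assoc _ _ _)))))) (assoc _ _ _)) (∙-cong (sym (cube u)) (trans (sym
        (assoc _ _ _)) (sym (cube v))))) (trans (sym (cube ζ)) ζ³) ⟩
    (u ↑ 3 ∙ v ↑ 3) ∙ ε ≈⟨ identityʳ _ ⟩
    u ↑ 3 ∙ v ↑ 3 ∎
    where
    cube : ∀ x → x ↑ 3 ≈ x ∙ x ∙ x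
    cube x = trans (↑-suc x 2) (trans (∙-congˡ (trans (↑-suc x 1) (∙-congˡ (↑-1 x)))) (sym (assoc _ _ _)))
    twist : (u ∙ v) ∙ u ≈ (u ∙ (u ∙ v)) ∙ ζ
    twist = trans (assoc _ _ _) (trans (∙-congˡ vu) (sym (assoc _ _ _)))
    step : (u ∙ v) ∙ (u ∙ v) ≈ (u ∙ u) ∙ (v ∙ v) ∙ ζ
    step = begin
      (u ∙ v) ∙ (u ∙ v) ≈⟨ assoc _ _ _ ⟨
      (u ∙ v) ∙ u ∙ v ≈⟨ ∙-congʳ twist ⟩
      (u ∙ (u ∙ v)) ∙ ζ ∙ v ≈⟨ swapʳ _ (ζ-central v) ⟩
      (u ∙ (u ∙ v)) ∙ v ∙ ζ ≈⟨ ∙-congʳ (trans (∙-congʳ (sym (assoc _ _ _))) (assoc _ _ _)) ⟩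
      (u ∙ u) ∙ (v ∙ v) ∙ ζ ∎

  conjugate-↑ : ∀ {y t s} → y ∙ t ≈ t ∙ s → ∀ k → y ↑ k ∙ t ≈ t ∙ s ↑ k
  conjugate-↑ {y} {t} {s} h zero    = trans (∙-congʳ (↑-0 y)) (trans (identityˡ t) (trans (sym (identityʳ t)) (∙-congˡ (sym (↑-0 s)))))
  conjugate-↑ {y} {t} {s} h (suc k) = begin
    y ↑ suc k ∙ t ≈⟨ trans (∙-congʳ (↑-suc y k)) (assoc _ _ _) ⟩
    y ∙ (y ↑ k ∙ t) ≈⟨ ∙-congˡ (conjugate-↑ h k) ⟩
    y ∙ (t ∙ s ↑ k) ≈⟨ assoc _ _ _ ⟨
    y ∙ t ∙ s ↑ k ≈⟨ ∙-congʳ h ⟩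
    t ∙ s ∙ s ↑ k ≈⟨ trans (assoc _ _ _) (∙-congˡ (sym (↑-suc s k))) ⟩
    t ∙ s ↑ suc k ∎

  twist-↑ : ∀ {y z t a} → Central z → y ∙ t ≈ t ∙ (y ∙ z ↑ a) → ∀ q → y ∙ t ↑ q ≈ t ↑ q ∙ (y ∙ z ↑ (a * q))
  twist-↑ {y} {z} {t} {a} z-central h zero = begin
    y ∙ t ↑ 0 ≈⟨ commute-resp (sym (↑-0 t)) (commute-ε y) ⟩
    t ↑ 0 ∙ y ≈⟨ ∙-congˡ (identityʳ y) ⟨
    t ↑ 0 ∙ (y ∙ ε) ≈⟨ ∙-congˡ (∙-congˡ (↑-0 z)) ⟨
    t ↑ 0 ∙ (y ∙ z ↑ 0) ≈⟨ ∙-congˡ (∙-congˡ (↑-≡ z (≡.sym (ℕ.*-zeroʳ a)))) ⟩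
    t ↑ 0 ∙ (y ∙ z ↑ (a * 0)) ∎
  twist-↑ {y} {z} {t} {a} z-central h (suc q) = begin
    y ∙ t ↑ suc q ≈⟨ ∙-congˡ (↑-suc t q) ⟩
    y ∙ (t ∙ t ↑ q) ≈⟨ assoc _ _ _ ⟨
    y ∙ t ∙ t ↑ q ≈⟨ ∙-congʳ h ⟩
    t ∙ (y ∙ z ↑ a) ∙ t ↑ q ≈⟨ assoc _ _ _ ⟩
    t ∙ (y ∙ z ↑ a ∙ t ↑ q) ≈⟨ ∙-congˡ (swapʳ y (central-↑ z-central a _)) ⟩
    t ∙ (y ∙ t ↑ q ∙ z ↑ a) ≈⟨ ∙-congˡ (∙-congʳ (twist-↑ z-central h q)) ⟩
    t ∙ (t ↑ q ∙ (y ∙ z ↑ (a * q)) ∙ z ↑ a) ≈⟨ ∙-congˡ (trans (assoc _ _ _) (∙-congˡ (assoc _ _ _))) ⟩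
    t ∙ (t ↑ q ∙ (y ∙ (z ↑ (a * q) ∙ z ↑ a))) ≈⟨ assoc _ _ _ ⟨
    t ∙ t ↑ q ∙ (y ∙ (z ↑ (a * q) ∙ z ↑ a)) ≈⟨ ∙-cong (↑-suc t q) (∙-congˡ (trans (↑-≡ z (eq a q)) (↑-+ z (a * q) a))) ⟨
    t ↑ suc q ∙ (y ∙ z ↑ (a * suc q)) ∎
    where eq : ∀ a q → a * suc q ≡ a * q + a
          eq = solve-∀


-- Extension of colourings

module _ {c ℓ : Level} where

  record InjColouring (G : Group c ℓ) : Set (c ⊔ ℓ) where
    open Group G
    field
      σ      : Carrier → Carrier
      σ-cong : Congruent _≈_ _≈_ σ
      σ-inj  : Injective _≈_ _≈_ σ
      Δ₁-inj : Injective _≈_ _≈_ (Δ₁ G σ)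
      Δ₂-inj : Injective _≈_ _≈_ (Δ₂ G σ)
      Δ₃-inj : Injective _≈_ _≈_ (Δ₃ G σ)

  module _ (G : Group c ℓ) where
    open Group G

    -- A candidate for x ↦ σ x on the coset tN, with values in sN; N is parametrised by ν.
    record LocalColouring {F : Set} (ν : F → Carrier) (_≈Q_ : Rel Carrier ℓ) (t s : Carrier) : Set (c ⊔ ℓ) where
      field
        φ      : F → Carrier
        φ-in   : ∀ n → φ n ≈Q ε
        φ-inj  : ∀ n n′ → φ n ≈ φ n′ → n ≡ n′
        Δ₁-inj : ∀ n n′ → (s ∙ φ n) ∙ (t ∙ ν n) ≈ (s ∙ φ n′) ∙ (t ∙ ν n′) → n ≡ n′
        Δ₂-inj : ∀ n n′ → (t ∙ ν n) ⁻¹ ∙ (s ∙ φ n) ≈ (t ∙ ν n′) ⁻¹ ∙ (s ∙ φ n′) → n ≡ n′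
        Δ₃-inj : ∀ n n′ → ((t ∙ ν n) ⁻¹ ∙ (s ∙ φ n)) ∙ (t ∙ ν n) ≈ ((t ∙ ν n′) ⁻¹ ∙ (s ∙ φ n′)) ∙ (t ∙ ν n′) → n ≡ n′

    module _ {_≈Q_ : Rel Carrier ℓ} (isQ : IsGroup _≈Q_ _∙_ ε _⁻¹)
             (coarser : ∀ {x y} → x ≈ y → x ≈Q y)
             (canonical : Canonical (G with≈ isQ)) (colouring : InjColouring (G with≈ isQ))
             {F : Set} (ν : F → Carrier) (ν-inj : ∀ n n′ → ν n ≈ ν n′ → n ≡ n′)
             (coset : ∀ {x y} → x ≈Q y → Σ F λ n → x ≈ y ∙ ν n)
             (local : ∀ t s → LocalColouring ν _≈Q_ t s) where

      private
        module Q = Group (G with≈ isQ)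
        module τ = InjColouring colouring
        open Canonical canonical renaming (canon to rep; canon-≈ to rep-≈; canon-cong to rep-cong)
        open Powers G using (∙-cancelˡ)
        open LocalColouring

        s : Carrier → Carrier
        s t = rep (τ.σ t)

        index : Carrier → F
        index x = proj₁ (coset (rep-≈ x))

        index-≈ : ∀ x → x ≈ rep x ∙ ν (index x)
        index-≈ x = proj₂ (coset (rep-≈ x))

        loc : ∀ t → LocalColouring ν _≈Q_ t (s t)
        loc t = local t (s t)

        σ : Carrier → Carrier
        σ x = s (rep x) ∙ φ (loc (rep x)) (index x)

        σ-≈Q : ∀ x → σ x ≈Q τ.σ x
        σ-≈Q x = Q.trans (Q.∙-congˡ (φ-in (loc (rep x)) (index x)))
                   (Q.trans (Q.identityʳ _) (Q.trans (Q.sym (rep-≈ _)) (τ.σ-cong (Q.sym (rep-≈ x)))))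

        σ-cong : Congruent _≈_ _≈_ σ
        σ-cong {x} {y} x≈y = reflexive (≡.cong₂ (λ t n → s t ∙ φ (loc t) n) tx≡ty
          (ν-inj _ _ (∙-cancelˡ (rep x) _ _ (trans (sym (index-≈ x)) (trans x≈y (trans (index-≈ y)
            (∙-congʳ (reflexive (≡.sym tx≡ty)))))))))
          where tx≡ty = rep-cong (coarser x≈y)

        -- An identity f between x and its candidate image only has to be checked inside one coset.
        reduce : (f : Carrier → Carrier → Carrier) →
                 (∀ {x x′ y y′} → x ≈ x′ → y ≈ y′ → f x y ≈ f x′ y′) →
                 (∀ {x x′ y y′} → x ≈Q x′ → y ≈Q y′ → f x y ≈Q f x′ y′) →
                 Injective _≈Q_ _≈Q_ (λ x → f x (τ.σ x)) →
                 (∀ t n n′ → f (t ∙ ν n) (s t ∙ φ (loc t) n) ≈ f (t ∙ ν n′) (s t ∙ φ (loc t) n′) → n ≡ n′) →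
                 Injective _≈_ _≈_ (λ x → f x (σ x))
        reduce f f-cong f-congQ τ-inj φ-inj {x} {y} e = trans (index-≈ x) (trans
            (reflexive (≡.cong₂ (λ t n → t ∙ ν n) tx≡ty n≡)) (sym (index-≈ y)))
          where
          x≈Qy : x ≈Q y
          x≈Qy = τ-inj (Q.trans (f-congQ Q.refl (Q.sym (σ-≈Q x)))
                   (Q.trans (coarser e) (f-congQ Q.refl (σ-≈Q y))))
          tx≡ty = rep-cong x≈Qy
          same : ∀ {t t′} n n′ → t ≡ t′ → f (t ∙ ν n) (s t ∙ φ (loc t) n) ≈ f (t′ ∙ ν n′) (s t′ ∙ φ (loc t′) n′) → n ≡ n′
          same n n′ ≡.refl = φ-inj _ n n′
          n≡ : index x ≡ index y
          n≡ = same (index x) (index y) tx≡ty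
                 (trans (f-cong (sym (index-≈ x)) refl) (trans e (f-cong (index-≈ y) refl)))

      extend : InjColouring G
      extend = record
        { σ = σ
        ; σ-cong = σ-cong
        ; σ-inj = reduce (λ x y → y) (λ _ e → e) (λ _ e → e) τ.σ-inj
            (λ t n n′ e → φ-inj (loc t) n n′ (∙-cancelˡ _ _ _ e))
        ; Δ₁-inj = reduce (λ x y → y ∙ x) (λ e f → ∙-cong f e) (λ e f → Q.∙-cong f e) τ.Δ₁-inj
            (λ t n n′ e → Δ₁-inj (loc t) n n′ e)
        ; Δ₂-inj = reduce (λ x y → x ⁻¹ ∙ y) (λ e f → ∙-cong (⁻¹-cong e) f) (λ e f → Q.∙-cong (Q.⁻¹-cong e) f) τ.Δ₂-inj
            (λ t n n′ e → Δ₂-inj (loc t) n n′ e)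
        ; Δ₃-inj = reduce (λ x y → (x ⁻¹ ∙ y) ∙ x) (λ e f → ∙-cong (∙-cong (⁻¹-cong e) f) e)
            (λ e f → Q.∙-cong (Q.∙-cong (Q.⁻¹-cong e) f) e) τ.Δ₃-inj
            (λ t n n′ e → Δ₃-inj (loc t) n n′ e) }

-- Deciding injectivity by evaluation

∧-T : ∀ x {y} → T (x ∧ y) → T x × T y
∧-T true t = tt , t

allᵇ : ∀ n → (Fin n → Bool) → Bool
allᵇ zero    p = true
allᵇ (suc n) p = p zero ∧ allᵇ n (λ i → p (suc i))

allᵇ-sound : ∀ {n} (p : Fin n → Bool) → T (allᵇ n p) → ∀ i → T (p i)
allᵇ-sound {suc n} p t zero    = proj₁ (∧-T (p zero) t)
allᵇ-sound {suc n} p t (suc i) = allᵇ-sound (λ j → p (suc j)) (proj₂ (∧-T (p zero) t)) i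

-- Injectivity is tested on a list of numbers, so that evaluation compares values by `_≡ᵇ_` on `ℕ`.
values : ∀ n → (Fin n → ℕ) → List ℕ
values zero    g = []
values (suc n) g = g zero ∷ values n (λ i → g (suc i))

absentᵇ : ℕ → List ℕ → Bool
absentᵇ x []       = true
absentᵇ x (y ∷ ys) = not (x ≡ᵇ y) ∧ absentᵇ x ys

distinctᵇ : List ℕ → Bool
distinctᵇ []       = true
distinctᵇ (x ∷ xs) = absentᵇ x xs ∧ distinctᵇ xs

absentᵇ-sound : ∀ {n} g x → T (absentᵇ x (values n g)) → ∀ i → x ≢ g i
absentᵇ-sound {suc n} g x t zero e with x ≡ᵇ g zero | ℕ.≡⇒≡ᵇ x (g zero) e
... | true | _ = t
absentᵇ-sound {suc n} g x t (suc i) = absentᵇ-sound (λ i → g (suc i)) x (proj₂ (∧-T (not (x ≡ᵇ g zero)) t)) i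

distinctᵇ-sound : ∀ {n} g → T (distinctᵇ (values n g)) → ∀ i j → g i ≡ g j → i ≡ j
distinctᵇ-sound {suc n} g t i j e with ∧-T (absentᵇ (g zero) (values n (λ i → g (suc i)))) t
distinctᵇ-sound {suc n} g t zero    zero    e | _       = ≡.refl
distinctᵇ-sound {suc n} g t zero    (suc j) e | t₀ , _  = ⊥-elim (absentᵇ-sound _ _ t₀ j e)
distinctᵇ-sound {suc n} g t (suc i) zero    e | t₀ , _  = ⊥-elim (absentᵇ-sound _ _ t₀ i (≡.sym e))
distinctᵇ-sound {suc n} g t (suc i) (suc j) e | _  , t₁ = ≡.cong suc (distinctᵇ-sound (λ i → g (suc i)) t₁ i j e)

ℕ³ : Set
ℕ³ = ℕ × ℕ × ℕ

module Digits (p q r : ℕ) where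

  Index : Set
  Index = Fin p × Fin q × Fin r

  digits : Index → ℕ³
  digits (i , j , k) = toℕ i , toℕ j , toℕ k

  -- The mixed radix number of the reduced triple. Triples that agree modulo p, q and r get the same
  -- code, so computed exponents may stay unreduced.
  code : .{{_ : NonZero p}} .{{_ : NonZero q}} .{{_ : NonZero r}} → ℕ³ → ℕ
  code (i , j , k) = ((i % p) * q + j % q) * r + k % r

  join : Index → Fin (p * (q * r))
  join (i , j , k) = combine i (combine j k)

  split : Fin (p * (q * r)) → Index
  split n = proj₁ (remQuot {p} (q * r) n) , remQuot {q} r (proj₂ (remQuot {p} (q * r) n))

  split-join : ∀ x → split (join x) ≡ x
  split-join (i , j , k) = ≡.trans
    (≡.cong (λ z → proj₁ z , remQuot {q} r (proj₂ z)) (remQuot-combine {p} {q * r} i (combine j k)))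
    (≡.cong (i ,_) (remQuot-combine {q} {r} j k))

  opaque
    injectiveᵇ : .{{_ : NonZero p}} .{{_ : NonZero q}} .{{_ : NonZero r}} → (Index → ℕ³) → Bool
    injectiveᵇ f = distinctᵇ (values (p * (q * r)) (λ n → code (f (split n))))

    injectiveᵇ-sound : .{{_ : NonZero p}} .{{_ : NonZero q}} .{{_ : NonZero r}} →
                       ∀ f → T (injectiveᵇ f) → ∀ x y → code (f x) ≡ code (f y) → x ≡ y
    injectiveᵇ-sound f t x y e = ≡.trans (≡.sym (split-join x)) (≡.trans (≡.cong split
      (distinctᵇ-sound _ t (join x) (join y)
        (≡.trans (≡.cong (λ z → code (f z)) (split-join x)) (≡.trans e (≡.cong (λ z → code (f z)) (≡.sym (split-join y)))))))
      (split-join y))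

-- Maps on the kernels of the extensions

entry : List ℕ → ℕ → ℕ
entry []       _       = 0
entry (x ∷ xs) zero    = x
entry (x ∷ xs) (suc n) = entry xs n

row : List (List ℕ) → ℕ → List ℕ
row []       _       = []
row (x ∷ xs) zero    = x
row (x ∷ xs) (suc n) = row xs n

-- The conditions for a kernel ⟨c⟩ × ⟨e⟩ × ⟨y⟩ of shape 3w × v × 3 with c and e central, in a
-- coset tN mapped to sN, where conjugation by t and s multiplies y by c^(wa) and c^(wb).
module KernelConditions (k w v : ℕ) .{{_ : NonZero v}} where

  -- Exponents of σ(x)x, x⁻¹σ(x) and x⁻¹σ(x)x relative to st, t⁻¹s and t⁻¹st. Signs are written as
  -- factors: k is -1 modulo 3w, and 2 is -1 modulo 3. Conjugation by t⁻¹s multiplies y by c^(w(b -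
  -- a)), whence `2 * b + a`; conjugation by t⁻¹st acts on y as s does, whence `2 * b`.
  δ₁ δ₂ δ₃ : (a b : ℕ) → ℕ³ → ℕ³ → ℕ³
  δ₁ a b (i , l , j) (i′ , l′ , j′) = i′ + w * (a * j′) + i , l′ + l , j′ + j
  δ₂ a b (i , l , j) (i′ , l′ , j′) = i′ + k * i + w * ((2 * b + a) * j) , l′ + 2 * l , j′ + 2 * j
  δ₃ a b (i , l , j) (i′ , l′ , j′) = i′ + w * (a * j′) + w * ((2 * b) * j) , l′ , j′

  open Digits (suc k) v 3 public

  check : (ℕ → ℕ → ℕ³ → ℕ³) → ℕ → ℕ → Bool
  check f a b = injectiveᵇ (λ n → f a b (digits n)) ∧
                injectiveᵇ (λ n → δ₁ a b (digits n) (f a b (digits n))) ∧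
                injectiveᵇ (λ n → δ₂ a b (digits n) (f a b (digits n))) ∧
                injectiveᵇ (λ n → δ₃ a b (digits n) (f a b (digits n)))

  validᵇ : (ℕ → ℕ → ℕ³ → ℕ³) → Bool
  validᵇ f = injectiveᵇ digits ∧ (allᵇ 3 λ a → allᵇ 3 λ b → check f (toℕ a) (toℕ b))

  validᵇ-digits : ∀ f → T (validᵇ f) → T (injectiveᵇ digits)
  validᵇ-digits f t = proj₁ (∧-T (injectiveᵇ digits) t)

  validᵇ-sound : ∀ f → T (validᵇ f) → ∀ {a b} → a < 3 → b < 3 → T (check f a b)
  validᵇ-sound f t a<3 b<3 = ≡.subst₂ (λ a b → T (check f a b)) (toℕ-fromℕ< a<3) (toℕ-fromℕ< b<3)
    (allᵇ-sound (λ b → check f _ (toℕ b)) (allᵇ-sound (λ a → allᵇ 3 λ b → check f (toℕ a) (toℕ b)) (proj₂ (∧-T (injectiveᵇ digits) t)) (fromℕ< a<3)) (fromℕ< b<3))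

-- This map and the table of cyclic9KernelMap were found by computer search.
linearKernelMap : ℕ → ℕ → ℕ³ → ℕ³
linearKernelMap a b (i , l , j) = u * j , l + j , i + l + (u + 2 * a) * j
  where
  -- Invertibility modulo 3 requires that u is not 0 (for σ), not b (for Δ₃) and, if v = 1, not -1 -
  -- b (for Δ₂). This leaves exactly 1, 2, 1 for b = 0, 1, 2. In the determinant of Δ₁ the summand
  -- 2a cancels the twist by a, and u drops out.
  u : ℕ
  u = 1 + 2 * (b * suc b)

cyclic9KernelMap : ℕ → ℕ → ℕ³ → ℕ³
cyclic9KernelMap a b (i , l , j) = decode (entry (row table (3 * a + b)) (3 * i + j))
  where
  decode : ℕ → ℕ³
  decode n = n / 3 , 0 , n % 3
  -- Row 3a + b, column 3i + j; the entry 3i′ + j′ stands for the image of (i, j).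
  table : List (List ℕ)
  table =
    (18 ∷ 4 ∷ 17 ∷ 8 ∷ 24 ∷ 2 ∷ 20 ∷ 23 ∷ 7 ∷ 15 ∷ 10 ∷ 1 ∷ 13 ∷ 9 ∷ 21 ∷ 26 ∷ 3 ∷ 12 ∷ 22 ∷ 5 ∷ 25 ∷ 16 ∷ 14 ∷ 0 ∷ 6 ∷ 19 ∷ 11 ∷ []) ∷
    (18 ∷ 21 ∷ 20 ∷ 25 ∷ 9 ∷ 0 ∷ 15 ∷ 19 ∷ 7 ∷ 1 ∷ 17 ∷ 12 ∷ 22 ∷ 26 ∷ 4 ∷ 5 ∷ 13 ∷ 2 ∷ 23 ∷ 6 ∷ 24 ∷ 14 ∷ 16 ∷ 11 ∷ 3 ∷ 8 ∷ 10 ∷ []) ∷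
    (18 ∷ 24 ∷ 9 ∷ 1 ∷ 8 ∷ 3 ∷ 23 ∷ 7 ∷ 16 ∷ 13 ∷ 22 ∷ 4 ∷ 12 ∷ 10 ∷ 19 ∷ 25 ∷ 2 ∷ 14 ∷ 15 ∷ 0 ∷ 6 ∷ 26 ∷ 21 ∷ 17 ∷ 20 ∷ 5 ∷ 11 ∷ []) ∷
    (18 ∷ 20 ∷ 13 ∷ 10 ∷ 7 ∷ 11 ∷ 19 ∷ 25 ∷ 1 ∷ 17 ∷ 16 ∷ 21 ∷ 4 ∷ 24 ∷ 26 ∷ 9 ∷ 3 ∷ 12 ∷ 2 ∷ 5 ∷ 8 ∷ 14 ∷ 23 ∷ 0 ∷ 6 ∷ 15 ∷ 22 ∷ []) ∷
    (18 ∷ 21 ∷ 15 ∷ 16 ∷ 9 ∷ 0 ∷ 6 ∷ 2 ∷ 20 ∷ 11 ∷ 24 ∷ 12 ∷ 23 ∷ 14 ∷ 17 ∷ 7 ∷ 26 ∷ 5 ∷ 25 ∷ 13 ∷ 10 ∷ 8 ∷ 4 ∷ 19 ∷ 3 ∷ 22 ∷ 1 ∷ []) ∷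
    (18 ∷ 5 ∷ 9 ∷ 8 ∷ 17 ∷ 3 ∷ 19 ∷ 1 ∷ 24 ∷ 23 ∷ 7 ∷ 16 ∷ 12 ∷ 11 ∷ 26 ∷ 13 ∷ 22 ∷ 4 ∷ 25 ∷ 0 ∷ 14 ∷ 2 ∷ 21 ∷ 20 ∷ 6 ∷ 15 ∷ 10 ∷ []) ∷
    (18 ∷ 8 ∷ 9 ∷ 13 ∷ 24 ∷ 2 ∷ 1 ∷ 10 ∷ 25 ∷ 26 ∷ 23 ∷ 14 ∷ 11 ∷ 22 ∷ 7 ∷ 16 ∷ 3 ∷ 12 ∷ 15 ∷ 4 ∷ 19 ∷ 17 ∷ 21 ∷ 0 ∷ 6 ∷ 20 ∷ 5 ∷ []) ∷
    (18 ∷ 21 ∷ 15 ∷ 7 ∷ 9 ∷ 0 ∷ 6 ∷ 11 ∷ 2 ∷ 20 ∷ 24 ∷ 12 ∷ 5 ∷ 23 ∷ 26 ∷ 25 ∷ 8 ∷ 14 ∷ 16 ∷ 4 ∷ 1 ∷ 17 ∷ 22 ∷ 10 ∷ 3 ∷ 13 ∷ 19 ∷ []) ∷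
    (18 ∷ 14 ∷ 9 ∷ 17 ∷ 26 ∷ 3 ∷ 10 ∷ 19 ∷ 24 ∷ 5 ∷ 25 ∷ 7 ∷ 12 ∷ 20 ∷ 8 ∷ 4 ∷ 13 ∷ 22 ∷ 16 ∷ 0 ∷ 23 ∷ 11 ∷ 21 ∷ 2 ∷ 6 ∷ 15 ∷ 1 ∷ []) ∷ []

opaque
  unfolding Digits.injectiveᵇ

  linear-valid₁ : T (KernelConditions.validᵇ 2 1 1 linearKernelMap)
  linear-valid₁ = tt

  linear-valid₃ : T (KernelConditions.validᵇ 2 1 3 linearKernelMap)
  linear-valid₃ = tt

  cyclic9-valid : T (KernelConditions.validᵇ 8 3 1 cyclic9KernelMap)
  cyclic9-valid = tt

-- The parameter w places the commutators of y in the subgroup of order 3 generated by d^w. The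
-- kernels C₃ × C₃ (v = 1, e trivial) and C₃³ (v = 3) have w = 1, and C₉ × C₃ has w = 3.
module KernelColouring {c ℓ : Level} (G : Group c ℓ) (k w v : ℕ) .{{_ : NonZero v}} (3w≡ : 3 * w ≡ suc k)
    (f : ℕ → ℕ → ℕ³ → ℕ³) (valid : T (KernelConditions.validᵇ k w v f)) where
  open Group G
  open Powers G
  open Commutators G
  open KernelConditions k w v
  open import Relation.Binary.Reasoning.Setoid setoid

  module _ {d e y : Carrier} (d-central : Central d) (e-central : Central e)
      (dˢᵏ : d ↑ suc k ≈ ε) (e³ : e ↑ 3 ≈ ε) (y³ : y ↑ 3 ≈ ε) where

    ν : ℕ³ → Carrier
    ν (i , l , j) = (d ↑ i ∙ e ↑ l) ∙ y ↑ j

    module _ (ν-inj : ∀ m n → ν m ≈ ν n → code m ≡ code n)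
        (action : ∀ t → ∃ λ a → y ∙ t ≈ t ∙ (y ∙ d ↑ (w * a)))
        {_≈Q_ : Rel Carrier ℓ} (ν-in : ∀ n → ν n ≈Q ε) where

      private
        central-∙ : ∀ {u z} → Central u → Central z → Central (u ∙ z)
        central-∙ p q x = sym (commute-∙ (sym (p x)) (sym (q x)))

        de-central : ∀ i l → Central (d ↑ i ∙ e ↑ l)
        de-central i l = central-∙ (central-↑ d-central i) (central-↑ e-central l)

        Acts : Carrier → ℕ → Set ℓ
        Acts t a = y ∙ t ≈ t ∙ (y ∙ d ↑ (w * a))

        acts-↑ : ∀ {t a} → Acts t a → ∀ j → y ↑ j ∙ t ≈ t ∙ (y ↑ j ∙ d ↑ (w * (a * j)))
        acts-↑ {t} {a} h j = trans (conjugate-↑ h j) (∙-congˡ (trans (∙-↑ j (sym (central-↑ d-central _ y)))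
          (∙-congˡ (trans (sym (↑-*′ d (w * a) j)) (↑-≡ d (ℕ.*-assoc w a j))))))

        ν-∙ : ∀ i l j i′ l′ j′ → ν (i , l , j) ∙ ν (i′ , l′ , j′) ≈ ν (i + i′ , l + l′ , j + j′)
        ν-∙ i l j i′ l′ j′ = begin
          ((d ↑ i ∙ e ↑ l) ∙ y ↑ j) ∙ ((d ↑ i′ ∙ e ↑ l′) ∙ y ↑ j′) ≈⟨ interchange _ _ (sym (de-central i′ l′ _)) ⟩
          ((d ↑ i ∙ e ↑ l) ∙ (d ↑ i′ ∙ e ↑ l′)) ∙ (y ↑ j ∙ y ↑ j′) ≈⟨ ∙-cong (interchange _ _ (central-↑ e-central l _)) (sym (↑-+ y j j′)) ⟩
          ((d ↑ i ∙ d ↑ i′) ∙ (e ↑ l ∙ e ↑ l′)) ∙ y ↑ (j + j′) ≈⟨ ∙-congʳ (∙-cong (↑-+ d i i′) (↑-+ e l l′)) ⟨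
          (d ↑ (i + i′) ∙ e ↑ (l + l′)) ∙ y ↑ (j + j′) ∎

        ν-acts : ∀ {t a} → Acts t a → ∀ i l j → ν (i , l , j) ∙ t ≈ t ∙ ν (i + w * (a * j) , l , j)
        ν-acts {t} {a} h i l j = begin
          ((d ↑ i ∙ e ↑ l) ∙ y ↑ j) ∙ t ≈⟨ assoc _ _ _ ⟩
          (d ↑ i ∙ e ↑ l) ∙ (y ↑ j ∙ t) ≈⟨ ∙-congˡ (acts-↑ h j) ⟩
          (d ↑ i ∙ e ↑ l) ∙ (t ∙ (y ↑ j ∙ d ↑ (w * (a * j)))) ≈⟨ assoc _ _ _ ⟨
          ((d ↑ i ∙ e ↑ l) ∙ t) ∙ (y ↑ j ∙ d ↑ (w * (a * j))) ≈⟨ ∙-congʳ (de-central i l t) ⟩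
          (t ∙ (d ↑ i ∙ e ↑ l)) ∙ (y ↑ j ∙ d ↑ (w * (a * j))) ≈⟨ assoc _ _ _ ⟩
          t ∙ ((d ↑ i ∙ e ↑ l) ∙ (y ↑ j ∙ d ↑ (w * (a * j)))) ≈⟨ ∙-congˡ (∙-congˡ (central-↑ d-central _ _)) ⟨
          t ∙ ((d ↑ i ∙ e ↑ l) ∙ (d ↑ (w * (a * j)) ∙ y ↑ j)) ≈⟨ ∙-congˡ (assoc _ _ _) ⟨
          t ∙ (((d ↑ i ∙ e ↑ l) ∙ d ↑ (w * (a * j))) ∙ y ↑ j) ≈⟨ ∙-congˡ (∙-congʳ (swapʳ _ (central-↑ e-central l _))) ⟩
          t ∙ (((d ↑ i ∙ d ↑ (w * (a * j))) ∙ e ↑ l) ∙ y ↑ j) ≈⟨ ∙-congˡ (∙-congʳ (∙-congʳ (↑-+ d i _))) ⟨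
          t ∙ ν (i + w * (a * j) , l , j) ∎

        product : ∀ {t a} → Acts t a → ∀ s i l j i′ l′ j′ →
                  (s ∙ ν (i , l , j)) ∙ (t ∙ ν (i′ , l′ , j′)) ≈ (s ∙ t) ∙ ν (i + w * (a * j) + i′ , l + l′ , j + j′)
        product {t} {a} h s i l j i′ l′ j′ = begin
          (s ∙ ν (i , l , j)) ∙ (t ∙ ν (i′ , l′ , j′)) ≈⟨ assoc _ _ _ ⟩
          s ∙ (ν (i , l , j) ∙ (t ∙ ν (i′ , l′ , j′))) ≈⟨ ∙-congˡ (assoc _ _ _) ⟨
          s ∙ ((ν (i , l , j) ∙ t) ∙ ν (i′ , l′ , j′)) ≈⟨ ∙-congˡ (∙-congʳ (ν-acts h i l j)) ⟩
          s ∙ ((t ∙ ν (i + w * (a * j) , l , j)) ∙ ν (i′ , l′ , j′)) ≈⟨ ∙-congˡ (assoc _ _ _) ⟩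
          s ∙ (t ∙ (ν (i + w * (a * j) , l , j) ∙ ν (i′ , l′ , j′))) ≈⟨ assoc _ _ _ ⟨
          (s ∙ t) ∙ (ν (i + w * (a * j) , l , j) ∙ ν (i′ , l′ , j′)) ≈⟨ ∙-congˡ (ν-∙ _ l j i′ l′ j′) ⟩
          (s ∙ t) ∙ ν (i + w * (a * j) + i′ , l + l′ , j + j′) ∎

        d³ʷ : ∀ n → d ↑ (n * (3 * w)) ≈ ε
        d³ʷ n = ↑-mult (3 * w) n (trans (↑-≡ d 3w≡) dˢᵏ)

        acts-% : ∀ {t a} → Acts t a → Acts t (a % 3)
        acts-% {t} {a} h = trans h (∙-congˡ (∙-congˡ (begin
          d ↑ (w * a) ≈⟨ ↑-≡ d (≡.trans (≡.cong (w *_) (m≡m%n+[m/n]*n a 3)) (eq w (a % 3) (a / 3))) ⟩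
          d ↑ (w * (a % 3) + (a / 3) * (3 * w)) ≈⟨ ↑-+ d (w * (a % 3)) _ ⟩
          d ↑ (w * (a % 3)) ∙ d ↑ ((a / 3) * (3 * w)) ≈⟨ ∙-congˡ (d³ʷ (a / 3)) ⟩
          d ↑ (w * (a % 3)) ∙ ε ≈⟨ identityʳ _ ⟩
          d ↑ (w * (a % 3)) ∎)))
          where eq : ∀ w r q → w * (r + q * 3) ≡ w * r + q * (3 * w)
                eq = solve-∀

        -- An exponent that describes the action of t is arbitrary; only the power d^(wa) depends on
        -- t alone. Actions are therefore compared through powers of d.
        acts-unique : ∀ {t a b} → Acts t a → Acts t b → d ↑ (w * a) ≈ d ↑ (w * b)
        acts-unique {t} h h′ = ∙-cancelˡ y _ _ (∙-cancelˡ t _ _ (trans (sym h) h′))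

        acts-∙ : ∀ {s t a b} → Acts s a → Acts t b → Acts (s ∙ t) (a + b)
        acts-∙ {s} {t} {a} {b} h h′ = begin
          y ∙ (s ∙ t) ≈⟨ assoc _ _ _ ⟨
          (y ∙ s) ∙ t ≈⟨ ∙-congʳ h ⟩
          (s ∙ (y ∙ d ↑ (w * a))) ∙ t ≈⟨ assoc _ _ _ ⟩
          s ∙ ((y ∙ d ↑ (w * a)) ∙ t) ≈⟨ ∙-congˡ (swapʳ y (central-↑ d-central _ t)) ⟩
          s ∙ ((y ∙ t) ∙ d ↑ (w * a)) ≈⟨ ∙-congˡ (∙-congʳ h′) ⟩
          s ∙ ((t ∙ (y ∙ d ↑ (w * b))) ∙ d ↑ (w * a)) ≈⟨ ∙-congˡ (trans (assoc _ _ _) (∙-congˡ (assoc _ _ _))) ⟩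
          s ∙ (t ∙ (y ∙ (d ↑ (w * b) ∙ d ↑ (w * a)))) ≈⟨ assoc _ _ _ ⟨
          (s ∙ t) ∙ (y ∙ (d ↑ (w * b) ∙ d ↑ (w * a))) ≈⟨ ∙-congˡ (∙-congˡ (trans (sym (↑-+ d (w * b) _)) (↑-≡ d (eq w a b)))) ⟩
          (s ∙ t) ∙ (y ∙ d ↑ (w * (a + b))) ∎
          where eq : ∀ w a b → w * b + w * a ≡ w * (a + b)
                eq = solve-∀

        acts-resp : ∀ {s t a} → s ≈ t → Acts s a → Acts t a
        acts-resp e h = trans (∙-congˡ (sym e)) (trans h (∙-congʳ e))

        cancel-t : ∀ t s → t ∙ (t ⁻¹ ∙ s) ≈ s
        cancel-t t s = trans (sym (assoc _ _ _)) (trans (∙-congʳ (inverseʳ t)) (identityˡ s))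

        solve-⁻¹ : ∀ {x u z} → x ∙ u ≈ z → x ⁻¹ ∙ z ≈ u
        solve-⁻¹ {x} {u} {z} h = trans (∙-congˡ (sym h)) (trans (sym (assoc _ _ _)) (trans (∙-congʳ (inverseˡ x)) (identityˡ u)))

        -- If a and b describe the same action, a + 2b may be replaced by 3b, and 3w annihilates d.
        d-vanish : ∀ {a b} j → d ↑ (w * a) ≈ d ↑ (w * b) → d ↑ (w * ((a + 2 * b) * j)) ≈ ε
        d-vanish {a} {b} j h = begin
          d ↑ (w * ((a + 2 * b) * j)) ≈⟨ ↑-≡ d (eq₁ w a b j) ⟩
          d ↑ ((w * a + w * (2 * b)) * j) ≈⟨ ↑-*′ d _ j ⟩
          (d ↑ (w * a + w * (2 * b))) ↑ j ≈⟨ ↑-cong j (trans (↑-+ d (w * a) _) (trans (∙-congʳ h) (sym (↑-+ d (w * b) _)))) ⟩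
          (d ↑ (w * b + w * (2 * b))) ↑ j ≈⟨ ↑-cong j (trans (↑-≡ d (eq₂ w b)) (d³ʷ b)) ⟩
          ε ↑ j ≈⟨ ε-↑ j ⟩
          ε ∎
          where eq₁ : ∀ w a b j → w * ((a + 2 * b) * j) ≡ (w * a + w * (2 * b)) * j
                eq₁ = solve-∀
                eq₂ : ∀ w b → w * b + w * (2 * b) ≡ b * (3 * w)
                eq₂ = solve-∀

        ↑-drop : ∀ x m n {l} → l ≡ m + n → x ↑ n ≈ ε → x ↑ l ≈ x ↑ m
        ↑-drop x m n e h = trans (↑-≡ x e) (trans (↑-+ x m n) (trans (∙-congˡ h) (identityʳ _)))

        cube-drop : ∀ {x} → x ↑ 3 ≈ ε → ∀ l l′ → x ↑ (l + (l′ + 2 * l)) ≈ x ↑ l′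
        cube-drop {x} x³ l l′ = ↑-drop x l′ (l * 3) (eq l l′) (↑-mult 3 l x³)
          where eq : ∀ l l′ → l + (l′ + 2 * l) ≡ l′ + l * 3
                eq = solve-∀

      module _ (t s : Carrier) where

        private
          a₀ b₀ : ∃ λ a → y ∙ _ ≈ _ ∙ (y ∙ d ↑ (w * a))
          a₀ = action t
          b₀ = action s

          a b : ℕ
          a = proj₁ a₀ % 3
          b = proj₁ b₀ % 3

          t-acts : Acts t a
          t-acts = acts-% {t} {proj₁ a₀} (proj₂ a₀)

          s-acts : Acts s b
          s-acts = acts-% {s} {proj₁ b₀} (proj₂ b₀)

          f′ : Index → ℕ³
          f′ n = f a b (digits n)

          φ : Index → Carrier
          φ n = ν (f′ n)

          ν′ : Index → Carrier
          ν′ n = ν (digits n)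

          Δ₁-eq : ∀ n → (s ∙ φ n) ∙ (t ∙ ν′ n) ≈ (s ∙ t) ∙ ν (δ₁ a b (digits n) (f′ n))
          Δ₁-eq n = product {t} {a} t-acts s _ _ _ _ _ _

          r : Carrier
          r = t ⁻¹ ∙ s

          Δ₂-eq : ∀ n → (t ∙ ν′ n) ⁻¹ ∙ (s ∙ φ n) ≈ r ∙ ν (δ₂ a b (digits n) (f′ n))
          Δ₂-eq n@(i₀ , l₀ , j₀) with action r
          -- Multiplication by tν removes the inverse. Since t r = s, the exponents a + a₂ and b
          -- describe the same action, and the commutator terms that collect on the left vanish.
          ... | a₂ , r-acts = solve-⁻¹ (begin
            (t ∙ ν′ n) ∙ (r ∙ ν (δ₂ a b (digits n) (f′ n)))
              ≈⟨ product {r} {a₂} r-acts t i l j (i′ + k * i + w * ((2 * b + a) * j)) (l′ + 2 * l) (j′ + 2 * j) ⟩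
            (t ∙ r) ∙ ν (i + w * (a₂ * j) + (i′ + k * i + w * ((2 * b + a) * j)) , l + (l′ + 2 * l) , j + (j′ + 2 * j))
              ≈⟨ ∙-cong (cancel-t t s) (∙-cong (∙-cong d-eq (cube-drop e³ l l′)) (cube-drop y³ j j′)) ⟩
            s ∙ φ n ∎)
            where
            i = toℕ i₀
            l = toℕ l₀
            j = toℕ j₀
            i′ = proj₁ (f′ n)
            l′ = proj₁ (proj₂ (f′ n))
            j′ = proj₂ (proj₂ (f′ n))
            eq : ∀ w k a a₂ b i i′ j → i + w * (a₂ * j) + (i′ + k * i + w * ((2 * b + a) * j)) ≡ i′ + (i * suc k + w * ((a + a₂ + 2 * b) * j))
            eq = solve-∀
            d-eq : d ↑ (i + w * (a₂ * j) + (i′ + k * i + w * ((2 * b + a) * j))) ≈ d ↑ i′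
            d-eq = ↑-drop d i′ _ (eq w k a a₂ b i i′ j) (trans (↑-+ d (i * suc k) _) (trans (∙-cong (↑-mult (suc k) i dˢᵏ)
              (d-vanish {a + a₂} {b} j (acts-unique {s} {a + a₂} {b} (acts-resp {t ∙ r} {s} {a + a₂} (cancel-t t s) (acts-∙ {t} {r} {a} {a₂} t-acts r-acts)) s-acts)))
              (identityʳ ε)))

          q : Carrier
          q = t ⁻¹ ∙ (s ∙ t)

          Δ₃-eq : ∀ n → ((t ∙ ν′ n) ⁻¹ ∙ (s ∙ φ n)) ∙ (t ∙ ν′ n) ≈ q ∙ ν (δ₃ a b (digits n) (f′ n))
          Δ₃-eq n@(i₀ , l₀ , j₀) with action q
          -- Since t q = s t, the element q acts on y by the same power of d as s.
          ... | a₃ , q-acts = trans (assoc _ _ _) (solve-⁻¹ (begin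
            (t ∙ ν′ n) ∙ (q ∙ ν (δ₃ a b (digits n) (f′ n)))
              ≈⟨ product {q} {a₃} q-acts t i l j (i′ + w * (a * j′) + w * ((2 * b) * j)) l′ j′ ⟩
            (t ∙ q) ∙ ν (i + w * (a₃ * j) + (i′ + w * (a * j′) + w * ((2 * b) * j)) , l + l′ , j + j′)
              ≈⟨ ∙-cong (cancel-t t (s ∙ t)) (∙-cong (∙-cong d-eq (↑-≡ e (ℕ.+-comm l l′))) (↑-≡ y (ℕ.+-comm j j′))) ⟩
            (s ∙ t) ∙ ν (δ₁ a b (digits n) (f′ n))
              ≈⟨ Δ₁-eq n ⟨
            (s ∙ φ n) ∙ (t ∙ ν′ n) ∎))
            where
            i = toℕ i₀
            l = toℕ l₀
            j = toℕ j₀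
            i′ = proj₁ (f′ n)
            l′ = proj₁ (proj₂ (f′ n))
            j′ = proj₂ (proj₂ (f′ n))
            eq : ∀ w a₃ b i i′ j x → i + w * (a₃ * j) + (i′ + x + w * ((2 * b) * j)) ≡ (i′ + x + i) + w * ((a₃ + 2 * b) * j)
            eq = solve-∀
            eq′ : ∀ w a b → w * (a + b) ≡ w * a + w * b
            eq′ = solve-∀
            a₃≈b : d ↑ (w * a₃) ≈ d ↑ (w * b)
            a₃≈b = ∙-cancelˡ (d ↑ (w * a)) _ _ (trans (sym (trans (↑-≡ d (eq′ w a a₃)) (↑-+ d (w * a) _))) (trans
              (acts-unique {s ∙ t} {a + a₃} {b + a}
                (acts-resp {t ∙ q} {s ∙ t} {a + a₃} (cancel-t t (s ∙ t)) (acts-∙ {t} {q} {a} {a₃} t-acts q-acts))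
                (acts-∙ {s} {t} {b} {a} s-acts t-acts))
              (trans (↑-≡ d (≡.trans (≡.cong (w *_) (ℕ.+-comm b a)) (eq′ w a b))) (↑-+ d (w * a) _))))
            d-eq : d ↑ (i + w * (a₃ * j) + (i′ + w * (a * j′) + w * ((2 * b) * j))) ≈ d ↑ (i′ + w * (a * j′) + i)
            d-eq = ↑-drop d _ _ (eq w a₃ b i i′ j (w * (a * j′))) (d-vanish {a₃} {b} j a₃≈b)

          checked : T (check f a b)
          checked = validᵇ-sound f valid (m%n<n (proj₁ a₀) 3) (m%n<n (proj₁ b₀) 3)

          check₀ = ∧-T (injectiveᵇ f′) checked
          check₁ = ∧-T (injectiveᵇ (λ n → δ₁ a b (digits n) (f′ n))) (proj₂ check₀)
          check₂ = ∧-T (injectiveᵇ (λ n → δ₂ a b (digits n) (f′ n))) (proj₂ check₁)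

          by-code : ∀ g → T (injectiveᵇ g) → ∀ {x : Index → Carrier} {u} → (∀ n → x n ≈ u ∙ ν (g n)) →
                    ∀ n n′ → x n ≈ x n′ → n ≡ n′
          by-code g ok x≈ n n′ e = injectiveᵇ-sound g ok n n′
            (ν-inj (g n) (g n′) (∙-cancelˡ _ _ _ (trans (sym (x≈ n)) (trans e (x≈ n′)))))

        localColouring : LocalColouring G ν′ _≈Q_ t s
        localColouring = record
          { φ      = φ
          ; φ-in   = λ n → ν-in (f′ n)
          ; φ-inj  = λ n n′ e → injectiveᵇ-sound f′ (proj₁ check₀) n n′ (ν-inj _ _ e)
          ; Δ₁-inj = by-code _ (proj₁ check₁) Δ₁-eq
          ; Δ₂-inj = by-code _ (proj₁ check₂) Δ₂-eq
          ; Δ₃-inj = by-code _ (proj₂ check₂) Δ₃-eq }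

      kernel-extension : (isQ : IsGroup _≈Q_ _∙_ ε _⁻¹) → (∀ {x x′} → x ≈ x′ → x ≈Q x′) →
                         Canonical (G with≈ isQ) → InjColouring (G with≈ isQ) → e ↑ v ≈ ε →
                         (∀ {x x′} → x ≈Q x′ → ∃ λ n → x ≈ x′ ∙ ν n) → InjColouring G
      kernel-extension isQ coarser canonical colouring eᵛ coset = extend G isQ coarser canonical colouring
          (λ n → ν (digits n))
          (λ n n′ h → injectiveᵇ-sound digits (validᵇ-digits f valid) n n′ (ν-inj _ _ h))
          (λ h → reduce (proj₁ (coset h)) , trans (proj₂ (coset h)) (∙-congˡ (reduce-≈ (proj₁ (coset h)))))
          localColouring
        where
        reduce : ℕ³ → Index
        reduce (i , l , j) = fromℕ< (m%n<n i (suc k)) , fromℕ< (m%n<n l v) , fromℕ< (m%n<n j 3)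
        reduce-≈ : ∀ n → ν n ≈ ν (digits (reduce n))
        reduce-≈ (i , l , j) = ∙-cong (∙-cong
          (trans (↑-% (suc k) i dˢᵏ) (↑-≡ d (≡.sym (toℕ-fromℕ< (m%n<n i (suc k))))))
          (trans (↑-% v l eᵛ) (↑-≡ e (≡.sym (toℕ-fromℕ< (m%n<n l v))))))
          (trans (↑-% 3 j y³) (↑-≡ y (≡.sym (toℕ-fromℕ< (m%n<n j 3)))))

module _ {c ℓ : Level} (G : Group c ℓ) where
  open Group G
  open Powers G

  module Parametrised {F : Set} (u : F → Carrier) (index : Carrier → F)
      (u-index : ∀ x → x ≈ u (index x)) (index-cong : ∀ {x y} → x ≈ y → index x ≡ index y) (φ : F → Carrier) where

    private
      descend : (f : Carrier → Carrier → Carrier) →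
                (∀ {x x′ y y′} → x ≈ x′ → y ≈ y′ → f x y ≈ f x′ y′) →
                (∀ n n′ → f (u n) (φ n) ≈ f (u n′) (φ n′) → n ≡ n′) →
                Injective _≈_ _≈_ (λ x → f x (φ (index x)))
      descend f f-cong inj {x} {y} e = trans (u-index x) (trans
        (reflexive (≡.cong u (inj _ _ (trans (f-cong (sym (u-index x)) refl) (trans e (f-cong (u-index y) refl))))))
        (sym (u-index y)))

    fromParametrisation : (∀ n n′ → φ n ≈ φ n′ → n ≡ n′) →
                          (∀ n n′ → φ n ∙ u n ≈ φ n′ ∙ u n′ → n ≡ n′) →
                          (∀ n n′ → u n ⁻¹ ∙ φ n ≈ u n′ ⁻¹ ∙ φ n′ → n ≡ n′) →
                          (∀ n n′ → (u n ⁻¹ ∙ φ n) ∙ u n ≈ (u n′ ⁻¹ ∙ φ n′) ∙ u n′ → n ≡ n′) →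
                          InjColouring G
    fromParametrisation p₀ p₁ p₂ p₃ = record
      { σ      = λ x → φ (index x)
      ; σ-cong = λ e → reflexive (≡.cong φ (index-cong e))
      ; σ-inj  = descend (λ x y → y) (λ _ e → e) p₀
      ; Δ₁-inj = descend (λ x y → y ∙ x) (λ e f → ∙-cong f e) p₁
      ; Δ₂-inj = descend (λ x y → x ⁻¹ ∙ y) (λ e f → ∙-cong (⁻¹-cong e) f) p₂
      ; Δ₃-inj = descend (λ x y → (x ⁻¹ ∙ y) ∙ x) (λ e f → ∙-cong (∙-cong (⁻¹-cong e) f) e) p₃ }

-- Groups of order 27

-- Multiplication and left division of the normal forms g^q z^i y^j when z is central,
-- z³ = y³ = 1, g³ = z^e and y g = g y z^a.
module Order27 (e a : ℕ) where

  open Digits 3 3 3 public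

  mul : ℕ³ → ℕ³ → ℕ³
  mul (q , i , j) (q′ , i′ , j′) = (q + q′) % 3 , i + i′ + a * (j * q′) + e * ((q + q′) / 3) , j + j′

  div : ℕ³ → ℕ³ → ℕ³
  div (q , i , j) (q′ , i′ , j′) = q″ , i′ + 2 * (i + a * (j * q″) + e * ((q + q″) / 3)) , j′ + 2 * j
    where
    q″ : ℕ
    q″ = (q′ + 2 * q) % 3

  -- Row 3e + a encodes a colouring for the parameters e and a, found by computer search.
  table : List (List ℕ)
  table =
    (16 ∷ 6 ∷ 10 ∷ 20 ∷ 24 ∷ 22 ∷ 2 ∷ 8 ∷ 14 ∷ 9 ∷ 5 ∷ 21 ∷ 3 ∷ 12 ∷ 0 ∷ 23 ∷ 13 ∷ 26 ∷ 15 ∷ 11 ∷ 4 ∷ 19 ∷ 25 ∷ 17 ∷ 7 ∷ 1 ∷ 18 ∷ []) ∷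
    (16 ∷ 25 ∷ 18 ∷ 15 ∷ 7 ∷ 3 ∷ 17 ∷ 24 ∷ 5 ∷ 22 ∷ 23 ∷ 11 ∷ 21 ∷ 0 ∷ 2 ∷ 10 ∷ 1 ∷ 13 ∷ 6 ∷ 12 ∷ 4 ∷ 8 ∷ 20 ∷ 9 ∷ 26 ∷ 14 ∷ 19 ∷ []) ∷
    (16 ∷ 24 ∷ 23 ∷ 11 ∷ 0 ∷ 5 ∷ 18 ∷ 1 ∷ 9 ∷ 20 ∷ 8 ∷ 25 ∷ 14 ∷ 17 ∷ 6 ∷ 7 ∷ 13 ∷ 21 ∷ 19 ∷ 26 ∷ 22 ∷ 12 ∷ 15 ∷ 2 ∷ 3 ∷ 4 ∷ 10 ∷ []) ∷
    (16 ∷ 6 ∷ 19 ∷ 25 ∷ 20 ∷ 4 ∷ 11 ∷ 17 ∷ 3 ∷ 2 ∷ 24 ∷ 14 ∷ 13 ∷ 26 ∷ 8 ∷ 18 ∷ 7 ∷ 9 ∷ 5 ∷ 1 ∷ 22 ∷ 21 ∷ 10 ∷ 15 ∷ 0 ∷ 12 ∷ 23 ∷ []) ∷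
    (16 ∷ 8 ∷ 24 ∷ 0 ∷ 25 ∷ 12 ∷ 18 ∷ 7 ∷ 14 ∷ 26 ∷ 21 ∷ 3 ∷ 22 ∷ 5 ∷ 1 ∷ 10 ∷ 17 ∷ 13 ∷ 23 ∷ 15 ∷ 19 ∷ 11 ∷ 4 ∷ 2 ∷ 9 ∷ 6 ∷ 20 ∷ []) ∷
    (6 ∷ 22 ∷ 4 ∷ 26 ∷ 23 ∷ 14 ∷ 13 ∷ 15 ∷ 8 ∷ 2 ∷ 1 ∷ 0 ∷ 10 ∷ 17 ∷ 24 ∷ 19 ∷ 18 ∷ 16 ∷ 21 ∷ 20 ∷ 25 ∷ 12 ∷ 3 ∷ 5 ∷ 11 ∷ 7 ∷ 9 ∷ []) ∷
    (16 ∷ 8 ∷ 22 ∷ 17 ∷ 14 ∷ 5 ∷ 25 ∷ 19 ∷ 4 ∷ 3 ∷ 11 ∷ 12 ∷ 20 ∷ 1 ∷ 23 ∷ 7 ∷ 13 ∷ 18 ∷ 21 ∷ 6 ∷ 2 ∷ 26 ∷ 9 ∷ 15 ∷ 0 ∷ 24 ∷ 10 ∷ []) ∷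
    (6 ∷ 23 ∷ 5 ∷ 20 ∷ 12 ∷ 11 ∷ 13 ∷ 22 ∷ 7 ∷ 2 ∷ 1 ∷ 0 ∷ 25 ∷ 24 ∷ 18 ∷ 16 ∷ 14 ∷ 10 ∷ 17 ∷ 3 ∷ 8 ∷ 21 ∷ 26 ∷ 19 ∷ 15 ∷ 4 ∷ 9 ∷ []) ∷
    (26 ∷ 12 ∷ 15 ∷ 9 ∷ 23 ∷ 20 ∷ 3 ∷ 0 ∷ 6 ∷ 19 ∷ 4 ∷ 22 ∷ 10 ∷ 13 ∷ 1 ∷ 7 ∷ 25 ∷ 16 ∷ 17 ∷ 11 ∷ 2 ∷ 24 ∷ 5 ∷ 14 ∷ 8 ∷ 21 ∷ 18 ∷ []) ∷ []

  opaque
    map27 : ℕ³ → ℕ³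
    map27 (q , i , j) = (n / 9) % 3 , (n / 3) % 3 , n % 3
      where
      n : ℕ
      n = entry (row table (3 * e + a)) (9 * q + 3 * i + j)

    map27-< : ∀ n → proj₁ (map27 n) < 3
    map27-< (q , i , j) = m%n<n (entry (row table (3 * e + a)) (9 * q + 3 * i + j) / 9) 3

  mul-< : ∀ m n → proj₁ (mul m n) < 3
  mul-< (q , i , j) (q′ , i′ , j′) = m%n<n (q + q′) 3

  div-< : ∀ m n → proj₁ (div m n) < 3
  div-< (q , i , j) (q′ , i′ , j′) = m%n<n (q′ + 2 * q) 3

  check27 : Bool
  check27 = injectiveᵇ (λ n → map27 (digits n)) ∧
            injectiveᵇ (λ n → mul (map27 (digits n)) (digits n)) ∧
            injectiveᵇ (λ n → div (digits n) (map27 (digits n))) ∧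
            injectiveᵇ (λ n → div (digits n) (mul (map27 (digits n)) (digits n)))

opaque
  unfolding Order27.map27 Digits.injectiveᵇ

  digits27-valid : T (Digits.injectiveᵇ 3 3 3 (Digits.digits 3 3 3))
  digits27-valid = tt

  -- For e and a both nonzero the group is L₃. It has a colouring, which is why the exceptions in
  -- the theorem start at r = 4.
  order27-valid : T (allᵇ 3 λ e → allᵇ 3 λ a → Order27.check27 (toℕ e) (toℕ a))
  order27-valid = tt

order27-checked : ∀ {e a} → e < 3 → a < 3 → T (Order27.check27 e a)
order27-checked e<3 a<3 = ≡.subst₂ (λ e a → T (Order27.check27 e a)) (toℕ-fromℕ< e<3) (toℕ-fromℕ< a<3)
  (allᵇ-sound (λ a → Order27.check27 _ (toℕ a))
    (allᵇ-sound (λ e → allᵇ 3 λ a → Order27.check27 (toℕ e) (toℕ a)) order27-valid (fromℕ< e<3)) (fromℕ< a<3))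

mod3-cancel : ∀ q q′ → (q + (q′ + 2 * q) % 3) % 3 ≡ q′ % 3
mod3-cancel q q′ = ≡.trans (%-distribˡ-+ q _ 3) (≡.trans (≡.cong (λ x → (q % 3 + x) % 3) (m%n%n≡m%n (q′ + 2 * q) 3))
  (≡.trans (≡.sym (%-distribˡ-+ q (q′ + 2 * q) 3)) (≡.trans (≡.cong (_% 3) (eq q q′)) ([m+kn]%n≡m%n q′ q 3))))
  where eq : ∀ q q′ → q + (q′ + 2 * q) ≡ q′ + q * 3
        eq = solve-∀

module _ {c ℓ : Level} (G : Group c ℓ) where
  open Group G
  open Powers G
  open Commutators G
  open import Relation.Binary.Reasoning.Setoid setoid

  module _ {g z y : Carrier} (z-central : Central z) (z³ : z ↑ 3 ≈ ε) (y³ : y ↑ 3 ≈ ε) where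

    normalForm : ℕ³ → Carrier
    normalForm (q , i , j) = g ↑ q ∙ (z ↑ i ∙ y ↑ j)

    module _ {e a : ℕ} (e<3 : e < 3) (a<3 : a < 3) (g³ : g ↑ 3 ≈ z ↑ e) (yg : y ∙ g ≈ g ∙ (y ∙ z ↑ a))
        (generated : ∀ x → ∃ λ n → x ≈ normalForm n)
        -- The exponents of g are bounded here because g³ = z^e gives unreduced normal forms for the
        -- same element.
        (unique : ∀ m n → proj₁ m < 3 → proj₁ n < 3 → normalForm m ≈ normalForm n → Digits.code 3 3 3 m ≡ Digits.code 3 3 3 n) where

      open Order27 e a

      private
        z-↑ : ∀ n → Central (z ↑ n)
        z-↑ = central-↑ z-central

        y-g′ : ∀ j q → y ↑ j ∙ g ↑ q ≈ g ↑ q ∙ (z ↑ (a * (j * q)) ∙ y ↑ j)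
        y-g′ j q = trans (conjugate-↑ (twist-↑ z-central yg q) j) (∙-congˡ (trans (∙-↑ j (sym (z-↑ _ y)))
          (trans (∙-congˡ (trans (sym (↑-*′ z (a * q) j)) (↑-≡ z (eq a q j)))) (sym (z-↑ _ _)))))
          where eq : ∀ a q j → a * q * j ≡ a * (j * q)
                eq = solve-∀

        g-% : ∀ q → g ↑ q ≈ g ↑ (q % 3) ∙ z ↑ (e * (q / 3))
        g-% q = begin
          g ↑ q ≈⟨ ↑-≡ g (≡.trans (m≡m%n+[m/n]*n q 3) (≡.cong (q % 3 +_) (ℕ.*-comm (q / 3) 3))) ⟩
          g ↑ (q % 3 + 3 * (q / 3)) ≈⟨ ↑-+ g (q % 3) _ ⟩
          g ↑ (q % 3) ∙ g ↑ (3 * (q / 3)) ≈⟨ ∙-congˡ (trans (↑-*′ g 3 (q / 3)) (↑-cong (q / 3) g³)) ⟩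
          g ↑ (q % 3) ∙ (z ↑ e) ↑ (q / 3) ≈⟨ ∙-congˡ (↑-*′ z e (q / 3)) ⟨
          g ↑ (q % 3) ∙ z ↑ (e * (q / 3)) ∎

        reduce : ∀ q i j → normalForm (q , i , j) ≈ normalForm (q % 3 , i + e * (q / 3) , j)
        reduce q i j = begin
          g ↑ q ∙ (z ↑ i ∙ y ↑ j) ≈⟨ ∙-congʳ (g-% q) ⟩
          g ↑ (q % 3) ∙ z ↑ (e * (q / 3)) ∙ (z ↑ i ∙ y ↑ j) ≈⟨ assoc _ _ _ ⟩
          g ↑ (q % 3) ∙ (z ↑ (e * (q / 3)) ∙ (z ↑ i ∙ y ↑ j)) ≈⟨ ∙-congˡ (assoc _ _ _) ⟨
          g ↑ (q % 3) ∙ (z ↑ (e * (q / 3)) ∙ z ↑ i ∙ y ↑ j) ≈⟨ ∙-congˡ (∙-congʳ (z-↑ _ _)) ⟩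
          g ↑ (q % 3) ∙ (z ↑ i ∙ z ↑ (e * (q / 3)) ∙ y ↑ j) ≈⟨ ∙-congˡ (∙-congʳ (↑-+ z i _)) ⟨
          g ↑ (q % 3) ∙ (z ↑ (i + e * (q / 3)) ∙ y ↑ j) ∎

        mul-correct : ∀ m n → normalForm m ∙ normalForm n ≈ normalForm (mul m n)
        mul-correct (q , i , j) (q′ , i′ , j′) = begin
          g ↑ q ∙ (z ↑ i ∙ y ↑ j) ∙ (g ↑ q′ ∙ (z ↑ i′ ∙ y ↑ j′))
            ≈⟨ trans (assoc _ _ _) (∙-congˡ (trans (sym (assoc _ _ _)) (∙-congʳ (assoc _ _ _)))) ⟩
          g ↑ q ∙ (z ↑ i ∙ (y ↑ j ∙ g ↑ q′) ∙ (z ↑ i′ ∙ y ↑ j′))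
            ≈⟨ ∙-congˡ (∙-congʳ (trans (∙-congˡ (y-g′ j q′)) (trans (sym (assoc _ _ _)) (trans (∙-congʳ (z-↑ i _)) (assoc _ _ _))))) ⟩
          g ↑ q ∙ (g ↑ q′ ∙ (z ↑ i ∙ (z ↑ (a * (j * q′)) ∙ y ↑ j)) ∙ (z ↑ i′ ∙ y ↑ j′))
            ≈⟨ trans (∙-congˡ (assoc _ _ _)) (sym (assoc _ _ _)) ⟩
          g ↑ q ∙ g ↑ q′ ∙ (z ↑ i ∙ (z ↑ (a * (j * q′)) ∙ y ↑ j) ∙ (z ↑ i′ ∙ y ↑ j′))
            ≈⟨ ∙-cong (sym (↑-+ g q q′)) (∙-congʳ (trans (sym (assoc _ _ _)) (∙-congʳ (sym (↑-+ z i _))))) ⟩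
          g ↑ (q + q′) ∙ (z ↑ (i + a * (j * q′)) ∙ y ↑ j ∙ (z ↑ i′ ∙ y ↑ j′))
            ≈⟨ ∙-congˡ (interchange _ _ (sym (z-↑ i′ _))) ⟩
          g ↑ (q + q′) ∙ (z ↑ (i + a * (j * q′)) ∙ z ↑ i′ ∙ (y ↑ j ∙ y ↑ j′))
            ≈⟨ ∙-congˡ (∙-cong (trans (sym (↑-+ z _ i′)) (↑-≡ z (eq i i′ (a * (j * q′))))) (sym (↑-+ y j j′))) ⟩
          normalForm (q + q′ , i + i′ + a * (j * q′) , j + j′)
            ≈⟨ reduce (q + q′) _ _ ⟩
          normalForm (mul (q , i , j) (q′ , i′ , j′)) ∎
          where eq : ∀ i i′ x → i + x + i′ ≡ i + i′ + x
                eq = solve-∀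

        div-correct : ∀ m n → proj₁ n % 3 ≡ proj₁ n → normalForm m ⁻¹ ∙ normalForm n ≈ normalForm (div m n)
        div-correct m@(q , i , j) n@(q′ , i′ , j′) q′-reduced = begin
          normalForm m ⁻¹ ∙ normalForm n ≈⟨ ∙-congˡ target ⟨
          normalForm m ⁻¹ ∙ (normalForm m ∙ normalForm d) ≈⟨ assoc _ _ _ ⟨
          normalForm m ⁻¹ ∙ normalForm m ∙ normalForm d ≈⟨ ∙-congʳ (inverseˡ _) ⟩
          ε ∙ normalForm d ≈⟨ identityˡ _ ⟩
          normalForm d ∎
          where
          d = div m n
          q″ = (q′ + 2 * q) % 3
          s = i + a * (j * q″) + e * ((q + q″) / 3)
          eq : ∀ i i′ x w → i + (i′ + 2 * (i + x + w)) + x + w ≡ i′ + (i + x + w) * 3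
          eq = solve-∀
          eq′ : ∀ j j′ → j + (j′ + 2 * j) ≡ j′ + j * 3
          eq′ = solve-∀
          drop : ∀ {x} → x ↑ 3 ≈ ε → ∀ {n} m k → n ≡ m + k * 3 → x ↑ n ≈ x ↑ m
          drop {x} x³ m k n≡ = trans (↑-≡ x n≡) (trans (↑-+ x m _) (trans (∙-congˡ (↑-mult 3 k x³)) (identityʳ _)))
          target : normalForm m ∙ normalForm d ≈ normalForm n
          target = trans (mul-correct m d) (∙-cong (↑-≡ g (≡.trans (mod3-cancel q q′) q′-reduced))
            (∙-cong (drop z³ i′ s (eq i i′ (a * (j * q″)) (e * ((q + q″) / 3)))) (drop y³ j′ j (eq′ j j′))))

        u φ : Index → Carrier
        u n = normalForm (digits n)
        φ n = normalForm (map27 (digits n))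

        toIndex : ℕ³ → Index
        toIndex (q , i , j) = fromℕ< (m%n<n q 3) , fromℕ< (m%n<n (i + e * (q / 3)) 3) , fromℕ< (m%n<n j 3)

        toIndex-≈ : ∀ n → normalForm n ≈ u (toIndex n)
        toIndex-≈ (q , i , j) = trans (reduce q i j) (∙-cong
          (↑-≡ g (≡.sym (toℕ-fromℕ< (m%n<n q 3))))
          (∙-cong (trans (↑-% 3 _ z³) (↑-≡ z (≡.sym (toℕ-fromℕ< (m%n<n (i + e * (q / 3)) 3)))))
                  (trans (↑-% 3 j y³) (↑-≡ y (≡.sym (toℕ-fromℕ< (m%n<n j 3)))))))

        index : Carrier → Index
        index x = toIndex (proj₁ (generated x))

        u-index : ∀ x → x ≈ u (index x)
        u-index x = trans (proj₂ (generated x)) (toIndex-≈ (proj₁ (generated x)))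

        by-code : ∀ f → T (injectiveᵇ f) → (∀ n → proj₁ (f n) < 3) → ∀ {x : Index → Carrier} →
                  (∀ n → x n ≈ normalForm (f n)) → ∀ n n′ → x n ≈ x n′ → n ≡ n′
        by-code f ok f<3 x≈ n n′ h = injectiveᵇ-sound f ok n n′ (unique (f n) (f n′) (f<3 n) (f<3 n′) (trans (sym (x≈ n)) (trans h (x≈ n′))))

        check₀ = ∧-T (injectiveᵇ (λ n → map27 (digits n))) (order27-checked e<3 a<3)
        check₁ = ∧-T (injectiveᵇ (λ n → mul (map27 (digits n)) (digits n))) (proj₂ check₀)
        check₂ = ∧-T (injectiveᵇ (λ n → div (digits n) (map27 (digits n)))) (proj₂ check₁)

      order27-colouring : InjColouring G
      order27-colouring = Parametrised.fromParametrisation G u index u-index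
        (λ {x} {y} h → by-code digits digits27-valid (λ (q , _) → toℕ<n q) (λ n → refl) (index x) (index y)
          (trans (sym (u-index x)) (trans h (u-index y))))
        φ
        (by-code (λ n → map27 (digits n)) (proj₁ check₀) (λ n → map27-< (digits n)) (λ n → refl))
        (by-code (λ n → mul (map27 (digits n)) (digits n)) (proj₁ check₁) (λ n → mul-< (map27 (digits n)) (digits n)) (λ n → mul-correct (map27 (digits n)) (digits n)))
        (by-code (λ n → div (digits n) (map27 (digits n))) (proj₁ check₂) (λ n → div-< (digits n) (map27 (digits n)))
            (λ n → div-correct (digits n) (map27 (digits n)) (m<n⇒m%n≡m (map27-< (digits n)))))
        (by-code (λ n → div (digits n) (mul (map27 (digits n)) (digits n))) (proj₂ check₂) (λ n → div-< (digits n) (mul (map27 (digits n)) (digits n))) (λ n → trans (assoc _ _ _)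
          (trans (∙-congˡ (mul-correct (map27 (digits n)) (digits n))) (div-correct (digits n) _ (m<n⇒m%n≡m (mul-< (map27 (digits n)) (digits n)))))))

-- The groups C₃ᵗ × C₃

module Arithmetic where

  open import Data.Nat
  open import Data.Nat.Properties
  open import Data.Bool using (if_then_else_)

  -- Multiples of d are added on both sides, so no subtraction occurs and the ring solver applies.
  Cong : ℕ → ℕ → ℕ → Set
  Cong d x y = ∃₂ λ a b → x + a * d ≡ y + b * d

  module _ {d : ℕ} where

    ≡⇒Cong : ∀ {x y} → x ≡ y → Cong d x y
    ≡⇒Cong ≡.refl = 0 , 0 , ≡.refl

    Cong-sym : ∀ {x y} → Cong d x y → Cong d y x
    Cong-sym (a , b , e) = b , a , ≡.sym e

    Cong-+ : ∀ {x y u v} → Cong d x y → Cong d u v → Cong d (x + u) (y + v)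
    Cong-+ {x} {y} {u} {v} (a , b , e) (a′ , b′ , e′) = a + a′ , b + b′ ,
      ≡.trans (rearr x u a a′ d) (≡.trans (≡.cong₂ _+_ e e′) (≡.sym (rearr y v b b′ d)))
      where rearr : ∀ x u a a′ d → x + u + (a + a′) * d ≡ (x + a * d) + (u + a′ * d)
            rearr = solve-∀

    Cong-* : ∀ k {x y} → Cong d x y → Cong d (k * x) (k * y)
    Cong-* k {x} {y} (a , b , e) = k * a , k * b ,
      ≡.trans (rearr k x a d) (≡.trans (≡.cong (k *_) e) (≡.sym (rearr k y b d)))
      where rearr : ∀ k x a d → k * x + k * a * d ≡ k * (x + a * d)
            rearr = solve-∀

    Cong-trans : ∀ {x y z} → Cong d x y → Cong d y z → Cong d x z
    Cong-trans {x} {y} {z} (a , b , e) (a′ , b′ , e′) = a + a′ , b + b′ , (begin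
      x + (a + a′) * d ≡⟨ rearr x a a′ d ⟩
      (x + a * d) + a′ * d ≡⟨ ≡.cong (_+ a′ * d) e ⟩
      (y + b * d) + a′ * d ≡⟨ rearr′ y b a′ d ⟩
      (y + a′ * d) + b * d ≡⟨ ≡.cong (_+ b * d) e′ ⟩
      (z + b′ * d) + b * d ≡⟨ rearr″ z b b′ d ⟩
      z + (b + b′) * d ∎)
      where
      open ≡.≡-Reasoning
      rearr : ∀ x a a′ d → x + (a + a′) * d ≡ (x + a * d) + a′ * d
      rearr = solve-∀
      rearr′ : ∀ y b a′ d → (y + b * d) + a′ * d ≡ (y + a′ * d) + b * d
      rearr′ = solve-∀
      rearr″ : ∀ z b b′ d → (z + b′ * d) + b * d ≡ z + (b + b′) * d
      rearr″ = solve-∀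

    Cong-multiple : ∀ x k → Cong d (x + k * d) x
    Cong-multiple x k = 0 , k , +-identityʳ _

    Cong-cancelˡ : ∀ c {x y} → Cong d (c + x) (c + y) → Cong d x y
    Cong-cancelˡ c {x} {y} (a , b , e) = a , b , +-cancelˡ-≡ c _ _
      (≡.trans (≡.sym (+-assoc c x _)) (≡.trans e (+-assoc c y _)))

    Cong-cancelʳ : ∀ c {x y} → Cong d (x + c) (y + c) → Cong d x y
    Cong-cancelʳ c {x} {y} h = Cong-cancelˡ c (≡.subst₂ (Cong d) (+-comm x c) (+-comm y c) h)

    Cong-resp : ∀ {x y x′ y′} → x ≡ x′ → y ≡ y′ → Cong d x y → Cong d x′ y′
    Cong-resp ≡.refl ≡.refl h = h

    module _ .{{_ : NonZero d}} where

      %⇒Cong : ∀ {x y} → x % d ≡ y % d → Cong d x y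
      %⇒Cong {x} {y} e = y / d , x / d , (begin
        x + y / d * d ≡⟨ ≡.cong (_+ y / d * d) (m≡m%n+[m/n]*n x d) ⟩
        x % d + x / d * d + y / d * d ≡⟨ ≡.cong (λ r → r + x / d * d + y / d * d) e ⟩
        y % d + x / d * d + y / d * d ≡⟨ rearr (y % d) (x / d * d) (y / d * d) ⟩
        y % d + y / d * d + x / d * d ≡⟨ ≡.cong (_+ x / d * d) (m≡m%n+[m/n]*n y d) ⟨
        y + x / d * d ∎)
        where
        open ≡.≡-Reasoning
        rearr : ∀ r u v → r + u + v ≡ r + v + u
        rearr = solve-∀

      Cong⇒% : ∀ {x y} → Cong d x y → x % d ≡ y % d
      Cong⇒% {x} {y} (a , b , e) = ≡.trans (≡.sym ([m+kn]%n≡m%n x a d)) (≡.trans (≡.cong (_% d) e) ([m+kn]%n≡m%n y b d))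

      Cong-< : ∀ {x y} → x < d → y < d → Cong d x y → x ≡ y
      Cong-< x<d y<d h = ≡.trans (≡.sym (m<n⇒m%n≡m x<d)) (≡.trans (Cong⇒% h) (m<n⇒m%n≡m y<d))

  Cong-factor : ∀ d e {x y} → Cong (d * e) x y → Cong d x y
  Cong-factor d e {x} {y} (a , b , h) = a * e , b * e , ≡.trans (≡.cong (x +_) (rearr a d e)) (≡.trans h (≡.cong (y +_) (≡.sym (rearr b d e))))
    where rearr : ∀ a d e → a * e * d ≡ a * (d * e)
          rearr = solve-∀

  Cong-scale : ∀ k .{{_ : NonZero k}} {d x y} → Cong (k * d) (k * x) (k * y) → Cong d x y
  Cong-scale k {d} {x} {y} (a , b , h) = a , b , *-cancelˡ-≡ _ _ k
    (≡.trans (rearr k x a d) (≡.trans h (≡.sym (rearr k y b d))))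
    where rearr : ∀ k x a d → k * (x + a * d) ≡ k * x + a * (k * d)
          rearr = solve-∀

  -- A map on Z₉ₘ × Z₃ for odd m = 2n + 1 ≥ 3. An element is written (z + 3mk + i, i) with z = z₀ + mh;
  -- it is sent to (2z + i + 3mf, b + k) where f and b are chosen such that, modulo 3, the
  -- top digit of the image and of x⁻¹σ(x) are the permutations π₁ and π₂ of i. These are affine with slopes -1
  -- and 1 except at the few places where the carries in 2z + i would otherwise destroy injectivity of σ(x)x.
  module Shear (n : ℕ) .{{_ : NonZero n}} where

    m M : ℕ
    m = 1 + 2 * n
    M = 3 * m

    -- 2z + i = place + carry · M, where t = 2z₀ + i.
    carry place : ℕ → ℕ → ℕ
    carry 0 t = 0
    carry 1 t = if does (t <? m) then 0 else 1
    carry _ t = if does (t <? 2 * m) then 1 else 2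
    place 0 t = t
    place 1 t = if does (t <? m) then 2 * m + t else t ∸ m
    place _ t = if does (t <? 2 * m) then m + t else 0

    -- The place 2m is taken by 2z + i once for each i = 0, 1, 2, namely at (z₀, h) = (0, 1), (n,
    -- 2), (2n, 0). There the slope changes from -1 to 1.
    π₁ : ℕ → ℕ → ℕ
    π₁ p i = if does (p ≟ 2 * m) then i else 2 * i

    -- With slopes -1 and 1 the terms in i cancel from `gauge` modulo 3, leaving h + carry + 2c for
    -- the constant c of π₂. For h = 0, 1, 2 the carries are 0, 0, 1 if t < m and 0, 1, 1 if m ≤ t <
    -- 2m; taking c = 0, 0, 1 and c = 0, 1, 1 gives three distinct residues. But c must not depend
    -- on i. For z₀ = n the values of t lie on both sides of m, and a change of slope for h < 2
    -- takes the place of a constant.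
    π₂ : ℕ → ℕ → ℕ → ℕ
    π₂ 0 z₀ i = if does (z₀ ≟ n) then 2 * i else i
    π₂ 1 z₀ i = if does (z₀ ≟ n) then 2 * i else (if does (z₀ <? n) then i else suc i)
    π₂ _ z₀ i = suc i

    private
      if-true : ∀ {A : Set} (d : Dec A) {u v : ℕ} → A → (if does d then u else v) ≡ u
      if-true d a rewrite dec-true d a = ≡.refl

      if-false : ∀ {A : Set} (d : Dec A) {u v : ℕ} → ¬ A → (if does d then u else v) ≡ v
      if-false d ¬a rewrite dec-false d ¬a = ≡.refl

      rewrite-both : ∀ {x p c p′ c′} → p ≡ p′ → c ≡ c′ → x ≡ p′ + c′ * M × p′ < M → x ≡ p + c * M × p < M
      rewrite-both ≡.refl ≡.refl h = h

    place-carry : ∀ {h t} → h < 3 → t ≤ 2 * m → t + 2 * m * h ≡ place h t + carry h t * M × place h t < M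
    place-carry {0} {t} _ t≤ = ≡.cong (t +_) (*-zeroʳ (2 * m)) , ≤-<-trans t≤ (m<n+m (2 * m) z<s)
    place-carry {1} {t} _ t≤ with t <? m
    ... | yes t<m = rewrite-both (if-true (t <? m) t<m) (if-true (t <? m) t<m)
                      (eq m t , ≡.subst (_< M) (+-comm t (2 * m)) (+-monoˡ-< (2 * m) t<m))
      where eq : ∀ m t → t + 2 * m * 1 ≡ 2 * m + t + 0 * (3 * m)
            eq = solve-∀
    ... | no t≮m = rewrite-both (if-false (t <? m) t≮m) (if-false (t <? m) t≮m)
                     (≡.trans (≡.cong (_+ 2 * m * 1) (≡.sym (m+[n∸m]≡n (≮⇒≥ t≮m)))) (eq m (t ∸ m)) ,
                      ≤-<-trans (m∸n≤m t m) (≤-<-trans t≤ (m<n+m (2 * m) z<s)))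
      where eq : ∀ m s → m + s + 2 * m * 1 ≡ s + 1 * (3 * m)
            eq = solve-∀
    place-carry {2} {t} _ t≤ with t <? 2 * m
    ... | yes t<2m = rewrite-both (if-true (t <? 2 * m) t<2m) (if-true (t <? 2 * m) t<2m) (eq m t , +-monoʳ-< m t<2m)
      where eq : ∀ m t → t + 2 * m * 2 ≡ m + t + 1 * (3 * m)
            eq = solve-∀
    ... | no t≮2m = rewrite-both (if-false (t <? 2 * m) t≮2m) (if-false (t <? 2 * m) t≮2m)
                      (≡.trans (≡.cong (_+ 2 * m * 2) (≤-antisym t≤ (≮⇒≥ t≮2m))) (eq m) , z<s)
      where eq : ∀ m → 2 * m + 2 * m * 2 ≡ 0 + 2 * (3 * m)
            eq = solve-∀
    place-carry {suc (suc (suc _))} (s≤s (s≤s (s≤s ()))) _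

    private
      2i : ∀ {i j} → Cong 3 (2 * i) (2 * j) → Cong 3 i j
      2i {i} {j} h = Cong-trans (Cong-sym (lem i)) (Cong-trans (Cong-* 2 h) (lem j))
        where lem : ∀ i → Cong 3 (2 * (2 * i)) i
              lem i = Cong-resp (≡.sym (eq i)) ≡.refl (Cong-multiple i i)
                where eq : ∀ i → 2 * (2 * i) ≡ i + i * 3
                      eq = solve-∀

    π₁-inj : ∀ p {i j} → i < 3 → j < 3 → Cong 3 (π₁ p i) (π₁ p j) → i ≡ j
    π₁-inj p i<3 j<3 h with does (p ≟ 2 * m)
    ... | true  = Cong-< i<3 j<3 h
    ... | false = Cong-< i<3 j<3 (2i h)

    π₂-inj : ∀ h z₀ {i j} → i < 3 → j < 3 → Cong 3 (π₂ h z₀ i) (π₂ h z₀ j) → i ≡ j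
    π₂-inj 0 z₀ i<3 j<3 h with does (z₀ ≟ n)
    ... | true  = Cong-< i<3 j<3 (2i h)
    ... | false = Cong-< i<3 j<3 h
    π₂-inj 1 z₀ i<3 j<3 h with does (z₀ ≟ n) | does (z₀ <? n)
    ... | true  | _     = Cong-< i<3 j<3 (2i h)
    ... | false | true  = Cong-< i<3 j<3 h
    ... | false | false = Cong-< i<3 j<3 (Cong-cancelˡ 1 h)
    π₂-inj (suc (suc _)) z₀ i<3 j<3 h = Cong-< i<3 j<3 (Cong-cancelˡ 1 h)

    -- Modulo 3 this is the top digit of σ(x)x plus twice its second exponent, with the known terms
    -- in i removed; k drops out. Once z₀ and i are known, it has to determine h.
    gauge : ℕ → ℕ → ℕ → ℕ
    gauge z₀ h i = h + 2 * π₂ h z₀ i + 2 * π₁ (place h t) i + carry h t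
      where t = 2 * z₀ + i

    private
      K : ∀ {z₀ h i p₁ p₂ c} → π₂ h z₀ i ≡ p₂ → π₁ (place h (2 * z₀ + i)) i ≡ p₁ → carry h (2 * z₀ + i) ≡ c →
          gauge z₀ h i ≡ h + 2 * p₂ + 2 * p₁ + c
      K ≡.refl ≡.refl ≡.refl = ≡.refl

      at : ∀ {p i} → p ≡ 2 * m → π₁ p i ≡ i
      at {p} = if-true (p ≟ 2 * m)

      off : ∀ {p i} → p ≢ 2 * m → π₁ p i ≡ 2 * i
      off {p} = if-false (p ≟ 2 * m)

      below : ∀ {p i} → p < 2 * m → π₁ p i ≡ 2 * i
      below p< = off (<⇒≢ p<)

      above : ∀ {p i} → 2 * m < p → π₁ p i ≡ 2 * i
      above p> = off (>⇒≢ p>)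

      m<2m : m < 2 * m
      m<2m = m<m+n m z<s

    module Region {t : ℕ} where

      Values : ℕ → (h : ℕ) → ℕ → ℕ → Set
      Values i h p c = π₁ (place h t) i ≡ p × carry h t ≡ c

      -- For h = 1 the place 2m + t is the exceptional one only if t = 0; then i = 0, and both
      -- slopes give the same value.
      low : ∀ {i} → (t ≡ 0 → i ≡ 0) → t < m → Values i 0 (2 * i) 0 × Values i 1 (2 * i) 0 × Values i 2 (2 * i) 1
      low {i} t≡0⇒ t<m =
        (below t<2m , ≡.refl) ,
        (≡.trans (≡.cong (λ p → π₁ p i) (if-true (t <? m) t<m)) high , if-true (t <? m) t<m) ,
        (≡.trans (≡.cong (λ p → π₁ p i) (if-true (t <? 2 * m) t<2m)) (below m+t<) , if-true (t <? 2 * m) t<2m)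
        where
        t<2m = <-trans t<m m<2m
        m+t< : m + t < 2 * m
        m+t< = ≡.subst (m + t <_) (≡.cong (m +_) (≡.sym (+-identityʳ m))) (+-monoʳ-< m t<m)
        high : π₁ (2 * m + t) i ≡ 2 * i
        high with t ≟ 0
        ... | yes t≡0 rewrite t≡0⇒ t≡0 with does (2 * m + t ≟ 2 * m)
        ...   | true  = ≡.refl
        ...   | false = ≡.refl
        high | no t≢0 = above (m<m+n (2 * m) (n≢0⇒n>0 t≢0))

      middle : ∀ {i} → t ≡ m → Values i 0 (2 * i) 0 × Values i 1 (2 * i) 1 × Values i 2 i 1
      middle {i} ≡.refl =
        (below m<2m , ≡.refl) ,
        (≡.trans (≡.cong (λ p → π₁ p i) (if-false (m <? m) (<-irrefl ≡.refl))) (below (≤-<-trans (m∸n≤m m m) m<2m)) ,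
          if-false (m <? m) (<-irrefl ≡.refl)) ,
        (≡.trans (≡.cong (λ p → π₁ p i) (if-true (m <? 2 * m) m<2m)) (at (≡.cong (m +_) (≡.sym (+-identityʳ m)))) ,
          if-true (m <? 2 * m) m<2m)

      high : ∀ {i} → m < t → t < 2 * m → Values i 0 (2 * i) 0 × Values i 1 (2 * i) 1 × Values i 2 (2 * i) 1
      high {i} m<t t<2m =
        (below t<2m , ≡.refl) ,
        (≡.trans (≡.cong (λ p → π₁ p i) (if-false (t <? m) (<-asym m<t))) (below (≤-<-trans (m∸n≤m t m) t<2m)) ,
          if-false (t <? m) (<-asym m<t)) ,
        (≡.trans (≡.cong (λ p → π₁ p i) (if-true (t <? 2 * m) t<2m))
          (above (≡.subst (_< m + t) (≡.cong (m +_) (≡.sym (+-identityʳ m))) (+-monoʳ-< m m<t))) , if-true (t <? 2 * m) t<2m)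

      top : ∀ {i} → t ≡ 2 * m → Values i 0 i 0 × Values i 1 (2 * i) 1 × Values i 2 (2 * i) 2
      top {i} ≡.refl =
        (at ≡.refl , ≡.refl) ,
        (≡.trans (≡.cong (λ p → π₁ p i) (if-false (2 * m <? m) (<-asym m<2m)))
          (below (≡.subst (_< 2 * m) (≡.sym (≡.trans (≡.cong (λ x → m + x ∸ m) (+-identityʳ m)) (m+n∸m≡n m m))) m<2m)) ,
          if-false (2 * m <? m) (<-asym m<2m)) ,
        (≡.trans (≡.cong (λ p → π₁ p i) (if-false (2 * m <? 2 * m) (<-irrefl ≡.refl))) (below {0} {i} z<s) ,
          if-false (2 * m <? 2 * m) (<-irrefl ≡.refl))

    Distinct : (ℕ → ℕ) → Set
    Distinct γ = ∀ {h h′} → h < 3 → h′ < 3 → Cong 3 (γ h) (γ h′) → h ≡ h′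

    private
      distinct₃ : ℕ → ℕ → ℕ → Bool
      distinct₃ a b c = not (a % 3 ≡ᵇ b % 3) ∧ not (a % 3 ≡ᵇ c % 3) ∧ not (b % 3 ≡ᵇ c % 3)

      not-T : ∀ {x y} → T (not (x ≡ᵇ y)) → x ≢ y
      not-T {x} t ≡.refl with x ≡ᵇ x | ≡⇒≡ᵇ x x ≡.refl
      ... | true | _ = t

      not-∧ : ∀ x {y} → T (not x ∧ y) → T (not x) × T y
      not-∧ false t = _ , t

      distinct : ∀ γ {v₀ v₁ v₂} → γ 0 ≡ v₀ → γ 1 ≡ v₁ → γ 2 ≡ v₂ → T (distinct₃ v₀ v₁ v₂) → Distinct γ
      distinct γ ≡.refl ≡.refl ≡.refl ok {h} {h′} h<3 h′<3 c = go h h′ h<3 h′<3 (Cong⇒% c)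
        where
        ok₁ = not-∧ (γ 0 % 3 ≡ᵇ γ 1 % 3) ok
        ok₂ = not-∧ (γ 0 % 3 ≡ᵇ γ 2 % 3) (proj₂ ok₁)
        n₀₁ = not-T {γ 0 % 3} {γ 1 % 3} (proj₁ ok₁)
        n₀₂ = not-T {γ 0 % 3} {γ 2 % 3} (proj₁ ok₂)
        n₁₂ = not-T {γ 1 % 3} {γ 2 % 3} (proj₂ ok₂)
        go : ∀ h h′ → h < 3 → h′ < 3 → γ h % 3 ≡ γ h′ % 3 → h ≡ h′
        go 0 0 _ _ e = ≡.refl
        go 1 1 _ _ e = ≡.refl
        go 2 2 _ _ e = ≡.refl
        go 0 1 _ _ e = ⊥-elim (n₀₁ e)
        go 1 0 _ _ e = ⊥-elim (n₀₁ (≡.sym e))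
        go 0 2 _ _ e = ⊥-elim (n₀₂ e)
        go 2 0 _ _ e = ⊥-elim (n₀₂ (≡.sym e))
        go 1 2 _ _ e = ⊥-elim (n₁₂ e)
        go 2 1 _ _ e = ⊥-elim (n₁₂ (≡.sym e))
        go (suc (suc (suc _))) _ (s≤s (s≤s (s≤s ()))) _ e
        go 0 (suc (suc (suc _))) _ (s≤s (s≤s (s≤s ()))) e
        go 1 (suc (suc (suc _))) _ (s≤s (s≤s (s≤s ()))) e
        go 2 (suc (suc (suc _))) _ (s≤s (s≤s (s≤s ()))) e

      Values : ℕ → ℕ → (ℕ → ℕ) → (ℕ → ℕ) → Set
      Values t i p c = Region.Values {t} i 0 (p 0) (c 0) × Region.Values {t} i 1 (p 1) (c 1) × Region.Values {t} i 2 (p 2) (c 2)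

      gauge-value : (p₂ p c : ℕ → ℕ) → ℕ → ℕ
      gauge-value p₂ p c h = h + 2 * p₂ h + 2 * p h + c h

      Good : (p₂ p c : ℕ → ℕ) → Set
      Good p₂ p c = T (distinct₃ (gauge-value p₂ p c 0) (gauge-value p₂ p c 1) (gauge-value p₂ p c 2))

      conclude : ∀ {z₀ i} (p₂ p c : ℕ → ℕ) → (∀ h → π₂ h z₀ i ≡ p₂ h) → Values (2 * z₀ + i) i p c →
                 Good p₂ p c →
                 Distinct (λ h → gauge z₀ h i)
      conclude {z₀} {i} p₂ p c e ((p₀ , c₀) , (p₁ , c₁) , (p₂′ , c₂)) = distinct (λ h → gauge z₀ h i)
        (K {z₀} {0} {i} (e 0) p₀ c₀) (K {z₀} {1} {i} (e 1) p₁ c₁) (K {z₀} {2} {i} (e 2) p₂′ c₂)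

      digit : ℕ → ℕ → ℕ → ℕ → ℕ
      digit a b c 0 = a
      digit a b c 1 = b
      digit a b c _ = c

      ≤2 : ∀ {i} → i < 3 → i ≤ 2
      ≤2 (s≤s h) = h

      double : ∀ z i → i < 3 → 2 * z + i ≤ 2 * suc z
      double z i i<3 = ≡.subst (2 * z + i ≤_) (≡.trans (+-comm (2 * z) 2) (≡.sym (*-distribˡ-+ 2 1 z))) (+-monoʳ-≤ (2 * z) (≤2 i<3))

    t≤2m : ∀ {z₀ i} → z₀ < m → i < 3 → 2 * z₀ + i ≤ 2 * m
    t≤2m {z₀} {i} z₀<m i<3 = ≤-trans (double z₀ i i<3) (*-monoʳ-≤ 2 z₀<m)

    private
      left : ∀ {z₀} i → i < 3 → z₀ < n → Distinct (λ h → gauge z₀ h i)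
      left {z₀} i i<3 z₀<n = conclude (digit i i (suc i)) (λ _ → 2 * i) (digit 0 0 1) π₂-left
          (Region.low (λ e → m+n≡0⇒n≡0 (2 * z₀) e) (s≤s (≤-trans (double z₀ i i<3) (*-monoʳ-≤ 2 z₀<n)))) (ok i i<3)
        where
        π₂-left : ∀ h → π₂ h z₀ i ≡ digit i i (suc i) h
        π₂-left 0 = if-false (z₀ ≟ n) (<⇒≢ z₀<n)
        π₂-left 1 = ≡.trans (if-false (z₀ ≟ n) (<⇒≢ z₀<n)) (if-true (z₀ <? n) z₀<n)
        π₂-left (suc (suc _)) = ≡.refl
        ok : ∀ i → i < 3 → Good (digit i i (suc i)) (λ _ → 2 * i) (digit 0 0 1)
        ok 0 _ = _
        ok 1 _ = _
        ok 2 _ = _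
        ok (suc (suc (suc _))) (s≤s (s≤s (s≤s ())))

      centre : ∀ i → i < 3 → Distinct (λ h → gauge n h i)
      centre i i<3 = go i i<3
        where
        π₂-centre : ∀ i h → π₂ h n i ≡ digit (2 * i) (2 * i) (suc i) h
        π₂-centre i 0 = if-true (n ≟ n) ≡.refl
        π₂-centre i 1 = if-true (n ≟ n) ≡.refl
        π₂-centre i (suc (suc _)) = ≡.refl
        go : ∀ i → i < 3 → Distinct (λ h → gauge n h i)
        go 0 _ = conclude (digit 0 0 1) (λ _ → 0) (digit 0 0 1) (π₂-centre 0)
          (Region.low {2 * n + 0} {0} (λ _ → ≡.refl) (s≤s (≤-reflexive (+-identityʳ (2 * n))))) _
        go 1 _ = conclude (digit 2 2 2) (digit 2 2 1) (digit 0 1 1) (π₂-centre 1)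
          (Region.middle {2 * n + 1} {1} (+-comm (2 * n) 1)) _
        go 2 _ = conclude (digit 4 4 3) (λ _ → 4) (digit 0 1 1) (π₂-centre 2)
          (Region.high {2 * n + 2} {2} (≤-reflexive (+-comm 2 (2 * n))) 2n+2<2m) _
          where
          eq : ∀ n → 2 * n + 2 + 2 * n ≡ 2 * (1 + 2 * n)
          eq = solve-∀
          2n+2<2m : 2 * n + 2 < 2 * m
          2n+2<2m = ≡.subst (2 * n + 2 <_) (eq n) (m<m+n (2 * n + 2) (≤-trans (>-nonZero⁻¹ n) (m≤m+n n _)))
        go (suc (suc (suc _))) (s≤s (s≤s (s≤s ())))

      right : ∀ {z₀} i → i < 3 → z₀ < m → n < z₀ → Distinct (λ h → gauge z₀ h i)
      right {z₀} i i<3 z₀<m n<z₀ with 2 * z₀ + i <? 2 * m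
      ... | yes t<2m = conclude (digit i (suc i) (suc i)) (λ _ → 2 * i) (digit 0 1 1) π₂-right (Region.high m<t t<2m) (ok i i<3)
        where
        m<t : m < 2 * z₀ + i
        m<t = ≤-trans (≡.subst (m <_) (≡.sym (*-distribˡ-+ 2 1 n)) ≤-refl) (≤-trans (*-monoʳ-≤ 2 n<z₀) (m≤m+n (2 * z₀) i))
        π₂-right : ∀ h → π₂ h z₀ i ≡ digit i (suc i) (suc i) h
        π₂-right 0 = if-false (z₀ ≟ n) (>⇒≢ n<z₀)
        π₂-right 1 = ≡.trans (if-false (z₀ ≟ n) (>⇒≢ n<z₀)) (if-false (z₀ <? n) (<-asym n<z₀))
        π₂-right (suc (suc _)) = ≡.refl
        ok : ∀ i → i < 3 → Good (digit i (suc i) (suc i)) (λ _ → 2 * i) (digit 0 1 1)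
        ok 0 _ = _
        ok 1 _ = _
        ok 2 _ = _
        ok (suc (suc (suc _))) (s≤s (s≤s (s≤s ())))
      ... | no t≮2m = go i i<3 t≡2m
        where
        t≡2m : 2 * z₀ + i ≡ 2 * m
        t≡2m = ≤-antisym (t≤2m {z₀} {i} z₀<m i<3) (≮⇒≥ t≮2m)
        π₂-right : ∀ i h → π₂ h z₀ i ≡ digit i (suc i) (suc i) h
        π₂-right i 0 = if-false (z₀ ≟ n) (>⇒≢ n<z₀)
        π₂-right i 1 = ≡.trans (if-false (z₀ ≟ n) (>⇒≢ n<z₀)) (if-false (z₀ <? n) (<-asym n<z₀))
        π₂-right i (suc (suc _)) = ≡.refl
        too-small : ∀ i → i < 2 → 2 * z₀ + i ≢ 2 * m
        too-small i i<2 = <⇒≢ (<-≤-trans (+-monoʳ-< (2 * z₀) i<2)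
          (≤-trans (≤-reflexive (≡.trans (+-comm (2 * z₀) 2) (≡.sym (*-distribˡ-+ 2 1 z₀)))) (*-monoʳ-≤ 2 z₀<m)))
        go : ∀ i → i < 3 → 2 * z₀ + i ≡ 2 * m → Distinct (λ h → gauge z₀ h i)
        go 0 _ e = ⊥-elim (too-small 0 z<s e)
        go 1 _ e = ⊥-elim (too-small 1 (s<s z<s) e)
        go 2 _ e = conclude (digit 2 3 3) (digit 2 4 4) (digit 0 1 2) (π₂-right 2) (Region.top e) _
        go (suc (suc (suc _))) (s≤s (s≤s (s≤s ()))) e

    gauge-distinct : ∀ {z₀ i} → z₀ < m → i < 3 → Distinct (λ h → gauge z₀ h i)
    gauge-distinct {z₀} {i} z₀<m i<3 with <-cmp z₀ n
    ... | tri< z₀<n _ _ = left i i<3 z₀<n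
    ... | tri≈ _ ≡.refl _ = centre i i<3
    ... | tri> _ _ n<z₀ = right i i<3 z₀<m n<z₀

    Z : ℕ → ℕ → ℕ
    Z z₀ h = z₀ + m * h

    -- Twice the carry together with the carry of 2z + i itself is a multiple of 3, so the top digit
    -- of σ(x) is exactly π₁.
    shift : ℕ → ℕ → ℕ → ℕ
    shift z₀ h i = π₁ (place h (2 * z₀ + i)) i + 2 * carry h (2 * z₀ + i)

    -- The exponents of x, σ x and x⁻¹ σ x for x = (z₀ , h , k , i).
    Xa Sa Sb Da Db : ℕ → ℕ → ℕ → ℕ → ℕ
    Xa z₀ h k i = Z z₀ h + M * k + i
    Sa z₀ h k i = 2 * Z z₀ h + i + M * shift z₀ h i
    Sb z₀ h k i = π₂ h z₀ i + i + 2 * shift z₀ h i + k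
    Da z₀ h k i = Z z₀ h + M * (shift z₀ h i + 2 * k)
    Db z₀ h k i = π₂ h z₀ i + 2 * shift z₀ h i + k

    private
      Z<M : ∀ {z₀ h} → z₀ < m → h < 3 → Z z₀ h < M
      Z<M {z₀} {h} z₀<m h<3 = <-≤-trans (+-monoˡ-< (m * h) z₀<m)
        (≤-trans (+-monoʳ-≤ m (*-monoʳ-≤ m (≤2 h<3))) (≤-reflexive (eq m)))
        where eq : ∀ m → m + m * 2 ≡ 3 * m
              eq = solve-∀

      Z-inj : ∀ {z₀ h z₀′ h′} → z₀ < m → h < 3 → z₀′ < m → h′ < 3 → Cong M (Z z₀ h) (Z z₀′ h′) → z₀ ≡ z₀′ × h ≡ h′
      Z-inj {z₀} {h} {z₀′} {h′} z₀<m h<3 z₀′<m h′<3 c = z₀≡ , *-cancelˡ-≡ h h′ m (+-cancelˡ-≡ z₀ _ _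
          (≡.trans Z≡ (≡.cong (_+ m * h′) (≡.sym z₀≡))))
        where
        Z≡ : Z z₀ h ≡ Z z₀′ h′
        Z≡ = Cong-< (Z<M z₀<m h<3) (Z<M z₀′<m h′<3) c
        z₀≡ : z₀ ≡ z₀′
        z₀≡ = Cong-< z₀<m z₀′<m (Cong-trans (Cong-sym (drop z₀ h)) (Cong-trans (≡⇒Cong Z≡) (drop z₀′ h′)))
          where
          drop : ∀ z₀ h → Cong m (Z z₀ h) z₀
          drop z₀ h = Cong-resp (≡.cong (z₀ +_) (*-comm h m)) ≡.refl (Cong-multiple z₀ h)

      drop-M : ∀ x y → Cong M (x + M * y) x
      drop-M x y = Cong-resp (≡.cong (x +_) (*-comm y M)) ≡.refl (Cong-multiple x y)

      strip : ∀ {x y u v} → x ≡ u → Cong (M * 3) (x + M * y) (u + M * v) → Cong 3 y v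
      strip {x} ≡.refl c = Cong-scale M (Cong-cancelˡ x c)

      halve : ∀ {x y} → Cong M (2 * x) (2 * y) → Cong M x y
      -- 2 + 3n is inverse to 2 modulo M = 3 + 6n.
      halve {x} {y} c = Cong-trans (Cong-sym (lem x)) (Cong-trans (Cong-* (2 + 3 * n) c) (lem y))
        where
        eq : ∀ n x → (2 + 3 * n) * (2 * x) ≡ x + x * (3 * (1 + 2 * n))
        eq = solve-∀
        lem : ∀ x → Cong M ((2 + 3 * n) * (2 * x)) x
        lem x = Cong-resp (≡.sym (eq n x)) ≡.refl (Cong-multiple x x)

    Same : (z₀ h k i z₀′ h′ k′ i′ : ℕ) → Set
    Same z₀ h k i z₀′ h′ k′ i′ = z₀ ≡ z₀′ × h ≡ h′ × k ≡ k′ × i ≡ i′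

    module _ {z₀ h k i z₀′ h′ k′ i′ : ℕ} (z₀<m : z₀ < m) (h<3 : h < 3) (k<3 : k < 3) (i<3 : i < 3)
             (z₀′<m : z₀′ < m) (h′<3 : h′ < 3) (k′<3 : k′ < 3) (i′<3 : i′ < 3) where

      private
        last-digit : Cong 3 (Db z₀ h k i) (Db z₀′ h′ k′ i′) → z₀ ≡ z₀′ → h ≡ h′ → i ≡ i′ → k ≡ k′
        last-digit c ≡.refl ≡.refl ≡.refl = Cong-< k<3 k′<3 (Cong-cancelˡ _ c)

        Sb≡ : ∀ z₀ h k i → Sb z₀ h k i ≡ Db z₀ h k i + i
        Sb≡ z₀ h k i = eq (π₂ h z₀ i) i (shift z₀ h i) k
          where eq : ∀ p i s k → p + i + 2 * s + k ≡ p + 2 * s + k + i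
                eq = solve-∀

      X-injective : Cong (M * 3) (Xa z₀ h k i) (Xa z₀′ h′ k′ i′) → Cong 3 i i′ → Same z₀ h k i z₀′ h′ k′ i′
      X-injective ca ci = z₀≡ , h≡ , Cong-< k<3 k′<3 (strip (≡.cong₂ Z z₀≡ h≡) ca′) , i≡
        where
        i≡  = Cong-< i<3 i′<3 ci
        ca′ : Cong (M * 3) (Z z₀ h + M * k) (Z z₀′ h′ + M * k′)
        ca′ = Cong-cancelʳ i (Cong-resp ≡.refl (≡.cong (Z z₀′ h′ + M * k′ +_) (≡.sym i≡)) ca)
        Z≡  = Z-inj z₀<m h<3 z₀′<m h′<3 (Cong-trans (Cong-sym (drop-M (Z z₀ h) k)) (Cong-trans (Cong-factor M 3 ca′) (drop-M (Z z₀′ h′) k′)))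
        z₀≡ = proj₁ Z≡
        h≡  = proj₂ Z≡

      -- Reduction modulo M gives the place. The top digit π₁ then gives i, the value of 2z + i
      -- gives z, and the second exponent gives k.
      σ-injective : Cong (M * 3) (Sa z₀ h k i) (Sa z₀′ h′ k′ i′) → Cong 3 (Sb z₀ h k i) (Sb z₀′ h′ k′ i′) →
                    Same z₀ h k i z₀′ h′ k′ i′
      σ-injective ca cb = z₀≡ , h≡ , last-digit Db≡ z₀≡ h≡ i≡ , i≡
        where
        pc  = place-carry {h} {2 * z₀ + i} h<3 (t≤2m z₀<m i<3)
        pc′ = place-carry {h′} {2 * z₀′ + i′} h′<3 (t≤2m z₀′<m i′<3)
        p  = place h (2 * z₀ + i)
        p′ = place h′ (2 * z₀′ + i′)
        c  = carry h (2 * z₀ + i)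
        c′ = carry h′ (2 * z₀′ + i′)
        Sa≡ : ∀ {z₀ h i p c} s → 2 * z₀ + i + 2 * m * h ≡ p + c * M → 2 * Z z₀ h + i + M * (s + 2 * c) ≡ p + M * (s + c * 3)
        Sa≡ {z₀} {h} {i} {p} {c} s e = ≡.trans (rearr z₀ m h i s c) (≡.trans (≡.cong (_+ 3 * m * (s + 2 * c)) e) (rearr′ p c m s))
          where
          rearr : ∀ z₀ m h i s c → 2 * (z₀ + m * h) + i + 3 * m * (s + 2 * c) ≡ (2 * z₀ + i + 2 * m * h) + 3 * m * (s + 2 * c)
          rearr = solve-∀
          rearr′ : ∀ p c m s → (p + c * (3 * m)) + 3 * m * (s + 2 * c) ≡ p + 3 * m * (s + c * 3)
          rearr′ = solve-∀
        ca′ : Cong (M * 3) (p + M * (π₁ p i + c * 3)) (p′ + M * (π₁ p′ i′ + c′ * 3))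
        ca′ = Cong-resp (Sa≡ {z₀} {h} {i} {p} {c} (π₁ p i) (proj₁ pc)) (Sa≡ {z₀′} {h′} {i′} {p′} {c′} (π₁ p′ i′) (proj₁ pc′)) ca
        p≡ : p ≡ p′
        p≡ = Cong-< (proj₂ pc) (proj₂ pc′) (Cong-trans (Cong-sym (drop-M p _)) (Cong-trans (Cong-factor M 3 ca′) (drop-M p′ _)))
        π≡ : Cong 3 (π₁ p i) (π₁ p i′)
        π≡ = Cong-trans (Cong-sym (Cong-multiple _ c)) (Cong-trans (strip p≡ ca′)
               (Cong-trans (Cong-multiple _ c′) (≡⇒Cong (≡.cong (λ q → π₁ q i′) (≡.sym p≡)))))
        i≡ : i ≡ i′
        i≡ = π₁-inj p i<3 i′<3 π≡
        2Z : ∀ z₀ h i p c → 2 * z₀ + i + 2 * m * h ≡ p + c * M → Cong M (2 * Z z₀ h + i) p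
        2Z z₀ h i p c e = Cong-resp (≡.sym (≡.trans (rearr z₀ m h i) e)) ≡.refl (Cong-multiple p c)
          where rearr : ∀ z₀ m h i → 2 * (z₀ + m * h) + i ≡ 2 * z₀ + i + 2 * m * h
                rearr = solve-∀
        Z≡ = Z-inj z₀<m h<3 z₀′<m h′<3 (halve (Cong-cancelʳ i (Cong-trans (2Z z₀ h i p c (proj₁ pc)) (Cong-trans (≡⇒Cong p≡)
               (Cong-trans (Cong-sym (2Z z₀′ h′ i′ p′ c′ (proj₁ pc′))) (≡⇒Cong (≡.cong (2 * Z z₀′ h′ +_) (≡.sym i≡))))))))
        z₀≡ = proj₁ Z≡
        h≡  = proj₂ Z≡
        Db≡ : Cong 3 (Db z₀ h k i) (Db z₀′ h′ k′ i′)
        Db≡ = Cong-cancelʳ i (Cong-resp (Sb≡ z₀ h k i) (≡.trans (Sb≡ z₀′ h′ k′ i′) (≡.cong (Db z₀′ h′ k′ i′ +_) (≡.sym i≡))) cb)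

      -- Reduction modulo M gives z. The top digit and the second exponent add up to π₂ modulo 3,
      -- free of `shift` and k, and this gives i.
      Δ₂-injective : Cong (M * 3) (Da z₀ h k i) (Da z₀′ h′ k′ i′) → Cong 3 (Db z₀ h k i) (Db z₀′ h′ k′ i′) →
                     Same z₀ h k i z₀′ h′ k′ i′
      Δ₂-injective ca cb = z₀≡ , h≡ , last-digit cb z₀≡ h≡ i≡ , i≡
        where
        Z-cong = Cong-trans (Cong-sym (drop-M (Z z₀ h) _)) (Cong-trans (Cong-factor M 3 ca) (drop-M (Z z₀′ h′) _))
        Z≡  = Z-inj z₀<m h<3 z₀′<m h′<3 Z-cong
        z₀≡ = proj₁ Z≡
        h≡  = proj₂ Z≡
        total : ∀ p s k → Cong 3 ((s + 2 * k) + (p + 2 * s + k)) p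
        total p s k = Cong-resp (≡.sym (eq p s k)) ≡.refl (Cong-multiple p (s + k))
          where eq : ∀ p s k → (s + 2 * k) + (p + 2 * s + k) ≡ p + (s + k) * 3
                eq = solve-∀
        i≡ : i ≡ i′
        i≡ = π₂-inj h z₀ i<3 i′<3 (Cong-trans (Cong-sym (total (π₂ h z₀ i) (shift z₀ h i) k))
               (Cong-trans (Cong-+ (strip (≡.cong₂ Z z₀≡ h≡) ca) cb)
               (Cong-trans (total (π₂ h′ z₀′ i′) (shift z₀′ h′ i′) k′) (≡⇒Cong (≡.sym (≡.cong₂ (λ h z₀ → π₂ h z₀ i′) h≡ z₀≡))))))

      -- As 3z = 3z₀ + Mh, reduction modulo 3 gives i and reduction modulo M gives z₀, while h moves
      -- into the top digit. There `gauge-distinct` recovers it.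
      Δ₁-injective : Cong (M * 3) (Sa z₀ h k i + Xa z₀ h k i) (Sa z₀′ h′ k′ i′ + Xa z₀′ h′ k′ i′) →
                     Cong 3 (Sb z₀ h k i + i) (Sb z₀′ h′ k′ i′ + i′) → Same z₀ h k i z₀′ h′ k′ i′
      Δ₁-injective ca cb = z₀≡ , h≡ , last-digit Db≡ z₀≡ h≡ i≡ , i≡
        where
        s  = shift z₀ h i
        s′ = shift z₀′ h′ i′
        Wa : ∀ z₀ h k i → Sa z₀ h k i + Xa z₀ h k i ≡ 3 * z₀ + 2 * i + M * (h + shift z₀ h i + k)
        Wa z₀ h k i = eq z₀ m h i k (shift z₀ h i)
          where eq : ∀ z₀ m h i k s → (2 * (z₀ + m * h) + i + 3 * m * s) + (z₀ + m * h + 3 * m * k + i) ≡ 3 * z₀ + 2 * i + 3 * m * (h + s + k)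
                eq = solve-∀
        ca′ : Cong (M * 3) (3 * z₀ + 2 * i + M * (h + s + k)) (3 * z₀′ + 2 * i′ + M * (h′ + s′ + k′))
        ca′ = Cong-resp (Wa z₀ h k i) (Wa z₀′ h′ k′ i′) ca
        cM : Cong M (3 * z₀ + 2 * i) (3 * z₀′ + 2 * i′)
        cM = Cong-trans (Cong-sym (drop-M _ _)) (Cong-trans (Cong-factor M 3 ca′) (drop-M _ _))
        mod3 : ∀ z₀ i → Cong 3 (3 * z₀ + 2 * i) (2 * i)
        mod3 z₀ i = Cong-resp (eq z₀ i) ≡.refl (Cong-multiple (2 * i) z₀)
          where eq : ∀ z₀ i → 2 * i + z₀ * 3 ≡ 3 * z₀ + 2 * i
                eq = solve-∀
        i≡ : i ≡ i′
        i≡ = Cong-< i<3 i′<3 (2i (Cong-trans (Cong-sym (mod3 z₀ i)) (Cong-trans (Cong-factor 3 m cM) (mod3 z₀′ i′))))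
        z₀≡ : z₀ ≡ z₀′
        z₀≡ = Cong-< z₀<m z₀′<m (Cong-scale 3 (Cong-cancelʳ (2 * i)
                (Cong-resp ≡.refl (≡.cong (λ j → 3 * z₀′ + 2 * j) (≡.sym i≡)) cM)))
        Db≡ : Cong 3 (Db z₀ h k i) (Db z₀′ h′ k′ i′)
        Db≡ = Cong-cancelʳ i (Cong-cancelʳ i (Cong-resp (≡.cong (_+ i) (Sb≡ z₀ h k i))
                (≡.trans (≡.cong (_+ i′) (Sb≡ z₀′ h′ k′ i′)) (≡.cong (λ j → Db z₀′ h′ k′ i′ + j + j) (≡.sym i≡))) cb))
        total : ∀ z₀ h k i → Cong 3 ((h + shift z₀ h i + k) + 2 * Db z₀ h k i) (gauge z₀ h i)
        total z₀ h k i = Cong-resp (≡.sym (eq h (π₂ h z₀ i) (π₁ (place h t) i) (carry h t) k)) ≡.refl (Cong-multiple _ (π₁ (place h t) i + 3 * carry h t + k))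
          where
          t = 2 * z₀ + i
          eq : ∀ h p₂ p c k → (h + (p + 2 * c) + k) + 2 * (p₂ + 2 * (p + 2 * c) + k) ≡ (h + 2 * p₂ + 2 * p + c) + (p + 3 * c + k) * 3
          eq = solve-∀
        h≡ : h ≡ h′
        h≡ = gauge-distinct {z₀} {i} z₀<m i<3 h<3 h′<3 (Cong-trans (Cong-sym (total z₀ h k i))
               (Cong-trans (Cong-+ (strip (≡.cong₂ (λ z i → 3 * z + 2 * i) z₀≡ i≡) ca′) (Cong-* 2 Db≡))
               (Cong-trans (total z₀′ h′ k′ i′) (≡⇒Cong (≡.sym (≡.cong₂ (λ z i → gauge z h′ i) z₀≡ i≡))))))

open Arithmetic

module _ {c ℓ : Level} (G : Group c ℓ) where
  open Group G
  open Powers G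
  open import Relation.Binary.Reasoning.Setoid setoid

  record IsC₃ᵗ×C₃ (t : ℕ) (g y : Carrier) : Set (c ⊔ ℓ) where
    field
      commute   : Commute g y
      g-order   : g ↑ (3 ^ t) ≈ ε
      y-order   : y ↑ 3 ≈ ε
      generated : ∀ x → ∃₂ λ n l → x ≈ g ↑ n ∙ y ↑ l
      unique    : ∀ n l n′ l′ → g ↑ n ∙ y ↑ l ≈ g ↑ n′ ∙ y ↑ l′ → Cong (3 ^ t) n n′ × Cong 3 l l′

  module _ {g y : Carrier} where

    el : ℕ → ℕ → Carrier
    el n l = g ↑ n ∙ y ↑ l

    el-∙ : Commute g y → ∀ n l n′ l′ → el n l ∙ el n′ l′ ≈ el (n + n′) (l + l′)
    el-∙ gy n l n′ l′ = trans (interchange _ _ (commute-↑↑ l n′ (sym gy))) (∙-cong (sym (↑-+ g n n′)) (sym (↑-+ y l l′)))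

    ↑-Cong : ∀ {x d m n} .{{_ : NonZero d}} → x ↑ d ≈ ε → Cong d m n → x ↑ m ≈ x ↑ n
    ↑-Cong {d = d} h c = ↑-≡% d h (Cong⇒% c)

    module _ (n : ℕ) .{{_ : NonZero n}} {t : ℕ} (3ᵗ≡ : 3 ^ t ≡ 3 * (1 + 2 * n) * 3)
             (isC : IsC₃ᵗ×C₃ t g y) where
      open IsC₃ᵗ×C₃ isC
      open Shear n

      private
        F : Set
        F = Fin m × Fin 3 × Fin 3 × Fin 3

        at : (ℕ → ℕ → ℕ → ℕ → ℕ) → F → ℕ
        at e (z₀ , h , k , i) = e (toℕ z₀) (toℕ h) (toℕ k) (toℕ i)

        Xb : ℕ → ℕ → ℕ → ℕ → ℕ
        Xb z₀ h k i = i

        u φ : F → Carrier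
        u x = el (at Xa x) (at Xb x)
        φ x = el (at Sa x) (at Sb x)

        g-M3 : g ↑ (M * 3) ≈ ε
        g-M3 = trans (↑-≡ g (≡.sym 3ᵗ≡)) g-order

        el-cong : ∀ {n l n′ l′} → Cong (M * 3) n n′ → Cong 3 l l′ → el n l ≈ el n′ l′
        el-cong c c′ = ∙-cong (↑-Cong g-M3 c) (↑-Cong y-order c′)

        unique′ : ∀ {n l n′ l′} → el n l ≈ el n′ l′ → Cong (M * 3) n n′ × Cong 3 l l′
        unique′ e with unique _ _ _ _ e
        ... | c , c′ = ≡.subst (λ d → Cong d _ _) 3ᵗ≡ c , c′

        toF : ∀ (x x′ : F) → Same (at (λ a _ _ _ → a) x) (at (λ _ b _ _ → b) x) (at (λ _ _ c _ → c) x) (at (λ _ _ _ d → d) x)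
                                  (at (λ a _ _ _ → a) x′) (at (λ _ b _ _ → b) x′) (at (λ _ _ c _ → c) x′) (at (λ _ _ _ d → d) x′) → x ≡ x′
        toF _ _ (e₁ , e₂ , e₃ , e₄) = ≡.cong₂ _,_ (toℕ-injective e₁) (≡.cong₂ _,_ (toℕ-injective e₂) (≡.cong₂ _,_ (toℕ-injective e₃) (toℕ-injective e₄)))

        by-exponents : (ea eb : ℕ → ℕ → ℕ → ℕ → ℕ) →
          (∀ {z₀ h k i z₀′ h′ k′ i′} → z₀ < m → h < 3 → k < 3 → i < 3 → z₀′ < m → h′ < 3 → k′ < 3 → i′ < 3 →
             Cong (M * 3) (ea z₀ h k i) (ea z₀′ h′ k′ i′) → Cong 3 (eb z₀ h k i) (eb z₀′ h′ k′ i′) → Same z₀ h k i z₀′ h′ k′ i′) →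
          {x : F → Carrier} → (∀ a → x a ≈ el (at ea a) (at eb a)) → ∀ a a′ → x a ≈ x a′ → a ≡ a′
        by-exponents ea eb inj x≈ a@(z₀ , h , k , i) a′@(z₀′ , h′ , k′ , i′) e with unique′ (trans (sym (x≈ a)) (trans e (x≈ a′)))
        ... | ca , cb = toF a a′ (inj (toℕ<n z₀) (toℕ<n h) (toℕ<n k) (toℕ<n i) (toℕ<n z₀′) (toℕ<n h′) (toℕ<n k′) (toℕ<n i′) ca cb)

        decode : ℕ → ℕ → F
        decode n l = fromℕ< (m%n<n w m) , fromℕ< (m%n<n (w / m) 3) , fromℕ< (m%n<n (w / m / 3) 3) , fromℕ< (m%n<n l 3)
          -- This is n - l modulo 9m, with 9m - 1 standing for -1: the parametrisation adds i to
          -- both coordinates.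
          where w = n + (l % 3) * (M * 3 ∸ 1)

        decode-≈ : ∀ n l → el n l ≈ u (decode n l)
        decode-≈ n l = el-cong (Cong-trans (Cong-sym w+i) (Cong-resp (≡.sym w+i≡) Xa≡ (Cong-multiple (R + i) (q / 3 / 3))))
            (Cong-trans (%⇒Cong (≡.sym (m%n%n≡m%n l 3))) (≡⇒Cong (≡.sym (toℕ-fromℕ< (m%n<n l 3)))))
          where
          i = l % 3
          w = n + i * (M * 3 ∸ 1)
          w+i : Cong (M * 3) (w + i) n
          w+i = Cong-resp (eq n i (M * 3 ∸ 1)) ≡.refl (Cong-multiple n i)
            where eq : ∀ n i p → n + i * suc p ≡ n + i * p + i
                  eq = solve-∀
          q = w / m
          R = w % m + m * (q % 3) + M * (q / 3 % 3)
          w+i≡ : w + i ≡ (R + i) + (q / 3 / 3) * (M * 3)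
          w+i≡ = ≡.trans (≡.cong (_+ i) (≡.trans (m≡m%n+[m/n]*n w m) (≡.cong (λ q → w % m + q * m) (≡.trans (m≡m%n+[m/n]*n q 3)
            (≡.cong (λ q′ → q % 3 + q′ * 3) (m≡m%n+[m/n]*n (q / 3) 3)))))) (eq (w % m) (q % 3) (q / 3 % 3) (q / 3 / 3) m i)
            where eq : ∀ z h k r m i → z + (h + (k + r * 3) * 3) * m + i ≡ z + m * h + 3 * m * k + i + r * (3 * m * 3)
                  eq = solve-∀
          Xa≡ : R + i ≡ at Xa (decode n l)
          Xa≡ = ≡.sym (≡.cong₂ _+_ (≡.cong₂ _+_ (≡.cong₂ (λ z h → z + m * h) (toℕ-fromℕ< (m%n<n w m)) (toℕ-fromℕ< (m%n<n q 3)))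
            (≡.cong (M *_) (toℕ-fromℕ< (m%n<n (q / 3) 3)))) (toℕ-fromℕ< (m%n<n l 3)))

        index : Carrier → F
        index x = decode (proj₁ (generated x)) (proj₁ (proj₂ (generated x)))

        u-index : ∀ x → x ≈ u (index x)
        u-index x = trans (proj₂ (proj₂ (generated x))) (decode-≈ _ _)

        div-≈ : ∀ a → u a ⁻¹ ∙ φ a ≈ el (at Da a) (at Db a)
        div-≈ a@(z₀ , h , k , i) = begin
          u a ⁻¹ ∙ φ a ≈⟨ ∙-congˡ (el-cong
            (Cong-resp (eq (Z (toℕ z₀) (toℕ h)) M (toℕ k) (toℕ i) (shift (toℕ z₀) (toℕ h) (toℕ i))) ≡.refl (Cong-multiple (at Sa a) (toℕ k)))
            (≡⇒Cong (eq′ (π₂ (toℕ h) (toℕ z₀) (toℕ i)) (toℕ i) (shift (toℕ z₀) (toℕ h) (toℕ i)) (toℕ k)))) ⟨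
          u a ⁻¹ ∙ el (at Xa a + at Da a) (at Xb a + at Db a) ≈⟨ ∙-congˡ (el-∙ commute _ _ _ _) ⟨
          u a ⁻¹ ∙ (u a ∙ el (at Da a) (at Db a)) ≈⟨ assoc _ _ _ ⟨
          u a ⁻¹ ∙ u a ∙ el (at Da a) (at Db a) ≈⟨ ∙-congʳ (inverseˡ _) ⟩
          ε ∙ el (at Da a) (at Db a) ≈⟨ identityˡ _ ⟩
          el (at Da a) (at Db a) ∎
          where
          eq : ∀ Z M k i s → 2 * Z + i + M * s + k * (M * 3) ≡ (Z + M * k + i) + (Z + M * (s + 2 * k))
          eq = solve-∀
          eq′ : ∀ p i s k → i + (p + 2 * s + k) ≡ p + i + 2 * s + k
          eq′ = solve-∀

        conj-≈ : ∀ a → (u a ⁻¹ ∙ φ a) ∙ u a ≈ φ a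
        conj-≈ a = begin
          (u a ⁻¹ ∙ φ a) ∙ u a ≈⟨ assoc _ _ _ ⟩
          u a ⁻¹ ∙ (φ a ∙ u a) ≈⟨ ∙-congˡ (trans (el-∙ commute _ _ _ _) (trans (∙-cong (↑-≡ g (ℕ.+-comm (at Sa a) _)) (↑-≡ y (ℕ.+-comm (at Sb a) _))) (sym (el-∙ commute _ _ _ _)))) ⟩
          u a ⁻¹ ∙ (u a ∙ φ a) ≈⟨ assoc _ _ _ ⟨
          u a ⁻¹ ∙ u a ∙ φ a ≈⟨ ∙-congʳ (inverseˡ _) ⟩
          ε ∙ φ a ≈⟨ identityˡ _ ⟩
          φ a ∎

      shear-colouring : InjColouring G
      shear-colouring = Parametrised.fromParametrisation G u index u-index
        (λ {x} {x′} e → by-exponents Xa Xb X-injective (λ a → refl) (index x) (index x′) (trans (sym (u-index x)) (trans e (u-index x′))))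
        φ
        (by-exponents Sa Sb σ-injective (λ a → refl))
        (by-exponents (λ z h k i → Sa z h k i + Xa z h k i) (λ z h k i → Sb z h k i + i) Δ₁-injective (λ a → el-∙ commute _ _ _ _))
        (by-exponents Da Db Δ₂-injective div-≈)
        (by-exponents Sa Sb σ-injective conj-≈)

  odd-power : ∀ s → ∃ λ n → NonZero n × 3 ^ suc s ≡ 1 + 2 * n
  odd-power zero = 1 , _ , ≡.refl
  odd-power (suc s) with odd-power s
  ... | n , _ , e = suc (3 * n) , _ , ≡.trans (≡.cong (3 *_) e) (eq n)
    where eq : ∀ n → 3 * (1 + 2 * n) ≡ 1 + 2 * suc (3 * n)
          eq = solve-∀

  -- `Shear` needs m = 3^t with m ≥ 3. For t = 0 the group has order 27 and is covered by the table,
  -- with z = g³ and trivial action.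
  C₃ᵗ×C₃-colouring : ∀ t {g y} → IsC₃ᵗ×C₃ (2 + t) g y → InjColouring G
  C₃ᵗ×C₃-colouring (suc s) isC with odd-power s
  ... | n , nz , e = shear-colouring n {{nz}} (≡.trans (≡.cong (λ x → 3 * (3 * x)) e) (eq (1 + 2 * n))) isC
    where eq : ∀ m → 3 * (3 * m) ≡ 3 * m * 3
          eq = solve-∀
  C₃ᵗ×C₃-colouring zero {g} {y} isC = order27-colouring G (λ x → sym (z-comm x)) z³ y-order {1} {0} (s≤s (s≤s z≤n)) (s≤s z≤n)
      (sym (↑-1 z)) yg gen uniq
    where
    open IsC₃ᵗ×C₃ isC
    z = g ↑ 3
    z³ : z ↑ 3 ≈ ε
    z³ = trans (sym (↑-*′ g 3 3)) g-order
    z-comm : ∀ x → Commute x z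
    z-comm x with generated x
    ... | n , l , e = sym (commute-resp (sym e) (commute-∙ (commute-↑↑ 3 n refl) (commute-↑↑ 3 l commute)))
    yg : y ∙ g ≈ g ∙ (y ∙ z ↑ 0)
    yg = trans (sym commute) (∙-congˡ (sym (trans (∙-congˡ (↑-0 z)) (identityʳ y))))
    gen : ∀ x → ∃ λ n → x ≈ normalForm G {g} {z} {y} (λ x → sym (z-comm x)) z³ y-order n
    gen x with generated x
    ... | n , l , e = (n , 0 , l) , trans e (∙-congˡ (sym (trans (∙-congʳ (↑-0 z)) (identityˡ _))))
    nf : ∀ q i j → g ↑ q ∙ (z ↑ i ∙ y ↑ j) ≈ g ↑ (q + 3 * i) ∙ y ↑ j
    nf q i j = trans (sym (assoc _ _ _)) (∙-congʳ (trans (∙-congˡ (sym (↑-*′ g 3 i))) (sym (↑-+ g q _))))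
    uniq : ∀ m n → proj₁ m < 3 → proj₁ n < 3 → _ → Digits.code 3 3 3 m ≡ Digits.code 3 3 3 n
    uniq (q , i , j) (q′ , i′ , j′) q<3 q′<3 e with unique (q + 3 * i) j (q′ + 3 * i′) j′ (trans (sym (nf q i j)) (trans e (nf q′ i′ j′)))
    ... | c , c′ = ≡.cong₂ (λ a b → a * 3 + b) (≡.cong₂ (λ a b → a * 3 + b) (≡.cong (_% 3) q≡) (Cong⇒% i≡)) (Cong⇒% c′)
      where
      drop : ∀ q i → Cong 3 (q + 3 * i) q
      drop q i = Cong-resp (≡.cong (q +_) (ℕ.*-comm i 3)) ≡.refl (Cong-multiple q i)
      q≡ : q ≡ q′
      q≡ = Cong-< q<3 q′<3 (Cong-trans (Cong-sym (drop q i)) (Cong-trans (Cong-factor 3 3 c) (drop q′ i′)))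
      i≡ : Cong 3 i i′
      i≡ = Cong-scale 3 (Cong-cancelˡ q (Cong-resp ≡.refl (≡.cong (_+ 3 * i′) (≡.sym q≡)) c))

-- Normal subgroups of type C₃ × C₃

least : ∀ {p} {P : ℕ → Set p} → (∀ n → Dec (P n)) → ∀ n → P n → P 0 ⊎ ∃ λ m → ¬ P m × P (suc m)
least P? zero    p = inj₁ p
least P? (suc n) p with P? n
... | yes q = least P? n q
... | no ¬q = inj₂ (n , ¬q , p)


module _ {c ℓ : Level} where

  Cyclic : Group c ℓ → Set (c ⊔ ℓ)
  Cyclic G = ∃ λ g → ∀ x → ∃ λ n → x ≈ g ↑ n
    where open Group G
          open Powers G

  record IsNormalC₃² (G : Group c ℓ) (z y : Group.Carrier G) : Set (c ⊔ ℓ) where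
    open Group G
    open Powers G
    field
      z-central₃ : IsCentral₃ G z
      z≉ε      : ¬ z ≈ ε
      y³       : y ↑ 3 ≈ ε
      y∉⟨z⟩    : ¬ _≈/_ G z-central₃ y ε
      action   : ∀ t → ∃ λ a → y ∙ t ≈ t ∙ (y ∙ z ↑ a)

    y-central₃ : IsCentral₃ (quotient G z-central₃) y
    y-central₃ = central₃ (λ x → proj₁ (action x) , trans (proj₂ (action x)) (sym (assoc _ _ _))) (≈⇒≈/ G z-central₃ y³)

    Quotient : Group c ℓ
    Quotient = quotient (quotient G z-central₃) y-central₃

    open IsCentral₃ z-central₃ public renaming (central to z-central; cube to z³)

  NormalC₃² : Group c ℓ → Set (c ⊔ ℓ)
  NormalC₃² G = ∃₂ λ z y → IsNormalC₃² G z y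

  Chain-exponent : ∀ k (G : Group c ℓ) → Chain k G → ∀ x → Group._≈_ G (Powers._↑_ G x (3 ^ k)) (Group.ε G)
  Chain-exponent zero    G triv x = triv _
  Chain-exponent (suc k) G (z , hz , z≉ε , ch) x with Chain-exponent k _ ch x
  ... | n , e = trans (↑-* x 3 (3 ^ k)) (trans (↑-cong 3 (trans e (identityˡ _)))
                  (trans (sym (↑-* z 3 n)) (trans (↑-≡ z (ℕ.*-comm 3 n)) (↑-mult 3 n (IsCentral₃.cube hz)))))
    where open Group G
          open Powers G

  -- If the quotient by z is cyclic, generated by g, then G is abelian. A power of g that has order
  -- 3 modulo z either has trivial cube and serves as y, or its cube generates ⟨z⟩ and then g
  -- generates G. Otherwise a pair z′, y′ in the quotient is lifted: z′ serves as y if its cube is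
  -- trivial, and else y′ is corrected by a power of z′.
  cyclic-or-normalC₃² : ∀ k (G : Group c ℓ) → Chain k G → Cyclic G ⊎ NormalC₃² G
  cyclic-or-normalC₃² zero    G triv = inj₁ (Group.ε G , λ x → 0 , Group.trans G (triv x) (Group.sym G (triv _)))
  cyclic-or-normalC₃² (suc k) G (z , hz , z≉ε , ch) with cyclic-or-normalC₃² k _ ch
  ... | inj₁ (g , gen) = cases (least (λ t → Chain-dec k _ ch (g ↑ (3 ^ t)) ε) k (Chain-exponent k _ ch g))
    where
    open Group G
    open Powers G
    open Commutators G
    open IsCentral₃ hz
    g-comm : ∀ s x → Commute (g ↑ s) x
    g-comm s x with gen x
    ... | n , i , e = commute-resp (sym e) (commute-∙ (commute-↑↑ s n refl) (sym (commute-↑↑ i s (central g))))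
    cases : _ → Cyclic G ⊎ NormalC₃² G
    cases (inj₁ (i , e)) = inj₁ (z , λ x → let n , j , h = gen x in i * n + j ,
      trans h (trans (∙-congʳ (trans (↑-cong n (trans (sym (↑-1 g)) (trans e (identityˡ _)))) (sym (↑-*′ z i n)))) (sym (↑-+ z _ j))))
    cases (inj₂ (t , y∉ , (i , e))) with Chain-dec (suc k) G (z , hz , z≉ε , ch) ((g ↑ (3 ^ t)) ↑ 3) ε
    ... | yes y³ = inj₂ (_ , _ , record
      { z-central₃ = hz ; z≉ε = z≉ε ; y³ = y³ ; y∉⟨z⟩ = y∉
      ; action = λ x → 0 , trans (g-comm (3 ^ t) x) (∙-congˡ (sym (trans (∙-congˡ (↑-0 z)) (identityʳ _)))) })
    ... | no y³≉ = inj₁ (g , λ x → let n , j , h = gen x in n + (3 ^ suc t) * (i * j) , (begin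
        x ≈⟨ h ⟩
        g ↑ n ∙ z ↑ j ≈⟨ ∙-congˡ (↑-cong j (order3-root cube i (λ h → y³≉ (trans y³≈ h)))) ⟩
        g ↑ n ∙ ((z ↑ i) ↑ i) ↑ j ≈⟨ ∙-congˡ (trans (sym (↑-*′ (z ↑ i) i j)) (↑-cong (i * j) (trans (sym (identityˡ _)) (sym e)))) ⟩
        g ↑ n ∙ (g ↑ (3 ^ suc t)) ↑ (i * j) ≈⟨ ∙-congˡ (↑-*′ g _ (i * j)) ⟨
        g ↑ n ∙ g ↑ (3 ^ suc t * (i * j)) ≈⟨ ↑-+ g n _ ⟨
        g ↑ (n + 3 ^ suc t * (i * j)) ∎))
      where
      open import Relation.Binary.Reasoning.Setoid setoid
      y³≈ : (g ↑ (3 ^ t)) ↑ 3 ≈ z ↑ i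
      y³≈ = trans (sym (↑-* g 3 (3 ^ t))) (trans e (identityˡ _))
  ... | inj₂ (z′ , y′ , nn) = lift (Chain-dec (suc k) G (z , hz , z≉ε , ch) (z′ ↑ 3) ε)
    where
    open Group G
    open Powers G
    open Commutators G
    open IsCentral₃ hz
    open import Relation.Binary.Reasoning.Setoid setoid
    Ḡ = quotient G hz
    module Ḡ = Group Ḡ
    module P̄ = Powers Ḡ
    open IsNormalC₃² nn using (z-central₃) renaming (z-central to z′-central; z³ to z′³; z≉ε to z′≉; y³ to y′³; y∉⟨z⟩ to y′∉; action to y′-action)
    z-↑ : ∀ n → Central (z ↑ n)
    z-↑ = central-↑ central
    lift : Dec (z′ ↑ 3 ≈ ε) → Cyclic G ⊎ NormalC₃² G
    lift (yes z′³≈ε) = inj₂ (_ , _ , record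
      { z-central₃ = hz ; z≉ε = z≉ε ; y³ = z′³≈ε ; y∉⟨z⟩ = z′≉
      ; action = λ x → proj₁ (z′-central x) , trans (proj₂ (z′-central x)) (assoc _ _ _) })
    lift (no z′³≉ε) = inj₂ (_ , _ , record
      { z-central₃ = hz ; z≉ε = z≉ε ; y³ = y³ ; y∉⟨z⟩ = y∉ ; action = action })
      where
      n = proj₁ z′³
      m = proj₁ y′³
      -- Here z′ has order 9. Since z = z′^(3n), it follows that y′³ = z^m = z′^(3e), and the factor
      -- z′^(2e) makes the cube trivial.
      e = n * m
      z′³≈ : z′ ↑ 3 ≈ z ↑ n
      z′³≈ = trans (proj₂ z′³) (identityˡ _)
      y′³≈ : y′ ↑ 3 ≈ z ↑ m
      y′³≈ = trans (proj₂ y′³) (identityˡ _)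
      z≈ : z ≈ (z′ ↑ 3) ↑ n
      z≈ = trans (order3-root cube n (λ h → z′³≉ε (trans z′³≈ h))) (↑-cong n (sym z′³≈))
      z′⁹ : (z′ ↑ 3) ↑ 3 ≈ ε
      z′⁹ = trans (↑-cong 3 z′³≈) (trans (sym (↑-*′ z n 3)) (↑-mult 3 n cube))
      y = y′ ∙ z′ ↑ (2 * e)
      cubed : ∀ {u v} → v Ḡ.∙ u Ḡ.≈ u Ḡ.∙ v → (u ∙ v) ↑ 3 ≈ u ↑ 3 ∙ v ↑ 3
      cubed (i , h) = cube-∙ h (z-↑ i) (trans (sym (↑-*′ z i 3)) (↑-mult 3 i cube))
      z′-↑ : ∀ n x → (z′ ↑ n ∙ x) Ḡ.≈ (x ∙ z′ ↑ n)
      z′-↑ n x = Ḡ.sym {x ∙ z′ ↑ n} {z′ ↑ n ∙ x} (P̄.commute-↑ n (Ḡ.sym {z′ ∙ x} {x ∙ z′} (z′-central x)))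
      y³ : y ↑ 3 ≈ ε
      y³ = begin
        (y′ ∙ z′ ↑ (2 * e)) ↑ 3 ≈⟨ cubed (z′-↑ (2 * e) y′) ⟩
        y′ ↑ 3 ∙ (z′ ↑ (2 * e)) ↑ 3 ≈⟨ ∙-cong (trans y′³≈ (trans (↑-cong m z≈) (sym (↑-*′ (z′ ↑ 3) n m)))) (trans (sym (↑-* z′ 3 (2 * e))) (↑-*′ z′ 3 (2 * e))) ⟩
        (z′ ↑ 3) ↑ e ∙ (z′ ↑ 3) ↑ (2 * e) ≈⟨ ↑-+ (z′ ↑ 3) e _ ⟨
        (z′ ↑ 3) ↑ (e + 2 * e) ≈⟨ trans (↑-*′ (z′ ↑ 3) 3 e) (trans (↑-cong e z′⁹) (ε-↑ e)) ⟩
        ε ∎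
      y∉ : ¬ (y Ḡ.≈ ε)
      y∉ h = y′∉ (e , Ḡ.trans {y′} {y ∙ z′ ↑ e} {ε ∙ z′ ↑ e}
          (Ḡ.sym {y ∙ z′ ↑ e} {y′} (n * e , (begin
            y′ ∙ z′ ↑ (2 * e) ∙ z′ ↑ e ≈⟨ trans (assoc _ _ _) (∙-congˡ (sym (↑-+ z′ (2 * e) e))) ⟩
            y′ ∙ z′ ↑ (2 * e + e) ≈⟨ ∙-congˡ (trans (↑-≡ z′ (eq e)) (↑-*′ z′ 3 e)) ⟩
            y′ ∙ (z′ ↑ 3) ↑ e ≈⟨ ∙-congˡ (trans (↑-cong e z′³≈) (sym (↑-*′ z n e))) ⟩
            y′ ∙ z ↑ (n * e) ∎)))
          (Ḡ.∙-congʳ {z′ ↑ e} {y} {ε} h))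
        where eq : ∀ e → 2 * e + e ≡ 3 * e
              eq = solve-∀
      action : ∀ t → ∃ λ a → y ∙ t ≈ t ∙ (y ∙ z ↑ a)
      action t with y′-action t
      ... | a , h = n * (a / 3) + b , (begin
          y ∙ t ≈⟨ y-t ⟩
          t ∙ s ≈⟨ ∙-congˡ (trans (assoc _ _ _) (∙-congˡ (∙-congʳ z′ᵃ))) ⟩
          t ∙ (y ∙ (z ↑ (n * (a / 3)) ∙ z ↑ b)) ≈⟨ ∙-congˡ (∙-congˡ (↑-+ z (n * (a / 3)) b)) ⟨
          t ∙ (y ∙ z ↑ (n * (a / 3) + b)) ∎)
        where
        w = z′ ↑ (2 * e)
        in-Ḡ : (y ∙ t) Ḡ.≈ (t ∙ (y ∙ z′ ↑ a))
        in-Ḡ = Ḡ.trans {y ∙ t} {y′ ∙ t ∙ w} {t ∙ (y ∙ z′ ↑ a)} (P̄.swapʳ y′ (z′-↑ (2 * e) t))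
          (Ḡ.trans {y′ ∙ t ∙ w} {t ∙ (y′ ∙ z′ ↑ a) ∙ w} {t ∙ (y ∙ z′ ↑ a)} (Ḡ.∙-congʳ {w} {y′ ∙ t} {t ∙ (y′ ∙ z′ ↑ a)} h)
            (≈⇒≈/ G hz (trans (assoc _ _ _) (∙-congˡ (swapʳ y′ (commute-↑↑ a (2 * e) refl))))))
        b = proj₁ in-Ḡ
        s = (y ∙ z′ ↑ a) ∙ z ↑ b
        y-t : y ∙ t ≈ t ∙ s
        y-t = trans (proj₂ in-Ḡ) (assoc _ _ _)
        -- s is conjugate to y, so its cube is trivial. That cube is z′^(3a); hence 3 divides a, and
        -- z′^a already lies in ⟨z⟩.
        s³ : s ↑ 3 ≈ ε
        s³ = ∙-cancelˡ t _ _ (trans (sym (conjugate-↑ y-t 3)) (trans (∙-congʳ y³) (trans (identityˡ t) (sym (identityʳ t)))))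
        z′³ᵃ : (z′ ↑ 3) ↑ a ≈ ε
        z′³ᵃ = begin
          (z′ ↑ 3) ↑ a ≈⟨ trans (sym (↑-*′ z′ 3 a)) (↑-* z′ 3 a) ⟩
          (z′ ↑ a) ↑ 3 ≈⟨ identityˡ _ ⟨
          ε ∙ (z′ ↑ a) ↑ 3 ≈⟨ ∙-congʳ y³ ⟨
          y ↑ 3 ∙ (z′ ↑ a) ↑ 3 ≈⟨ cubed (z′-↑ a y) ⟨
          (y ∙ z′ ↑ a) ↑ 3 ≈⟨ identityʳ _ ⟨
          (y ∙ z′ ↑ a) ↑ 3 ∙ ε ≈⟨ ∙-congˡ (trans (sym (↑-*′ z b 3)) (↑-mult 3 b cube)) ⟨
          (y ∙ z′ ↑ a) ↑ 3 ∙ (z ↑ b) ↑ 3 ≈⟨ ∙-↑ 3 (sym (z-↑ b _)) ⟨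
          s ↑ 3 ≈⟨ s³ ⟩
          ε ∎
        z′ᵃ : z′ ↑ a ≈ z ↑ (n * (a / 3))
        z′ᵃ = begin
          z′ ↑ a ≈⟨ ↑-≡ z′ (≡.trans (m≡m%n+[m/n]*n a 3) (≡.trans (≡.cong (_+ a / 3 * 3) (order3-∤ z′⁹ z′³≉ε a z′³ᵃ)) (ℕ.*-comm (a / 3) 3))) ⟩
          z′ ↑ (3 * (a / 3)) ≈⟨ ↑-*′ z′ 3 (a / 3) ⟩
          (z′ ↑ 3) ↑ (a / 3) ≈⟨ ↑-cong (a / 3) z′³≈ ⟩
          (z ↑ n) ↑ (a / 3) ≈⟨ ↑-*′ z n (a / 3) ⟨
          z ↑ (n * (a / 3)) ∎

-- The subgroup N and its quotient

module _ {c ℓ : Level} where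

  module NormalSubgroup (G : Group c ℓ) {z y : Group.Carrier G} (N : IsNormalC₃² G z y) where
    open Group G
    open Powers G
    open Commutators G
    open IsNormalC₃² N public
    open import Relation.Binary.Reasoning.Setoid setoid

    z-↑ : ∀ n → Central (z ↑ n)
    z-↑ = central-↑ z-central

    infix 4 _≈Q_
    _≈Q_ : Rel Carrier ℓ
    _≈Q_ = Group._≈_ Quotient

    module Q where
      open Group Quotient public using (trans; sym; refl; ∙-congʳ; ∙-congˡ)

    ≈⇒≈Q : ∀ {x x′} → x ≈ x′ → x ≈Q x′
    ≈⇒≈Q e = ≈⇒≈/ _ y-central₃ (≈⇒≈/ G z-central₃ e)

    ≈/⇒≈Q : ∀ {x x′} → _≈/_ G z-central₃ x x′ → x ≈Q x′
    ≈/⇒≈Q e = ≈⇒≈/ _ y-central₃ e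

    y-powers : ∀ j j′ → _≈/_ G z-central₃ (y ↑ j) (y ↑ j′) → j % 3 ≡ j′ % 3
    y-powers j j′ = Powers.order3-inj (quotient G z-central₃) (≈⇒≈/ G z-central₃ y³) y∉⟨z⟩ j j′

    N-unique : ∀ j i j′ i′ → y ↑ j ∙ z ↑ i ≈ y ↑ j′ ∙ z ↑ i′ → j % 3 ≡ j′ % 3 × i % 3 ≡ i′ % 3
    N-unique j i j′ i′ e = j≡ , order3-inj z³ z≉ε i i′ (∙-cancelˡ (y ↑ j) _ _ (trans e (∙-congʳ (↑-≡% 3 {j′} {j} y³ (≡.sym j≡)))))
      where
      j≡ : j % 3 ≡ j′ % 3
      j≡ = y-powers j j′ (i′ + 2 * i , (begin
        y ↑ j ≈⟨ identityʳ _ ⟨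
        y ↑ j ∙ ε ≈⟨ ∙-congˡ (trans (↑-*′ z 3 i) (trans (↑-cong i z³) (ε-↑ i))) ⟨
        y ↑ j ∙ z ↑ (i + 2 * i) ≈⟨ trans (∙-congˡ (↑-+ z i _)) (sym (assoc _ _ _)) ⟩
        y ↑ j ∙ z ↑ i ∙ z ↑ (2 * i) ≈⟨ ∙-congʳ e ⟩
        y ↑ j′ ∙ z ↑ i′ ∙ z ↑ (2 * i) ≈⟨ trans (assoc _ _ _) (∙-congˡ (sym (↑-+ z i′ _))) ⟩
        y ↑ j′ ∙ z ↑ (i′ + 2 * i) ∎))

    N-trivial : ∀ j i → y ↑ j ∙ z ↑ i ≈ ε → j % 3 ≡ 0 × i % 3 ≡ 0
    N-trivial j i e = N-unique j i 0 0 (trans e (sym (trans (∙-cong (↑-0 y) (↑-0 z)) (identityˡ ε))))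

    -- [y, t³] = [y, t]³ because [y, t] is central, and [y, t] lies in ⟨z⟩.
    y-commutes-cube : ∀ t k → Commute y (t ↑ (k * 3))
    y-commutes-cube t k with action t
    ... | a , h = trans (twist-↑ z-central h (k * 3)) (∙-congˡ (trans (∙-congˡ (trans (↑-≡ z (≡.sym (ℕ.*-assoc a k 3))) (↑-mult 3 (a * k) z³))) (identityʳ y)))

    private
      module K = KernelColouring G 2 1 1 ≡.refl linearKernelMap linear-valid₁


    N-extension : Canonical Quotient → InjColouring Quotient → InjColouring G
    N-extension canonical colouring = K.kernel-extension {z} {ε} {y} z-central ε-central z³ (ε-↑ 3) y³
        ν-inj
        (λ t → proj₁ (action t) , trans (proj₂ (action t)) (∙-congˡ (∙-congˡ (↑-≡ z (≡.sym (ℕ.*-identityˡ _))))))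
        ν-in (Group.isGroup Quotient) ≈⇒≈Q canonical colouring (↑-1 ε)
        (λ { (j , i , e) → (i , 0 , j) , trans e (trans (assoc _ _ _) (∙-congˡ (sym (ν≈ i 0 j)))) })
      where
      ν≈ : ∀ i l j → (z ↑ i ∙ ε ↑ l) ∙ y ↑ j ≈ y ↑ j ∙ z ↑ i
      ν≈ i l j = trans (∙-congʳ (trans (∙-congˡ (ε-↑ l)) (identityʳ _))) (z-↑ i _)
      ν-inj : ∀ m n → _ → KernelConditions.code 2 1 1 m ≡ KernelConditions.code 2 1 1 n
      ν-inj (i , l , j) (i′ , l′ , j′) e with N-unique j i j′ i′ (trans (sym (ν≈ i l j)) (trans e (ν≈ i′ l′ j′)))
      ... | j≡ , i≡ = ≡.cong₂ (λ a b → a * 3 + b) (≡.cong₂ (λ a b → a * 1 + b) i≡ (≡.trans (n%1≡0 l) (≡.sym (n%1≡0 l′)))) j≡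
      ν-in : ∀ n → K.ν z-central ε-central z³ (ε-↑ 3) y³ n ≈Q ε
      ν-in (i , l , j) = j , i , trans (ν≈ i l j) (∙-congʳ (sym (identityˡ _)))

    Quotient-Chain : ∀ k → Chain k G → ∃ λ k′ → k ≡ 2 + k′ × Chain k′ Quotient
    Quotient-Chain zero          triv = ⊥-elim (z≉ε (triv z))
    Quotient-Chain (suc zero)    ch   = ⊥-elim (y∉⟨z⟩ (Chain-quotient 0 G ch z-central₃ z≉ε y))
    Quotient-Chain (suc (suc k)) ch   = k , ≡.refl ,
      Chain-quotient k _ (Chain-quotient (suc k) G ch z-central₃ z≉ε) y-central₃ y∉⟨z⟩

    Quotient-Canonical : ∀ k → Chain k G → Canonical Quotient
    Quotient-Canonical k ch with Quotient-Chain k ch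
    ... | k′ , _ , ch′ = Chain-canonical k′ _ ch′

  module _ (G : Group c ℓ) (trivial : ∀ x → Group._≈_ G x (Group.ε G)) where
    open Group G

    all-≈ : ∀ {x y} → x ≈ y
    all-≈ {x} {y} = trans (trivial x) (sym (trivial y))

    trivial-colouring : InjColouring G
    trivial-colouring = record { σ = λ x → x ; σ-cong = λ e → e ; σ-inj = λ _ → all-≈
                               ; Δ₁-inj = λ _ → all-≈ ; Δ₂-inj = λ _ → all-≈ ; Δ₃-inj = λ _ → all-≈ }

  module _ (G : Group c ℓ) where
    open Group G
    open Powers G
    open import Relation.Binary.Reasoning.Setoid setoid

    -- Multiplying by the inverse power of g on the left and of y on the right works without
    -- commutation of g and y, so this applies to L_r as well as to C₃ᵗ × C₃.
    unique-from-kernel : ∀ {g y} D .{{_ : NonZero D}} → g ↑ D ≈ ε → y ↑ 3 ≈ ε →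
      (∀ n l → g ↑ n ∙ y ↑ l ≈ ε → Cong D n 0 × Cong 3 l 0) →
      ∀ n l n′ l′ → g ↑ n ∙ y ↑ l ≈ g ↑ n′ ∙ y ↑ l′ → Cong D n n′ × Cong 3 l l′
    unique-from-kernel {g} {y} D@(suc p) gᴰ y³ kernel n l n′ l′ e with kernel (n′ * p + n) (l + 2 * l′) (begin
        g ↑ (n′ * p + n) ∙ y ↑ (l + 2 * l′) ≈⟨ ∙-cong (↑-+ g (n′ * p) n) (↑-+ y l _) ⟩
        (g ↑ (n′ * p) ∙ g ↑ n) ∙ (y ↑ l ∙ y ↑ (2 * l′)) ≈⟨ trans (assoc _ _ _) (∙-congˡ (sym (assoc _ _ _))) ⟩
        g ↑ (n′ * p) ∙ (g ↑ n ∙ y ↑ l ∙ y ↑ (2 * l′)) ≈⟨ ∙-congˡ (∙-congʳ e) ⟩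
        g ↑ (n′ * p) ∙ (g ↑ n′ ∙ y ↑ l′ ∙ y ↑ (2 * l′)) ≈⟨ trans (∙-congˡ (assoc _ _ _)) (sym (assoc _ _ _)) ⟩
        (g ↑ (n′ * p) ∙ g ↑ n′) ∙ (y ↑ l′ ∙ y ↑ (2 * l′)) ≈⟨ ∙-cong (↑-+ g (n′ * p) n′) (↑-+ y l′ _) ⟨
        g ↑ (n′ * p + n′) ∙ y ↑ (l′ + 2 * l′) ≈⟨ ∙-cong (trans (↑-≡ g (eq n′ p)) (↑-mult D n′ gᴰ)) (trans (↑-*′ y 3 l′) (trans (↑-cong l′ y³) (ε-↑ l′))) ⟩
        ε ∙ ε ≈⟨ identityˡ ε ⟩
        ε ∎)
      where eq : ∀ n p → n * p + n ≡ n * suc p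
            eq = solve-∀
    ... | c , c′ = Cong-trans (Cong-sym (Cong-multiple n n′)) (Cong-trans (≡⇒Cong (eq n n′ p)) (Cong-+ c (≡⇒Cong {x = n′} ≡.refl))) ,
                   Cong-trans (Cong-sym (Cong-multiple l l′)) (Cong-trans (≡⇒Cong (eq′ l l′)) (Cong-+ c′ (≡⇒Cong {x = l′} ≡.refl)))
      where eq : ∀ n n′ p → n + n′ * suc p ≡ n′ * p + n + n′
            eq = solve-∀
            eq′ : ∀ l l′ → l + l′ * 3 ≡ l + 2 * l′ + l′
            eq′ = solve-∀

    -- The power g^(3^t) has order 3, which forces 3 to divide n; the induction then passes to g³
    -- and n / 3.
    exact-order : ∀ t {g} → g ↑ (3 ^ suc t) ≈ ε → ¬ g ↑ (3 ^ t) ≈ ε → ∀ n → g ↑ n ≈ ε → ∃ λ q → n ≡ q * 3 ^ suc t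
    exact-order zero {g} g³ g≉ n e = n / 3 , ≡.trans (m≡m%n+[m/n]*n n 3)
      (≡.cong (_+ n / 3 * 3) (order3-∤ g³ (λ h → g≉ (trans (↑-1 g) h)) n e))
    exact-order (suc t) {g} gᵗ g≉ n e =
      let q , q≡ = exact-order t {g ↑ 3} (trans (sym (↑-*′ g 3 _)) gᵗ) (λ h → g≉ (trans (↑-*′ g 3 _) h)) (n / 3)
                     (trans (sym (↑-* g (n / 3) 3)) (trans (↑-≡ g (≡.sym n≡)) e))
      in q , ≡.trans n≡ (≡.trans (≡.cong (_* 3) q≡) (eq q (3 ^ suc t)))
      where
      w = g ↑ (3 ^ suc t)
      n%3≡0 : n % 3 ≡ 0
      n%3≡0 = order3-∤ {w} (trans (sym (↑-* g 3 _)) gᵗ) g≉ n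
        (trans (sym (↑-*′ g (3 ^ suc t) n)) (trans (↑-* g (3 ^ suc t) n) (trans (↑-cong (3 ^ suc t) e) (ε-↑ (3 ^ suc t)))))
      n≡ : n ≡ n / 3 * 3
      n≡ = ≡.trans (m≡m%n+[m/n]*n n 3) (≡.cong (_+ n / 3 * 3) n%3≡0)
      eq : ∀ q x → q * x * 3 ≡ q * (3 * x)
      eq = solve-∀

module _ {c ℓ : Level} where

  module _ (G : Group c ℓ) where
    open Group G
    open Powers G

    C₃×C₃-colouring : ∀ {g y} → IsC₃ᵗ×C₃ G 1 g y → InjColouring G
    C₃×C₃-colouring {g} {y} isC = NormalSubgroup.N-extension G N
        (record { canon = λ _ → ε ; canon-≈ = trivial ; canon-cong = λ _ → ≡.refl })
        (trivial-colouring _ trivial)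
      where
      open IsC₃ᵗ×C₃ isC renaming (commute to gy)
      1≢0 : ¬ Cong 3 1 0
      1≢0 c with Cong⇒% c
      ... | ()
      g-central : Central g
      g-central x with generated x
      ... | n , l , e = commute-resp (sym e) (commute-∙ (commute-↑ n refl) (commute-↑ l gy))
      hg : IsCentral₃ G g
      hg = central₃ g-central g-order
      N : IsNormalC₃² G g y
      N = record
        { z-central₃ = hg
        ; z≉ε = λ e → 1≢0 (proj₁ (unique 1 0 0 0 (∙-congʳ (trans (↑-1 g) (trans e (sym (↑-0 g)))))))
        ; y³ = y-order
        ; y∉⟨z⟩ = λ { (n , e) → 1≢0 (proj₂ (unique 0 1 n 0 (begin
            g ↑ 0 ∙ y ↑ 1 ≈⟨ trans (∙-congʳ (↑-0 g)) (trans (identityˡ _) (↑-1 y)) ⟩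
            y ≈⟨ trans e (identityˡ _) ⟩
            g ↑ n ≈⟨ trans (∙-congˡ (↑-0 y)) (identityʳ _) ⟨
            g ↑ n ∙ y ↑ 0 ∎))) }
        ; action = λ t → 0 , trans (sym (y-comm t)) (∙-congˡ (sym (trans (∙-congˡ (↑-0 g)) (identityʳ y)))) }
        where
        open import Relation.Binary.Reasoning.Setoid setoid
        y-comm : ∀ t → Commute t y
        y-comm t with generated t
        ... | n , l , e = sym (commute-resp (sym e) (commute-∙ (commute-↑ n (sym gy)) (commute-↑ l refl)))
      trivial : ∀ x → Group._≈_ (IsNormalC₃².Quotient N) x ε
      trivial x with generated x
      ... | n , l , e = l , n , trans e (trans (commute-↑↑ n l gy) (∙-congʳ (sym (identityˡ _))))

    colour-C₃ᵗ×C₃ : ∀ t {g y} → IsC₃ᵗ×C₃ G (suc t) g y → InjColouring G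
    colour-C₃ᵗ×C₃ zero    = C₃×C₃-colouring
    colour-C₃ᵗ×C₃ (suc t) = C₃ᵗ×C₃-colouring G t

    -- Generators of a group isomorphic to L_(t+2).
    record IsModular (t : ℕ) (a b : Carrier) : Set (c ⊔ ℓ) where
      field
        a-order   : a ↑ (3 ^ suc t) ≈ ε
        b-order   : b ↑ 3 ≈ ε
        relation  : b ∙ a ≈ a ↑ (1 + 3 ^ t) ∙ b
        generated : ∀ x → ∃₂ λ n l → x ≈ a ↑ n ∙ b ↑ l
        kernel    : ∀ n l → a ↑ n ∙ b ↑ l ≈ ε → Cong (3 ^ suc t) n 0 × Cong 3 l 0

    Modular : Set (c ⊔ ℓ)
    Modular = ∃ λ t → ∃₂ λ a b → IsModular (2 + t) a b

  module Rebase (G : Group c ℓ) {z y : Group.Carrier G} (N : IsNormalC₃² G z y) where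
    open Group G
    open Powers G
    open Commutators G
    open NormalSubgroup G N
    open import Relation.Binary.Reasoning.Setoid setoid

    -- A change of basis of N that makes a given central element ζ the first generator. If ζ lies in
    -- ⟨z⟩, y stays. Otherwise ζ and z generate N, and z becomes the second generator. The two maps
    -- say that N, and with it the quotient, has not changed.
    rebase : ∀ {ζ} j i → Central ζ → ¬ ζ ≈ ε → ζ ≈ y ↑ j ∙ z ↑ i →
             ∃ λ y′ → Σ (IsNormalC₃² G ζ y′) λ N′ →
               (∀ {x x′} → x ≈Q x′ → Group._≈_ (IsNormalC₃².Quotient N′) x x′) ×
               (∀ {x x′} → Group._≈_ (IsNormalC₃².Quotient N′) x x′ → x ≈Q x′)
    rebase {ζ} j i ζ-central ζ≉ε ζ≈ with j % 3 ℕ.≟ 0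
    ... | yes j≡0 = y , N′ , to , from
      where
      ζ≈zⁱ : ζ ≈ z ↑ i
      ζ≈zⁱ = trans ζ≈ (trans (∙-congʳ (trans (↑-% 3 j y³) (trans (↑-≡ y j≡0) (↑-0 y)))) (identityˡ _))
      z≈ζⁱ : z ≈ ζ ↑ i
      z≈ζⁱ = trans (order3-root z³ i (λ h → ζ≉ε (trans ζ≈zⁱ h))) (↑-cong i (sym ζ≈zⁱ))
      z-to-ζ : ∀ n → z ↑ n ≈ ζ ↑ (i * n)
      z-to-ζ n = trans (↑-cong n z≈ζⁱ) (sym (↑-*′ ζ i n))
      ζ-to-z : ∀ n → ζ ↑ n ≈ z ↑ (i * n)
      ζ-to-z n = trans (↑-cong n ζ≈zⁱ) (sym (↑-*′ z i n))
      N′ : IsNormalC₃² G ζ y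
      N′ = record
        { z-central₃ = central₃ ζ-central (trans (↑-cong 3 ζ≈zⁱ) (trans (sym (↑-*′ z i 3)) (↑-mult 3 i z³)))
        ; z≉ε = ζ≉ε ; y³ = y³
        ; y∉⟨z⟩ = λ { (n , e) → y∉⟨z⟩ (i * n , trans e (∙-congˡ (ζ-to-z n))) }
        ; action = λ t → i * proj₁ (action t) , trans (proj₂ (action t)) (∙-congˡ (∙-congˡ (z-to-ζ _))) }
      to : ∀ {x x′} → x ≈Q x′ → Group._≈_ (IsNormalC₃².Quotient N′) x x′
      to (p , q , e) = p , i * q , trans e (∙-congˡ (z-to-ζ q))
      from : ∀ {x x′} → Group._≈_ (IsNormalC₃².Quotient N′) x x′ → x ≈Q x′
      from (p , q , e) = p , i * q , trans e (∙-congˡ (ζ-to-z q))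
    ... | no j≢0 = z , N′ , to , from
      where
      yʲ≉ε : ¬ y ↑ j ≈ ε
      yʲ≉ε h = j≢0 (proj₁ (N-trivial j 0 (trans (∙-cong h (↑-0 z)) (identityˡ ε))))
      ζ-↑ : ∀ n → ζ ↑ n ≈ y ↑ (j * n) ∙ z ↑ (i * n)
      ζ-↑ n = trans (↑-cong n ζ≈) (trans (∙-↑ n (sym (z-↑ i _))) (∙-cong (sym (↑-*′ y j n)) (sym (↑-*′ z i n))))
      ζ³ : ζ ↑ 3 ≈ ε
      ζ³ = trans (ζ-↑ 3) (trans (∙-cong (↑-mult 3 j y³) (↑-mult 3 i z³)) (identityˡ ε))
      z∉⟨ζ⟩ : ∀ n → ¬ z ≈ ε ∙ ζ ↑ n
      z∉⟨ζ⟩ n e = z≉ε (trans e (trans (identityˡ _) (trans (↑-% 3 n ζ³) (trans (↑-≡ ζ n≡0) (↑-0 ζ)))))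
        where
        jn≡0 : (j * n) % 3 ≡ 0
        jn≡0 = proj₁ (N-unique (j * n) (i * n) 0 1 (trans (sym (ζ-↑ n)) (trans (sym (identityˡ _)) (trans (sym e)
          (trans (sym (↑-1 z)) (trans (sym (identityˡ _)) (∙-congʳ (sym (↑-0 y)))))))))
        n≡0 : n % 3 ≡ 0
        n≡0 = order3-∤ (trans (sym (↑-*′ y j 3)) (↑-mult 3 j y³)) yʲ≉ε n
          (trans (sym (↑-*′ y j n)) (trans (↑-% 3 (j * n) y³) (trans (↑-≡ y jn≡0) (↑-0 y))))
      y≈ : ∀ p → y ↑ p ≈ z ↑ (2 * i * (j * p)) ∙ ζ ↑ (j * p)
      y≈ p = begin
        y ↑ p ≈⟨ ↑-cong p (order3-root y³ j yʲ≉ε) ⟩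
        ((y ↑ j) ↑ j) ↑ p ≈⟨ ↑-*′ (y ↑ j) j p ⟨
        (y ↑ j) ↑ (j * p) ≈⟨ ↑-cong (j * p) yʲ≈ ⟩
        (z ↑ (2 * i) ∙ ζ) ↑ (j * p) ≈⟨ ∙-↑ (j * p) (z-↑ (2 * i) ζ) ⟩
        (z ↑ (2 * i)) ↑ (j * p) ∙ ζ ↑ (j * p) ≈⟨ ∙-congʳ (↑-*′ z (2 * i) (j * p)) ⟨
        z ↑ (2 * i * (j * p)) ∙ ζ ↑ (j * p) ∎
        where
        yʲ≈ : y ↑ j ≈ z ↑ (2 * i) ∙ ζ
        yʲ≈ = begin
          y ↑ j ≈⟨ identityʳ _ ⟨
          y ↑ j ∙ ε ≈⟨ ∙-congˡ (trans (↑-*′ z 3 i) (trans (↑-cong i z³) (ε-↑ i))) ⟨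
          y ↑ j ∙ z ↑ (i + 2 * i) ≈⟨ trans (∙-congˡ (↑-+ z i _)) (sym (assoc _ _ _)) ⟩
          y ↑ j ∙ z ↑ i ∙ z ↑ (2 * i) ≈⟨ ∙-congʳ ζ≈ ⟨
          ζ ∙ z ↑ (2 * i) ≈⟨ ζ-central _ ⟩
          z ↑ (2 * i) ∙ ζ ∎
      N′ : IsNormalC₃² G ζ z
      N′ = record
        { z-central₃ = central₃ ζ-central ζ³ ; z≉ε = ζ≉ε ; y³ = z³
        ; y∉⟨z⟩ = λ { (n , e) → z∉⟨ζ⟩ n e }
        ; action = λ t → 0 , trans (z-central t) (∙-congˡ (sym (trans (∙-congˡ (↑-0 ζ)) (identityʳ z)))) }
      to : ∀ {x x′} → x ≈Q x′ → Group._≈_ (IsNormalC₃².Quotient N′) x x′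
      to {x} {x′} (p , q , e) = 2 * i * (j * p) + q , j * p , (begin
        x ≈⟨ e ⟩
        x′ ∙ y ↑ p ∙ z ↑ q ≈⟨ ∙-congʳ (trans (∙-congˡ (y≈ p)) (sym (assoc _ _ _))) ⟩
        x′ ∙ z ↑ (2 * i * (j * p)) ∙ ζ ↑ (j * p) ∙ z ↑ q ≈⟨ swapʳ _ (sym (z-↑ q _)) ⟩
        x′ ∙ z ↑ (2 * i * (j * p)) ∙ z ↑ q ∙ ζ ↑ (j * p) ≈⟨ ∙-congʳ (trans (assoc _ _ _) (∙-congˡ (sym (↑-+ z _ q)))) ⟩
        x′ ∙ z ↑ (2 * i * (j * p) + q) ∙ ζ ↑ (j * p) ∎)
      from : ∀ {x x′} → Group._≈_ (IsNormalC₃².Quotient N′) x x′ → x ≈Q x′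
      from {x} {x′} (p , q , e) = j * q , i * q + p , (begin
        x ≈⟨ e ⟩
        x′ ∙ z ↑ p ∙ ζ ↑ q ≈⟨ swapʳ x′ (z-↑ p _) ⟩
        x′ ∙ ζ ↑ q ∙ z ↑ p ≈⟨ ∙-congʳ (trans (∙-congˡ (ζ-↑ q)) (sym (assoc _ _ _))) ⟩
        x′ ∙ y ↑ (j * q) ∙ z ↑ (i * q) ∙ z ↑ p ≈⟨ trans (assoc _ _ _) (∙-congˡ (sym (↑-+ z (i * q) p))) ⟩
        x′ ∙ y ↑ (j * q) ∙ z ↑ (i * q + p) ∎)

-- The case of a cyclic quotient

module _ {c ℓ : Level} where

  module _ (G : Group c ℓ) where
    open Group G
    open Powers G
    open import Relation.Binary.Reasoning.Setoid setoid

    exact-order-unique : ∀ t {g} → g ↑ (3 ^ suc t) ≈ ε → ¬ g ↑ (3 ^ t) ≈ ε → ∀ n n′ → g ↑ n ≈ g ↑ n′ → Cong (3 ^ suc t) n n′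
    exact-order-unique t {g} gᵗ g≉ n n′ e with 3 ^ suc t | ℕ.m^n≢0 3 (suc t) | gᵗ | exact-order G t gᵗ g≉
    ... | suc p | _ | gᴰ | exact with exact (n′ * p + n) (begin
        g ↑ (n′ * p + n) ≈⟨ ↑-+ g (n′ * p) n ⟩
        g ↑ (n′ * p) ∙ g ↑ n ≈⟨ ∙-congˡ e ⟩
        g ↑ (n′ * p) ∙ g ↑ n′ ≈⟨ ↑-+ g (n′ * p) n′ ⟨
        g ↑ (n′ * p + n′) ≈⟨ trans (↑-≡ g (eq n′ p)) (↑-mult (suc p) n′ gᴰ) ⟩
        ε ∎)
      where eq : ∀ n p → n * p + n ≡ n * suc p
            eq = solve-∀
    ... | q , q≡ = n′ , q , ≡.trans (eq n n′ p) (≡.trans (≡.cong (n′ +_) q≡) ≡.refl)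
      where eq : ∀ n n′ p → n + n′ * suc p ≡ n′ + (n′ * p + n)
            eq = solve-∀

  module CyclicQuotient (G : Group c ℓ) {z y : Group.Carrier G} (N : IsNormalC₃² G z y) {g : Group.Carrier G}
      (gen : ∀ x → ∃ λ n → Group._≈_ (IsNormalC₃².Quotient N) x (Powers._↑_ G g n)) where
    open Group G
    open Powers G
    open Commutators G
    open NormalSubgroup G N
    open import Relation.Binary.Reasoning.Setoid setoid

    private
      a : ℕ
      a = proj₁ (action g)

      y-g : y ∙ g ≈ g ∙ (y ∙ z ↑ a)
      y-g = proj₂ (action g)

    y≉ε : ¬ y ≈ ε
    y≉ε e = y∉⟨z⟩ (≈⇒≈/ G z-central₃ e)

    y-cancel : ∀ u l → u ∙ y ↑ l ∙ y ↑ (2 * l) ≈ u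
    y-cancel u l = trans (assoc _ _ _) (trans (∙-congˡ (trans (sym (↑-+ y l _)) (trans (↑-*′ y 3 l) (trans (↑-cong l y³) (ε-↑ l))))) (identityʳ u))

    -- G is generated by g, y and z, and y commutes with cubes.
    cube-central : ∀ k → Central (g ↑ (k * 3))
    cube-central k x with gen x
    ... | n , j , i , e = commute-resp (sym e) (commute-∙ (commute-∙ (commute-↑↑ (k * 3) n refl)
            (commute-↑ j (sym (y-commutes-cube g k)))) (sym (z-↑ i _)))

    order27-case : ∀ {e} → e < 3 → g ↑ 3 ≈ z ↑ e → ¬ g ≈Q ε → InjColouring G
    order27-case {e} e<3 g³ g∉ = order27-colouring G z-central z³ y³ e<3 (m%n<n a 3) g³
        (trans y-g (∙-congˡ (∙-congˡ (↑-% 3 a z³)))) generated unique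
      where
      nf : ∀ q i j → g ↑ q ∙ (z ↑ i ∙ y ↑ j) ≈ g ↑ q ∙ y ↑ j ∙ z ↑ i
      nf q i j = trans (∙-congˡ (z-↑ i _)) (sym (assoc _ _ _))
      generated : ∀ x → ∃ λ n → x ≈ normalForm G {g} {z} {y} z-central z³ y³ n
      generated x with gen x
      ... | n , j , i , h = (n , i , j) , trans h (sym (nf n i j))
      unique : ∀ m n → proj₁ m < 3 → proj₁ n < 3 → _ → Digits.code 3 3 3 m ≡ Digits.code 3 3 3 n
      unique (q , i , j) (q′ , i′ , j′) q<3 q′<3 h = ≡.cong₂ (λ a b → a * 3 + b) (≡.cong₂ (λ a b → a * 3 + b) q≡ (proj₂ ji≡)) (proj₁ ji≡)
        where
        h′ : g ↑ q ∙ y ↑ j ∙ z ↑ i ≈ g ↑ q′ ∙ y ↑ j′ ∙ z ↑ i′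
        h′ = trans (sym (nf q i j)) (trans h (nf q′ i′ j′))
        g³≈Qε : g ↑ 3 ≈Q ε
        g³≈Qε = 0 , e , trans g³ (trans (sym (identityˡ _)) (∙-congʳ (trans (sym (identityˡ ε)) (∙-congˡ (sym (↑-0 y))))))
        q≡ : q % 3 ≡ q′ % 3
        q≡ = Powers.order3-inj Quotient g³≈Qε g∉ q q′ (Q.trans {g ↑ q} {g ↑ q ∙ y ↑ j ∙ z ↑ i} {g ↑ q′}
               (Q.sym {g ↑ q ∙ y ↑ j ∙ z ↑ i} {g ↑ q} (j , i , refl)) (j′ , i′ , h′))
        ji≡ = N-unique j i j′ i′ (∙-cancelˡ (g ↑ q) _ _ (trans (sym (assoc _ _ _)) (trans h′ (trans (assoc _ _ _)
                (∙-congʳ (↑-≡ g (≡.trans (≡.sym (m<n⇒m%n≡m q′<3)) (≡.trans (≡.sym q≡) (m<n⇒m%n≡m q<3)))))))))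

    module _ (T₁ : ℕ) (minimal : ¬ g ↑ (3 ^ T₁) ≈Q ε) where

      private
        S = suc T₁

      -- Now G = ⟨g⟩⟨y⟩. If y commutes with g, this is C₃ᵗ × C₃. Otherwise it is some L_r, and for S
      -- = 1 it is L₃, of order 27.
      z-power-case : g ↑ (3 ^ S) ≈ z → InjColouring G ⊎ Modular G
      z-power-case gᵀ = cases (a % 3 ℕ.≟ 0) T₁ ≡.refl
        where
        g-order : g ↑ (3 ^ suc S) ≈ ε
        g-order = trans (↑-* g 3 (3 ^ S)) (trans (↑-cong 3 gᵀ) z³)
        gᵀ≈Qε : g ↑ (3 ^ S) ≈Q ε
        gᵀ≈Qε = ≈/⇒≈Q (1 , trans gᵀ (sym (trans (identityˡ _) (↑-1 z))))
        z≈ : ∀ i → z ↑ i ≈ g ↑ (3 ^ S * i)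
        z≈ i = trans (↑-cong i (sym gᵀ)) (sym (↑-*′ g (3 ^ S) i))
        generated : ∀ x → ∃₂ λ n l → x ≈ g ↑ n ∙ y ↑ l
        generated x with gen x
        ... | n , j , i , e = n + 3 ^ S * i , j , (begin
          x ≈⟨ e ⟩
          g ↑ n ∙ y ↑ j ∙ z ↑ i ≈⟨ swapʳ _ (sym (z-↑ i _)) ⟩
          g ↑ n ∙ z ↑ i ∙ y ↑ j ≈⟨ ∙-congʳ (trans (∙-congˡ (z≈ i)) (sym (↑-+ g n _))) ⟩
          g ↑ (n + 3 ^ S * i) ∙ y ↑ j ∎)
        kernel : ∀ n l → g ↑ n ∙ y ↑ l ≈ ε → Cong (3 ^ suc S) n 0 × Cong 3 l 0
        kernel n l e with exact-order Quotient T₁ gᵀ≈Qε minimal n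
                            (2 * l , 0 , trans (sym (y-cancel (g ↑ n) l)) (trans (∙-congʳ e) (trans (sym (identityʳ _)) (∙-congˡ (sym (↑-0 z))))))
        ... | q , n≡ with N-trivial l q (trans (∙-congˡ (trans (z≈ q) (↑-≡ g (≡.trans (ℕ.*-comm (3 ^ S) q) (≡.sym n≡))))) (trans (sym g-y) e))
          where
          g-y : g ↑ n ∙ y ↑ l ≈ y ↑ l ∙ g ↑ n
          g-y = trans (∙-congʳ gⁿ) (trans (z-↑ q _) (∙-congˡ (sym gⁿ)))
            where gⁿ : g ↑ n ≈ z ↑ q
                  gⁿ = trans (↑-≡ g (≡.trans n≡ (ℕ.*-comm q (3 ^ S)))) (sym (z≈ q))
        ... | l≡0 , q≡0 = Cong-resp (≡.sym (≡.trans n≡ (≡.cong (_* 3 ^ S) (≡.trans (m≡m%n+[m/n]*n q 3) (≡.cong (_+ q / 3 * 3) q≡0))))) ≡.refl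
              (Cong-resp (eq (q / 3) (3 ^ S)) ≡.refl (Cong-multiple 0 (q / 3))) , %⇒Cong l≡0
          where eq : ∀ q d → 0 + q * (3 * d) ≡ (0 + q * 3) * d
                eq = solve-∀
        cases : Dec (a % 3 ≡ 0) → ∀ t → T₁ ≡ t → InjColouring G ⊎ Modular G
        cases (yes a≡0) _ _ = inj₁ (colour-C₃ᵗ×C₃ G S record
          { commute = sym (trans y-g (∙-congˡ (trans (∙-congˡ (trans (↑-% 3 a z³) (trans (↑-≡ z a≡0) (↑-0 z)))) (identityʳ y))))
          ; g-order = g-order ; y-order = y³ ; generated = generated
          ; unique = unique-from-kernel G (3 ^ suc S) {{ℕ.m^n≢0 3 (suc S)}} g-order y³ kernel })
        cases (no _) zero ≡.refl = inj₁ (order27-case {1} (s≤s (s≤s z≤n)) (trans gᵀ (sym (↑-1 z))) (λ h → minimal (Q.trans {g ↑ 1} {g} {ε} (≈⇒≈Q (↑-1 g)) h)))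
        -- The choice b = y^a turns the commutator of b and g into z^(a·a) = z = g^(3^S), as the
        -- exponent 1 + 3^S of the relation demands.
        cases (no a≢0) (suc T₂) ≡.refl = inj₂ (T₂ , g , y ↑ a , record
          { a-order = g-order
          ; b-order = trans (sym (↑-*′ y a 3)) (↑-mult 3 a y³)
          ; relation = begin
              y ↑ a ∙ g ≈⟨ conjugate-↑ y-g a ⟩
              g ∙ (y ∙ z ↑ a) ↑ a ≈⟨ ∙-congˡ (trans (∙-↑ a (sym (z-↑ a y))) (∙-congˡ (sym (order3-root z³ a zᵃ≉ε)))) ⟩
              g ∙ (y ↑ a ∙ z) ≈⟨ trans (∙-congˡ (sym (z-central _))) (sym (assoc _ _ _)) ⟩
              g ∙ z ∙ y ↑ a ≈⟨ ∙-congʳ (trans (∙-congˡ (sym gᵀ)) (sym (↑-suc g (3 ^ S)))) ⟩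
              g ↑ (1 + 3 ^ S) ∙ y ↑ a ∎
          ; generated = λ x → let n , l , e = generated x in n , a * l , trans e (∙-congˡ (trans (↑-cong l (order3-root y³ a yᵃ≉ε)) (sym (↑-*′ (y ↑ a) a l))))
          ; kernel = λ n l e → let cn , cl = kernel n (a * l) (trans (∙-congˡ (↑-*′ y a l)) e) in
              cn , %⇒Cong (order3-∤ (trans (sym (↑-*′ y a 3)) (↑-mult 3 a y³)) yᵃ≉ε l (trans (sym (↑-*′ y a l)) (trans (↑-% 3 (a * l) y³) (trans (↑-≡ y (Cong⇒% cl)) (↑-0 y))))) })
          where
          zᵃ≉ε : ¬ z ↑ a ≈ ε
          zᵃ≉ε h = a≢0 (order3-∤ z³ z≉ε a h)
          yᵃ≉ε : ¬ y ↑ a ≈ ε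
          yᵃ≉ε h = a≢0 (order3-∤ y³ y≉ε a h)

      -- w = g^(3^T₁) has order 3 and lies outside N; for T₁ > 0 it is a power of g³ and hence
      -- central. With w in place of y the quotient is no longer cyclic: it is generated by g and y,
      -- whose commutator lies in ⟨z⟩.
      split-case : ∀ k → Chain k G → g ↑ (3 ^ S) ≈ ε → InjColouring G
      split-case k ch gᵀ = cases T₁ ≡.refl
        where
        cases : ∀ t → T₁ ≡ t → InjColouring G
        cases zero ≡.refl = order27-case {0} (s≤s z≤n) (trans gᵀ (sym (↑-0 z))) (λ h → minimal (Q.trans {g ↑ 1} {g} {ε} (≈⇒≈Q (↑-1 g)) h))
        cases (suc T₂) ≡.refl = N₂.N-extension (N₂.Quotient-Canonical k ch) (colour-C₃ᵗ×C₃ _ T₂ isC)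
          where
          w = g ↑ (3 ^ T₁)
          w-central : Central w
          w-central x = trans (∙-congʳ w≡) (trans (cube-central (3 ^ T₂) x) (∙-congˡ (sym w≡)))
            where w≡ = ↑-≡ g (ℕ.*-comm 3 (3 ^ T₂))
          w³ : w ↑ 3 ≈ ε
          w³ = trans (sym (↑-* g 3 (3 ^ T₁))) gᵀ
          N₂′ : IsNormalC₃² G z w
          N₂′ = record
            { z-central₃ = z-central₃ ; z≉ε = z≉ε ; y³ = w³ ; y∉⟨z⟩ = λ h → minimal (≈/⇒≈Q h)
            ; action = λ t → 0 , trans (w-central t) (∙-congˡ (sym (trans (∙-congˡ (↑-0 z)) (identityʳ w)))) }
          module N₂ = NormalSubgroup G N₂′
          kernel : ∀ n l → Group._≈_ N₂.Quotient (g ↑ n ∙ y ↑ l) ε → Cong (3 ^ suc T₂) n 0 × Cong 3 l 0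
          kernel n l (j , i , e) = Cong-trans (Cong-factor (3 ^ T₁) 3 (Cong-resp ≡.refl ≡.refl (≡.subst (λ d → Cong d n (3 ^ T₁ * j)) (ℕ.*-comm 3 (3 ^ T₁)) n≡)))
                (Cong-resp (ℕ.*-comm j (3 ^ T₁)) ≡.refl (Cong-multiple 0 j)) ,
              %⇒Cong (y-powers l 0 (i , trans yˡ (trans (sym (identityˡ _)) (∙-congʳ (sym (↑-0 y))))))
            where
            n≡ : Cong (3 ^ S) n (3 ^ T₁ * j)
            n≡ = exact-order-unique Quotient T₁ (≈⇒≈Q gᵀ) minimal n (3 ^ T₁ * j) (2 * l , i , (begin
              g ↑ n ≈⟨ y-cancel (g ↑ n) l ⟨
              g ↑ n ∙ y ↑ l ∙ y ↑ (2 * l) ≈⟨ ∙-congʳ (trans e (∙-congʳ (identityˡ _))) ⟩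
              w ↑ j ∙ z ↑ i ∙ y ↑ (2 * l) ≈⟨ swapʳ _ (z-↑ i _) ⟩
              w ↑ j ∙ y ↑ (2 * l) ∙ z ↑ i ≈⟨ ∙-congʳ (∙-congʳ (↑-*′ g (3 ^ T₁) j)) ⟨
              g ↑ (3 ^ T₁ * j) ∙ y ↑ (2 * l) ∙ z ↑ i ∎))
            yˡ : y ↑ l ≈ z ↑ i
            yˡ = ∙-cancelˡ (g ↑ n) _ _ (trans e (∙-congʳ (trans (identityˡ _) (trans (sym (↑-*′ g (3 ^ T₁) j)) (sym (↑-≡% (3 ^ S) {{ℕ.m^n≢0 3 S}} gᵀ (Cong⇒% {{ℕ.m^n≢0 3 S}} n≡)))))))
          isC : IsC₃ᵗ×C₃ N₂.Quotient (suc T₂) g y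
          isC = record
            { commute = Group.sym N₂.Quotient {y ∙ g} {g ∙ y} (N₂.≈/⇒≈Q (a , trans y-g (sym (assoc _ _ _))))
            ; g-order = 1 , 0 , trans (sym (↑-1 w)) (trans (sym (identityˡ _)) (trans (sym (identityʳ _)) (∙-congˡ (sym (↑-0 z)))))
            ; y-order = N₂.≈⇒≈Q y³
            ; generated = λ x → let n , j , i , e = gen x in n , j , N₂.≈/⇒≈Q (i , e)
            ; unique = unique-from-kernel N₂.Quotient (3 ^ suc T₂) {{ℕ.m^n≢0 3 (suc T₂)}}
                (1 , 0 , trans (sym (↑-1 w)) (trans (sym (identityˡ _)) (trans (sym (identityʳ _)) (∙-congˡ (sym (↑-0 z))))))
                (N₂.≈⇒≈Q y³) kernel }

  cyclic-quotient-case : ∀ k (G : Group c ℓ) → Chain k G → ∀ {z y} (N : IsNormalC₃² G z y) → Cyclic (IsNormalC₃².Quotient N) →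
                         InjColouring G ⊎ Modular G
  cyclic-quotient-case k G ch {z} {y} N (g , gen) with NormalSubgroup.Quotient-Chain G N k ch
  ... | k′ , _ , ch′ = cases (least (λ t → Chain-dec k′ _ ch′ (g ↑ (3 ^ t)) ε) k′ (Chain-exponent k′ _ ch′ g))
    where
    open Group G
    open Powers G
    open NormalSubgroup G N
    cases : _ → InjColouring G ⊎ Modular G
    cases (inj₁ g≈Qε) = inj₁ (N-extension (Quotient-Canonical k ch) (trivial-colouring Quotient λ x →
      let n , e = gen x in Q.trans {x} {g ↑ n} {ε} e (Q.trans {g ↑ n} {(g ↑ 1) ↑ n} {ε} (≈⇒≈Q (↑-cong n (sym (↑-1 g))))
        (Q.trans {(g ↑ 1) ↑ n} {ε ↑ n} {ε} (Powers.↑-cong Quotient n g≈Qε) (≈⇒≈Q (ε-↑ n))))))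
    cases (inj₂ (T₁ , minimal , gᵀ)) with Chain-dec k G ch (g ↑ (3 ^ suc T₁)) ε
    ... | yes gᵀ≈ε = inj₁ (CyclicQuotient.split-case G N gen T₁ minimal k ch gᵀ≈ε)
    -- This power of g lies in N and, as a power of g³, is central. It is made the first generator
    -- of N.
    ... | no gᵀ≉ε with Rebase.rebase G N (proj₁ gᵀ) (proj₁ (proj₂ gᵀ))
                         (λ x → trans (∙-congʳ ζ≡) (trans (CyclicQuotient.cube-central G N gen (3 ^ T₁) x) (∙-congˡ (sym ζ≡))))
                         gᵀ≉ε (trans (proj₂ (proj₂ gᵀ)) (∙-congʳ (identityˡ _)))
      where ζ≡ = ↑-≡ g (ℕ.*-comm 3 (3 ^ T₁))
    ...   | y′ , N′ , to , from = CyclicQuotient.z-power-case G N′ (λ x → proj₁ (gen x) , to (proj₂ (gen x))) T₁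
                                    (λ h → minimal (from h)) refl

-- The case of a quotient isomorphic to L_r

module _ {c ℓ : Level} where

  module ModularQuotient (G : Group c ℓ) (k : ℕ) (ch : Chain k G) {z y : Group.Carrier G} (N : IsNormalC₃² G z y)
      (s t : ℕ) (s≡ : s ≡ 2 + t) {a b : Group.Carrier G} (modular : IsModular (IsNormalC₃².Quotient N) s a b) where
    open Group G
    open Powers G
    open Commutators G
    open NormalSubgroup G N
    open IsModular modular
    open import Relation.Binary.Reasoning.Setoid setoid

    private
      module Q̄ = Powers Quotient

      d u : Carrier
      d = a ↑ (3 ^ s)
      u = (a ↑ 3) ↑ 3

      b-a³ : (b ∙ a ↑ 3) ≈Q (a ↑ 3 ∙ b)
      b-a³ = Q.trans {b ∙ a ↑ 3} {(a ↑ (1 + 3 ^ s)) ↑ 3 ∙ b} {a ↑ 3 ∙ b}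
        (Q.sym {(a ↑ (1 + 3 ^ s)) ↑ 3 ∙ b} {b ∙ a ↑ 3} (Commutators.conjugate-↑ Quotient (Q.sym {b ∙ a} {a ↑ (1 + 3 ^ s) ∙ b} relation) 3))
        (Q.∙-congʳ {b} {(a ↑ (1 + 3 ^ s)) ↑ 3} {a ↑ 3} (Q.trans {(a ↑ (1 + 3 ^ s)) ↑ 3} {a ↑ 3 ∙ a ↑ (3 ^ suc s)} {a ↑ 3}
          (≈⇒≈Q (trans (sym (↑-*′ a (1 + 3 ^ s) 3)) (trans (↑-≡ a (eq (3 ^ s))) (↑-+ a 3 _))))
          (Q.trans {a ↑ 3 ∙ a ↑ (3 ^ suc s)} {a ↑ 3 ∙ ε} {a ↑ 3} (Q.∙-congˡ {a ↑ 3} {a ↑ (3 ^ suc s)} {ε} a-order) (≈⇒≈Q (identityʳ _)))))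
        where eq : ∀ x → (1 + x) * 3 ≡ 3 + 3 * x
              eq = solve-∀

      -- b a³ b⁻¹ = a³n with n ∈ N; as n commutes with a³ and n³ = 1, b commutes with a⁹.
      conj-a³ : (b ∙ a ↑ 3 ∙ b ⁻¹) ≈Q (a ↑ 3)
      conj-a³ = Q.trans {b ∙ a ↑ 3 ∙ b ⁻¹} {a ↑ 3 ∙ b ∙ b ⁻¹} {a ↑ 3} (Q.∙-congʳ {b ⁻¹} {b ∙ a ↑ 3} {a ↑ 3 ∙ b} b-a³)
        (≈⇒≈Q (trans (assoc _ _ _) (trans (∙-congˡ (inverseʳ b)) (identityʳ _))))

      b-u : Commute u b
      b-u with conj-a³
      ... | j , i , e = trans (∙-congʳ u≈) (conjugate-↑ s-b 3)
        where
        r = a ↑ 3 ∙ y ↑ j ∙ z ↑ i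
        s-b : r ∙ b ≈ b ∙ a ↑ 3
        s-b = trans (∙-congʳ (sym e)) (trans (assoc _ _ _) (trans (∙-congˡ (inverseˡ b)) (identityʳ _)))
        u≈ : u ≈ r ↑ 3
        u≈ = sym (begin
          (a ↑ 3 ∙ y ↑ j ∙ z ↑ i) ↑ 3 ≈⟨ ∙-↑ 3 (sym (z-↑ i _)) ⟩
          (a ↑ 3 ∙ y ↑ j) ↑ 3 ∙ (z ↑ i) ↑ 3 ≈⟨ ∙-cong (∙-↑ 3 (commute-↑ j (sym (y-commutes-cube a 1)))) (trans (sym (↑-*′ z i 3)) (↑-mult 3 i z³)) ⟩
          (a ↑ 3) ↑ 3 ∙ (y ↑ j) ↑ 3 ∙ ε ≈⟨ trans (identityʳ _) (∙-congˡ (trans (sym (↑-*′ y j 3)) (↑-mult 3 j y³))) ⟩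
          (a ↑ 3) ↑ 3 ∙ ε ≈⟨ identityʳ _ ⟩
          u ∎)

      a-u : Commute u a
      a-u = sym (commute-↑ 3 (commute-↑ 3 refl))

      y-u : Commute u y
      y-u = sym (commute-↑ 3 (y-commutes-cube a 1))

      u-central : Central u
      u-central x with generated x
      ... | n , l , j , i , e = commute-resp (sym e) (commute-∙ (commute-∙ (commute-∙ (commute-↑ n a-u) (commute-↑ l b-u))
                                  (commute-↑ j y-u)) (sym (z-↑ i u)))

      -- Here r ≥ 4 enters: s = r - 2 is at least 2, so d is a power of the central element a⁹.
      d≈ : d ≈ u ↑ (3 ^ t)
      d≈ = trans (↑-≡ a (≡.cong (3 ^_) s≡)) (trans (↑-*′ a 3 (3 * 3 ^ t)) (↑-*′ (a ↑ 3) 3 (3 ^ t)))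

      d-central : Central d
      d-central x = trans (∙-congʳ d≈) (trans (central-↑ u-central (3 ^ t) x) (∙-congˡ (sym d≈)))

      d³≈Qε : (d ↑ 3) ≈Q ε
      d³≈Qε = Q.trans {d ↑ 3} {a ↑ (3 ^ suc s)} {ε} (≈⇒≈Q (sym (↑-* a 3 (3 ^ s)))) a-order

      unique : ∀ n l n′ l′ → (a ↑ n ∙ b ↑ l) ≈Q (a ↑ n′ ∙ b ↑ l′) → Cong (3 ^ suc s) n n′ × Cong 3 l l′
      unique = unique-from-kernel Quotient (3 ^ suc s) {{ℕ.m^n≢0 3 (suc s)}} a-order b-order kernel

      d≉Qε : ¬ d ≈Q ε
      d≉Qε h = Data.Nat.≢-nonZero⁻¹ (3 ^ s) {{ℕ.m^n≢0 3 s}} (Cong-< {{ℕ.m^n≢0 3 (suc s)}} (ℕ.^-monoʳ-< 3 (s≤s (s≤s z≤n)) {s} {suc s} ℕ.≤-refl) (ℕ.m^n>0 3 (suc s)) (proj₁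
        (unique (3 ^ s) 0 0 0 (Q.∙-congʳ {b ↑ 0} {d} {a ↑ 0} (Q.trans {d} {ε} {a ↑ 0} h (≈⇒≈Q (sym (↑-0 a))))))))

      hd : IsCentral₃ Quotient d
      hd = central₃ (λ x → ≈⇒≈Q (d-central x)) d³≈Qε

      R : Group c ℓ
      R = quotient Quotient hd

      ≈⇒≈R : ∀ {x x′} → x ≈ x′ → Group._≈_ R x x′
      ≈⇒≈R e = ≈⇒≈/ Quotient hd (≈⇒≈Q e)

      d≈Rε : Group._≈_ R d ε
      d≈Rε = 1 , ≈⇒≈Q (trans (sym (↑-1 d)) (sym (identityˡ _)))

      R-kernel : ∀ n l → Group._≈_ R (a ↑ n ∙ b ↑ l) ε → Cong (3 ^ s) n 0 × Cong 3 l 0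
      R-kernel n l (i , e) with unique n l (3 ^ s * i) 0 (Q.trans {a ↑ n ∙ b ↑ l} {ε ∙ d ↑ i} {a ↑ (3 ^ s * i) ∙ b ↑ 0} e
          (≈⇒≈Q (trans (identityˡ _) (trans (sym (↑-*′ a (3 ^ s) i)) (trans (sym (identityʳ _)) (∙-congˡ (sym (↑-0 b))))))))
      ... | cn , cl = Cong-trans (Cong-factor (3 ^ s) 3 (≡.subst (λ m → Cong m n (3 ^ s * i)) (ℕ.*-comm 3 (3 ^ s)) cn))
                        (Cong-resp (ℕ.*-comm i (3 ^ s)) ≡.refl (Cong-multiple 0 i)) , cl

      -- The relation of L_r says that the commutator of b and a is d, which is trivial in R.
      R-isC : IsC₃ᵗ×C₃ R s a b
      R-isC = record
        { commute = Group.sym R {b ∙ a} {a ∙ b} (1 , Q.trans {b ∙ a} {a ↑ (1 + 3 ^ s) ∙ b} {a ∙ b ∙ d ↑ 1} relation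
            (≈⇒≈Q (trans (∙-congʳ (↑-suc a (3 ^ s))) (trans (swapʳ a (d-central b)) (∙-congˡ (sym (↑-1 d)))))))
        ; g-order = d≈Rε
        ; y-order = ≈⇒≈/ Quotient hd b-order
        ; generated = λ x → let n , l , e = generated x in n , l , ≈⇒≈/ Quotient hd e
        ; unique = unique-from-kernel R (3 ^ s) {{ℕ.m^n≢0 3 s}} d≈Rε (≈⇒≈/ Quotient hd b-order) R-kernel }

      R-colouring : InjColouring R
      R-colouring = colour-C₃ᵗ×C₃ R (suc t) (≡.subst (λ s → IsC₃ᵗ×C₃ R s a b) s≡ R-isC)

      Chain⇒R-canonical : ∀ k′ → Chain k′ Quotient → Canonical R
      Chain⇒R-canonical zero     ch′ = ⊥-elim (d≉Qε (ch′ d))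
      Chain⇒R-canonical (suc k′) ch′ = Chain-canonical k′ R (Chain-quotient k′ Quotient ch′ {d} hd d≉Qε)

      R-canonical : Canonical R
      R-canonical = let k′ , _ , ch′ = Quotient-Chain k ch in Chain⇒R-canonical k′ ch′


      d-powers : ∀ l l′ → (d ↑ l) ≈Q (d ↑ l′) → l % 3 ≡ l′ % 3
      d-powers = Q̄.order3-inj d³≈Qε d≉Qε

    -- ⟨N, d⟩ is elementary abelian of order 27, and d takes the place of the second central
    -- generator.
    elementary-kernel : d ↑ 3 ≈ ε → InjColouring G
    elementary-kernel d³ = K.kernel-extension {z} {d} {y} z-central d-central z³ d³ y³ ν-inj
        (λ x → proj₁ (action x) , trans (proj₂ (action x)) (∙-congˡ (∙-congˡ (↑-≡ z (≡.sym (ℕ.*-identityˡ _))))))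
        ν-in (Group.isGroup R) ≈⇒≈R R-canonical R-colouring d³
        (λ { {x} {x′} (l , j , i , e) → (i , l , j) , trans e (trans (trans (assoc _ _ _) (assoc _ _ _)) (∙-congˡ (trans (sym (assoc _ _ _)) (sym (ν≈ i l j))))) })
      where
      module K = KernelColouring G 2 1 3 ≡.refl linearKernelMap linear-valid₃
      ν≈ : ∀ i l j → (z ↑ i ∙ d ↑ l) ∙ y ↑ j ≈ (d ↑ l ∙ y ↑ j) ∙ z ↑ i
      ν≈ i l j = trans (assoc _ _ _) (z-↑ i _)
      ν≈Q : ∀ i l j → ((z ↑ i ∙ d ↑ l) ∙ y ↑ j) ≈Q (d ↑ l)
      ν≈Q i l j = j , i , ν≈ i l j
      ν-in : ∀ n → Group._≈_ R (K.ν z-central d-central z³ d³ y³ n) ε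
      ν-in (i , l , j) = l , j , i , trans (ν≈ i l j) (∙-congʳ (∙-congʳ (sym (identityˡ _))))
      ν-inj : ∀ m n → _ → KernelConditions.code 2 1 3 m ≡ KernelConditions.code 2 1 3 n
      ν-inj (i , l , j) (i′ , l′ , j′) e = ≡.cong₂ (λ a b → a * 3 + b) (≡.cong₂ (λ a b → a * 3 + b) (proj₂ ji≡) l≡) (proj₁ ji≡)
        where
        l≡ : l % 3 ≡ l′ % 3
        l≡ = d-powers l l′ (Q.trans {d ↑ l} {(z ↑ i ∙ d ↑ l) ∙ y ↑ j} {d ↑ l′} (Q.sym {(z ↑ i ∙ d ↑ l) ∙ y ↑ j} {d ↑ l} (ν≈Q i l j))
               (Q.trans {(z ↑ i ∙ d ↑ l) ∙ y ↑ j} {(z ↑ i′ ∙ d ↑ l′) ∙ y ↑ j′} {d ↑ l′} (≈⇒≈Q e) (ν≈Q i′ l′ j′)))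
        ji≡ = N-unique j i j′ i′ (∙-cancelˡ (d ↑ l) _ _ (begin
          d ↑ l ∙ (y ↑ j ∙ z ↑ i) ≈⟨ assoc _ _ _ ⟨
          d ↑ l ∙ y ↑ j ∙ z ↑ i ≈⟨ ν≈ i l j ⟨
          (z ↑ i ∙ d ↑ l) ∙ y ↑ j ≈⟨ e ⟩
          (z ↑ i′ ∙ d ↑ l′) ∙ y ↑ j′ ≈⟨ ν≈ i′ l′ j′ ⟩
          d ↑ l′ ∙ y ↑ j′ ∙ z ↑ i′ ≈⟨ assoc _ _ _ ⟩
          d ↑ l′ ∙ (y ↑ j′ ∙ z ↑ i′) ≈⟨ ∙-congʳ (↑-≡% 3 {l′} {l} d³ (≡.sym l≡)) ⟩
          d ↑ l ∙ (y ↑ j′ ∙ z ↑ i′) ∎))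

    -- Now d has order 9 and N has d³ as its central generator. Conjugation multiplies y′ by powers
    -- of d³, hence w = 3.
    cyclic9-kernel : ∀ {y′} (N′ : IsNormalC₃² G (d ↑ 3) y′) →
                     (∀ {x x′} → x ≈Q x′ → Group._≈_ (IsNormalC₃².Quotient N′) x x′) →
                     (∀ {x x′} → Group._≈_ (IsNormalC₃².Quotient N′) x x′ → x ≈Q x′) → InjColouring G
    cyclic9-kernel {y′} N′ to from = K.kernel-extension {d} {ε} {y′} d-central ε-central d⁹ (ε-↑ 3) N′.y³ ν-inj
        (λ x → proj₁ (N′.action x) , trans (proj₂ (N′.action x)) (∙-congˡ (∙-congˡ (sym (↑-*′ d 3 _)))))
        ν-in (Group.isGroup R) ≈⇒≈R R-canonical R-colouring (↑-1 ε) coset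
      where
      module N′ = NormalSubgroup G N′
      module K = KernelColouring G 8 3 1 ≡.refl cyclic9KernelMap cyclic9-valid
      d⁹ : d ↑ 9 ≈ ε
      d⁹ = trans (↑-*′ d 3 3) N′.z³
      ν≈ : ∀ i l j → (d ↑ i ∙ ε ↑ l) ∙ y′ ↑ j ≈ d ↑ i ∙ y′ ↑ j
      ν≈ i l j = ∙-congʳ (trans (∙-congˡ (ε-↑ l)) (identityʳ _))
      power≈Q : ∀ i j → (d ↑ i ∙ y′ ↑ j) ≈Q (d ↑ i)
      power≈Q i j = from (j , 0 , trans (sym (identityʳ _)) (∙-congˡ (sym (↑-0 (d ↑ 3)))))
      third : ∀ n → n % 3 ≡ 0 → n ≡ n / 3 * 3
      third n n≡0 = ≡.trans (m≡m%n+[m/n]*n n 3) (≡.cong (_+ n / 3 * 3) n≡0)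
      kernel′ : ∀ n l → d ↑ n ∙ y′ ↑ l ≈ ε → Cong 9 n 0 × Cong 3 l 0
      kernel′ n l e = Cong-resp (≡.sym n≡) ≡.refl (Cong-multiple 0 (n / 3 / 3)) , %⇒Cong (proj₁ lq≡0)
        where
        n≡0 : n % 3 ≡ 0
        n≡0 = d-powers n 0 (Q.trans {d ↑ n} {d ↑ n ∙ y′ ↑ l} {d ↑ 0} (Q.sym {d ↑ n ∙ y′ ↑ l} {d ↑ n} (power≈Q n l)) (≈⇒≈Q (trans e (sym (↑-0 d)))))
        lq≡0 : l % 3 ≡ 0 × n / 3 % 3 ≡ 0
        lq≡0 = N′.N-trivial l (n / 3) (trans (sym (N′.z-↑ (n / 3) _)) (trans (∙-congʳ (trans (sym (↑-* d (n / 3) 3)) (↑-≡ d (≡.sym (third n n≡0))))) e))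
        n≡ : n ≡ n / 3 / 3 * 9
        n≡ = ≡.trans (third n n≡0) (≡.trans (≡.cong (_* 3) (third (n / 3) (proj₂ lq≡0))) (ℕ.*-assoc (n / 3 / 3) 3 3))
      ν-inj : ∀ m n → K.ν d-central ε-central d⁹ (ε-↑ 3) N′.y³ m ≈ K.ν d-central ε-central d⁹ (ε-↑ 3) N′.y³ n →
              KernelConditions.code 8 3 1 m ≡ KernelConditions.code 8 3 1 n
      ν-inj (i , l , j) (i′ , l′ , j′) e = ≡.cong₂ (λ a b → a * 3 + b)
          (≡.cong₂ (λ a b → a * 1 + b) (Cong⇒% (proj₁ cc)) (≡.trans (n%1≡0 l) (≡.sym (n%1≡0 l′)))) (Cong⇒% (proj₂ cc))
        where
        cc : Cong 9 i i′ × Cong 3 j j′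
        cc = unique-from-kernel G 9 d⁹ N′.y³ kernel′ i j i′ j′ (trans (sym (ν≈ i l j)) (trans e (ν≈ i′ l′ j′)))
      ν-in : ∀ n → Group._≈_ R (K.ν d-central ε-central d⁹ (ε-↑ 3) N′.y³ n) ε
      ν-in (i , l , j) = i , Q.trans {(d ↑ i ∙ ε ↑ l) ∙ y′ ↑ j} {d ↑ i ∙ y′ ↑ j} {ε ∙ d ↑ i} (≈⇒≈Q (ν≈ i l j))
        (Q.trans {d ↑ i ∙ y′ ↑ j} {d ↑ i} {ε ∙ d ↑ i} (power≈Q i j) (≈⇒≈Q (sym (identityˡ _))))
      coset : ∀ {x x′} → Group._≈_ R x x′ → ∃ λ n → x ≈ x′ ∙ K.ν d-central ε-central d⁹ (ε-↑ 3) N′.y³ n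
      coset {x} {x′} (l , e) with to e
      ... | p , q , h = (l + 3 * q , 0 , p) , (begin
        x ≈⟨ h ⟩
        x′ ∙ d ↑ l ∙ y′ ↑ p ∙ (d ↑ 3) ↑ q ≈⟨ swapʳ _ (sym (N′.z-↑ q _)) ⟩
        x′ ∙ d ↑ l ∙ (d ↑ 3) ↑ q ∙ y′ ↑ p ≈⟨ ∙-congʳ (trans (assoc _ _ _) (∙-congˡ (trans (∙-congˡ (sym (↑-*′ d 3 q))) (sym (↑-+ d l _))))) ⟩
        x′ ∙ d ↑ (l + 3 * q) ∙ y′ ↑ p ≈⟨ trans (assoc _ _ _) (∙-congˡ (sym (ν≈ _ 0 p))) ⟩
        x′ ∙ ((d ↑ (l + 3 * q) ∙ ε ↑ 0) ∙ y′ ↑ p) ∎)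

    modular-quotient-case : InjColouring G
    modular-quotient-case = cases (Chain-dec k G ch (d ↑ 3) ε) d³≈Qε
      where
      cases : Dec (d ↑ 3 ≈ ε) → (d ↑ 3) ≈Q ε → InjColouring G
      cases (yes d³≈ε) _           = elementary-kernel d³≈ε
      cases (no d³≉ε)  (j , i , e) =
        let y′ , N′ , to , from = Rebase.rebase G N j i (central-↑ d-central 3) d³≉ε
                                    (trans e (∙-congʳ (identityˡ _)))
        in cyclic9-kernel N′ to from

  -- Cyclic and modular groups remain alternatives of the conclusion because the quotient by N may
  -- be such a group. The length drops by two at each step, hence the well-founded recursion.
  colour : ∀ k → Acc _<_ k → (G : Group c ℓ) → Chain k G → Cyclic G ⊎ Modular G ⊎ InjColouring G
  colour k (acc rec) G ch with cyclic-or-normalC₃² k G ch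
  ... | inj₁ cyclic = inj₁ cyclic
  ... | inj₂ (z , y , N) with NormalSubgroup.Quotient-Chain G N k ch
  ...   | k′ , ≡.refl , ch′ with colour k′ (rec (s≤s (ℕ.n≤1+n k′))) (IsNormalC₃².Quotient N) ch′
  ...     | inj₂ (inj₂ colouring) = inj₂ (inj₂ (NormalSubgroup.N-extension G N (NormalSubgroup.Quotient-Canonical G N k ch) colouring))
  ...     | inj₂ (inj₁ (t , a , b , modular)) = inj₂ (inj₂ (ModularQuotient.modular-quotient-case G k ch N (2 + t) t ≡.refl modular))
  ...     | inj₁ cyclic with cyclic-quotient-case k G ch N cyclic
  ...       | inj₁ colouring = inj₂ (inj₂ colouring)
  ...       | inj₂ modular = inj₂ (inj₁ modular)

-- The presentation of L_r

opaque
  unfolding power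

  pow≡power : ∀ {c ℓ} (G : Group c ℓ) x n → pow G x n ≡ Powers._↑_ G x n
  pow≡power G x zero    = ≡.refl
  pow≡power G x (suc n) = ≡.cong (Group._∙_ G x) (pow≡power G x n)

module _ {c ℓ : Level} where

  module _ (G : Group c ℓ) where
    open Group G
    open Powers G
    open Commutators G
    open import Relation.Binary.Reasoning.Setoid setoid

    module _ {a b : Carrier} {d : ℕ} (relation : b ∙ a ≈ a ↑ suc d ∙ b) where

      commutation : ∀ l n → b ↑ l ∙ a ↑ n ≈ a ↑ (suc d ^ l * n) ∙ b ↑ l
      commutation zero n = begin
        b ↑ 0 ∙ a ↑ n ≈⟨ trans (∙-congʳ (↑-0 b)) (sym (commute-ε _)) ⟩
        a ↑ n ∙ ε ≈⟨ ∙-cong (↑-≡ a (ℕ.+-identityʳ n)) (↑-0 b) ⟨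
        a ↑ (1 * n) ∙ b ↑ 0 ∎
      commutation (suc l) n = begin
        b ↑ suc l ∙ a ↑ n ≈⟨ trans (∙-congʳ (↑-suc b l)) (assoc _ _ _) ⟩
        b ∙ (b ↑ l ∙ a ↑ n) ≈⟨ trans (∙-congˡ (commutation l n)) (sym (assoc _ _ _)) ⟩
        b ∙ a ↑ (suc d ^ l * n) ∙ b ↑ l ≈⟨ ∙-congʳ (conjugate-↑ (sym relation) (suc d ^ l * n)) ⟨
        (a ↑ suc d) ↑ (suc d ^ l * n) ∙ b ∙ b ↑ l ≈⟨ trans (assoc _ _ _) (∙-cong (trans (sym (↑-*′ a (suc d) _)) (↑-≡ a (≡.sym (ℕ.*-assoc (suc d) (suc d ^ l) n)))) (sym (↑-suc b l))) ⟩
        a ↑ (suc d ^ suc l * n) ∙ b ↑ suc l ∎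

      product : ∀ n l n′ l′ → (a ↑ n ∙ b ↑ l) ∙ (a ↑ n′ ∙ b ↑ l′) ≈ a ↑ (n + suc d ^ l * n′) ∙ b ↑ (l + l′)
      product n l n′ l′ = begin
        (a ↑ n ∙ b ↑ l) ∙ (a ↑ n′ ∙ b ↑ l′) ≈⟨ trans (assoc _ _ _) (∙-congˡ (sym (assoc _ _ _))) ⟩
        a ↑ n ∙ (b ↑ l ∙ a ↑ n′ ∙ b ↑ l′) ≈⟨ ∙-congˡ (∙-congʳ (commutation l n′)) ⟩
        a ↑ n ∙ (a ↑ (suc d ^ l * n′) ∙ b ↑ l ∙ b ↑ l′) ≈⟨ trans (∙-congˡ (assoc _ _ _)) (sym (assoc _ _ _)) ⟩
        (a ↑ n ∙ a ↑ (suc d ^ l * n′)) ∙ (b ↑ l ∙ b ↑ l′) ≈⟨ ∙-cong (↑-+ a n _) (↑-+ b l l′) ⟨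
        a ↑ (n + suc d ^ l * n′) ∙ b ↑ (l + l′) ∎

    gen-↑ : ∀ {a b x} → Gen G a b x → ∀ n → Gen G a b (x ↑ n)
    gen-↑ {x = x} h zero    = gen-≈ (sym (↑-0 x)) gen-ε
    gen-↑ {x = x} h (suc n) = gen-≈ (sym (↑-suc x n)) (gen-∙ h (gen-↑ h n))

    conjugation⇒relation : ∀ {a b x} → (b ∙ a) ∙ b ⁻¹ ≈ x → b ∙ a ≈ x ∙ b
    conjugation⇒relation {b = b} h = trans (sym (trans (assoc _ _ _) (trans (∙-congˡ (inverseˡ b)) (identityʳ _)))) (∙-congʳ h)

    relation⇒conjugation : ∀ {a b x} → b ∙ a ≈ x ∙ b → (b ∙ a) ∙ b ⁻¹ ≈ x
    relation⇒conjugation {b = b} h = trans (∙-congʳ h) (trans (assoc _ _ _) (trans (∙-congˡ (inverseʳ b)) (identityʳ _)))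

    pow≈ : ∀ x n → pow G x n ≈ x ↑ n
    pow≈ x n = reflexive (pow≡power G x n)

  -- Normal forms a^n b^l are unique modulo the orders of a and b, and their product formula follows
  -- from the relations alone. Reading the exponents in H is therefore well defined and
  -- multiplicative.
  Modular⇒presented : (G : Group c ℓ) → Modular G → ∃ λ r → 4 ≤ r × IsPresentedAsL G r
  Modular⇒presented G (t , a , b , modular) = 4 + t , s≤s (s≤s (s≤s (s≤s z≤n))) , a , b ,
      (λ x → let n , l , e = generated x in gen-≈ (sym e) (gen-∙ (gen-↑ G gen-a n) (gen-↑ G gen-b l))) ,
      (trans (pow≈ G a (3 ^ suc s)) a-order , trans (pow≈ G b 3) b-order ,
        trans (relation⇒conjugation G relation) (sym (pow≈ G a (1 + 3 ^ s)))) ,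
      universal
    where
    open Group G
    open Powers G
    open IsModular modular
    s : ℕ
    s = 2 + t
    unique : ∀ n l n′ l′ → a ↑ n ∙ b ↑ l ≈ a ↑ n′ ∙ b ↑ l′ → Cong (3 ^ suc s) n n′ × Cong 3 l l′
    unique = unique-from-kernel G (3 ^ suc s) {{ℕ.m^n≢0 3 (suc s)}} a-order b-order kernel
    universal : (H : Group c ℓ) → (a′ b′ : Group.Carrier H) → LRelations H (4 + t) a′ b′ →
      ∃ λ (f : Carrier → Group.Carrier H) →
        GroupMorphisms.IsGroupHomomorphism (Group.rawGroup G) (Group.rawGroup H) f ×
        Group._≈_ H (f a) a′ × Group._≈_ H (f b) b′
    universal H a′ b′ (a′-order , b′-order , conj) = f , isHom ,
        H.trans (at-value 1 0 (sym (trans (∙-cong (↑-1 a) (↑-0 b)) (identityʳ a)))) (H.trans (H.∙-cong (P.↑-1 a′) (P.↑-0 b′)) (H.identityʳ a′)) ,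
        H.trans (at-value 0 1 (sym (trans (∙-cong (↑-0 a) (↑-1 b)) (identityˡ b)))) (H.trans (H.∙-cong (P.↑-0 a′) (P.↑-1 b′)) (H.identityˡ b′))
      where
      module H = Group H
      module P = Powers H
      order-a′ : a′ P.↑ (3 ^ suc s) H.≈ H.ε
      order-a′ = H.trans (H.sym (pow≈ H a′ (3 ^ suc s))) a′-order
      order-b′ : b′ P.↑ 3 H.≈ H.ε
      order-b′ = H.trans (H.sym (pow≈ H b′ 3)) b′-order
      relation′ : b′ H.∙ a′ H.≈ a′ P.↑ (1 + 3 ^ s) H.∙ b′
      relation′ = conjugation⇒relation H (H.trans conj (pow≈ H a′ (1 + 3 ^ s)))
      f : Carrier → H.Carrier
      f x = let n , l , _ = generated x in a′ P.↑ n H.∙ b′ P.↑ l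
      at-value : ∀ {x} n l → x ≈ a ↑ n ∙ b ↑ l → f x H.≈ (a′ P.↑ n H.∙ b′ P.↑ l)
      at-value {x} n l e =
        let n′ , l′ , e′ = generated x
            cn , cl = unique n′ l′ n l (trans (sym e′) e)
        in H.∙-cong (P.↑-≡% (3 ^ suc s) {{ℕ.m^n≢0 3 (suc s)}} order-a′ (Cong⇒% {{ℕ.m^n≢0 3 (suc s)}} cn)) (P.↑-≡% 3 order-b′ (Cong⇒% cl))
      f-cong : ∀ {x y} → x ≈ y → f x H.≈ f y
      f-cong {x} {y} e = let n , l , e′ = generated y in at-value n l (trans e e′)
      f-∙ : ∀ x y → f (x ∙ y) H.≈ (f x H.∙ f y)
      f-∙ x y =
        let n , l , e = generated x
            n′ , l′ , e′ = generated y
        in H.trans (at-value _ _ (trans (∙-cong e e′) (product G {a} {b} {3 ^ s} relation n l n′ l′)))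
                   (H.sym (product H {a′} {b′} {3 ^ s} relation′ n l n′ l′))
      f-ε : f ε H.≈ H.ε
      f-ε = P.∙-cancelˡ (f ε) _ _ (H.trans (H.sym (f-∙ ε ε)) (H.trans (f-cong (identityˡ ε)) (H.sym (H.identityʳ _))))
      isHom : GroupMorphisms.IsGroupHomomorphism rawGroup H.rawGroup f
      isHom = record
        { isMonoidHomomorphism = record
          { isMagmaHomomorphism = record { isRelHomomorphism = record { cong = f-cong } ; homo = f-∙ }
          ; ε-homo = f-ε }
        ; ⁻¹-homo = λ x → P.inverseˡ-unique (f (x ⁻¹)) (f x) (H.trans (H.sym (f-∙ (x ⁻¹) x)) (H.trans (f-cong (inverseˡ x)) f-ε)) }

-- Groups of order 3ᵏ are nilpotent

∣3^ : ∀ k {d} → d ∣ 3 ^ k → d ≡ 1 ⊎ 3 ∣ d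
∣3^ zero    h = inj₁ (∣1⇒≡1 h)
∣3^ (suc k) {d} h with 3 ∣? d
... | yes 3∣d = inj₂ 3∣d
... | no 3∤d = ∣3^ k (coprime-divisor coprime h)
  where
  coprime : Coprime d 3
  coprime (e∣d , e∣3) with prime⇒irreducible (from-yes (prime? 3)) e∣3
  ... | inj₁ e≡1    = e≡1
  ... | inj₂ ≡.refl = ⊥-elim (3∤d e∣d)

count : ∀ {n} → (Fin n → Bool) → ℕ
count {zero}  P = 0
count {suc n} P = (if P zero then 1 else 0) + count (λ i → P (suc i))

count-ext : ∀ {n} {P Q : Fin n → Bool} → (∀ i → P i ≡ Q i) → count P ≡ count Q
count-ext {zero}  e = ≡.refl
count-ext {suc n} e rewrite e zero = ≡.cong (_ +_) (count-ext (λ i → e (suc i)))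

count-split : ∀ {n} (P Q : Fin n → Bool) → count P ≡ count (λ i → P i ∧ Q i) + count (λ i → P i ∧ not (Q i))
count-split {zero}  P Q = ≡.refl
count-split {suc n} P Q with P zero | Q zero | count-split (λ i → P (suc i)) (λ i → Q (suc i))
... | false | _     | e = e
... | true  | true  | e = ≡.cong suc e
... | true  | false | e = ≡.trans (≡.cong suc e) (≡.sym (ℕ.+-suc _ _))

count-true : ∀ n → count {n} (λ _ → true) ≡ n
count-true zero    = ≡.refl
count-true (suc n) = ≡.cong suc (count-true n)

record Enumeration {n : ℕ} (P : Fin n → Bool) (s : ℕ) : Set where
  field
    element  : Fin s → Fin n
    sound    : ∀ c → T (P (element c))
    complete : ∀ i → T (P i) → ∃ λ c → element c ≡ i
    distinct : ∀ {c c′} → element c ≡ element c′ → c ≡ c′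

enumerate : ∀ {n} (P : Fin n → Bool) → Enumeration P (count P)
enumerate {zero} P = record { element = λ () ; sound = λ () ; complete = λ () ; distinct = λ {} }
enumerate {suc n} P with P zero in eq | enumerate (λ i → P (suc i))
... | false | E = record
  { element  = λ c → suc (element c)
  ; sound    = sound
  ; complete = λ { zero t → ⊥-elim (≡.subst T eq t) ; (suc i) t → let c , e = complete i t in c , ≡.cong suc e }
  ; distinct = λ e → distinct (suc-injective e) }
  where open Enumeration E
... | true | E = record
  { element  = λ { zero → zero ; (suc c) → suc (element c) }
  ; sound    = λ { zero → ≡.subst T (≡.sym eq) tt ; (suc c) → sound c }
  ; complete = λ { zero t → zero , ≡.refl ; (suc i) t → let c , e = complete i t in suc c , ≡.cong suc e }
  ; distinct = λ { {zero} {zero} e → ≡.refl ; {suc c} {suc c′} e → ≡.cong suc (distinct (suc-injective e)) } }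
  where open Enumeration E

enumeration-size : ∀ {n} {P : Fin n → Bool} {s s′} → Enumeration P s → Enumeration P s′ → s ≡ s′
enumeration-size E E′ = ℕ.≤-antisym (le E E′) (le E′ E)
  where
  le : ∀ {n} {P : Fin n → Bool} {s s′} → Enumeration P s → Enumeration P s′ → s ≤ s′
  le E E′ = injective⇒≤ {f = λ c → proj₁ (E′.complete (E.element c) (E.sound c))} λ {c} {c′} e → E.distinct
      (≡.trans (≡.sym (proj₂ (E′.complete _ (E.sound c)))) (≡.trans (≡.cong E′.element e) (proj₂ (E′.complete _ (E.sound c′)))))
    where
    module E  = Enumeration E
    module E′ = Enumeration E′

record Classes {ℓ} {n : ℕ} (_~_ : Rel (Fin n) ℓ) : Set ℓ where
  field
    size       : ℕ
    class      : Fin n → Fin size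
    rep        : Fin size → Fin n
    class-cong : ∀ {i j} → i ~ j → class i ≡ class j
    rep-class  : ∀ i → rep (class i) ~ i
    class-rep  : ∀ c → class (rep c) ≡ c

classes : ∀ {ℓ} n {_~_ : Rel (Fin n) ℓ} → IsEquivalence _~_ → (∀ i j → Dec (i ~ j)) → Classes _~_
classes zero eq dec = record { size = 0 ; class = λ () ; rep = λ () ; class-cong = λ { {()} } ; rep-class = λ () ; class-rep = λ () }
classes (suc n) {_~_} eq dec with classes n {λ i j → suc i ~ suc j}
    (record { refl = IsEquivalence.refl eq ; sym = IsEquivalence.sym eq ; trans = IsEquivalence.trans eq }) (λ i j → dec
    (suc i) (suc j))
                               | any? (λ j → dec zero (suc j))
... | C | yes (j , 0~j) = record
  { size       = size
  ; class      = λ { zero → class j ; (suc i) → class i }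
  ; rep        = λ c → suc (rep c)
  ; class-cong = λ { {zero} {zero} _ → ≡.refl
                   ; {zero} {suc i} h → class-cong (trans (sym 0~j) h)
                   ; {suc i} {zero} h → class-cong (trans h 0~j)
                   ; {suc i} {suc i′} h → class-cong h }
  ; rep-class  = λ { zero → trans (rep-class j) (sym 0~j) ; (suc i) → rep-class i }
  ; class-rep  = class-rep }
  where
  open Classes C
  open IsEquivalence eq
... | C | no 0≁ = record
  { size       = suc size
  ; class      = λ { zero → zero ; (suc i) → suc (class i) }
  ; rep        = λ { zero → zero ; (suc c) → suc (rep c) }
  ; class-cong = λ { {zero} {zero} _ → ≡.refl
                   ; {zero} {suc i} h → ⊥-elim (0≁ (i , h))
                   ; {suc i} {zero} h → ⊥-elim (0≁ (i , sym h))
                   ; {suc i} {suc i′} h → ≡.cong suc (class-cong h) }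
  ; rep-class  = λ { zero → refl ; (suc i) → rep-class i }
  ; class-rep  = λ { zero → ≡.refl ; (suc c) → ≡.cong suc (class-rep c) } }
  where
  open Classes C
  open IsEquivalence eq

module _ {n : ℕ} (_~_ : Fin n → Fin n → Bool) (~-refl : ∀ i → T (i ~ i))
         (~-sym : ∀ {i j} → T (i ~ j) → T (j ~ i)) (~-trans : ∀ {i j k} → T (i ~ j) → T (j ~ k) → T (i ~ k)) where

  private
    ∧-absorb : ∀ x y → (T y → T x) → x ∧ y ≡ y
    ∧-absorb true  y     h = ≡.refl
    ∧-absorb false true  h = ⊥-elim (h tt)
    ∧-absorb false false h = ≡.refl

    T-∧ : ∀ {x y} → T x → T y → T (x ∧ y)
    T-∧ {true} _ t = t

    T-not : ∀ {x} → T (not x) → ¬ T x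
    T-not {false} _ ()

    not-T : ∀ {x} → ¬ T x → T (not x)
    not-T {true}  h = h tt
    not-T {false} h = tt

    positive : ∀ {n} (P : Fin n → Bool) i → T (P i) → 0 < count P
    positive P i t with count P | enumerate P
    ... | zero  | E with Enumeration.complete E i t
    ...   | ()
    positive P i t | suc _ | E = s≤s z≤n

  -- A saturated set is a union of classes. The class of its first element is split off; m bounds
  -- the count and makes the recursion structural.
  class-equation : ∀ m P → count P ≤ m → (∀ {i j} → T (P i) → T (i ~ j) → T (P j)) →
                   (∀ i → T (P i) → 3 ∣ count (i ~_)) → 3 ∣ count P
  class-equation m P P≤m saturated divisible with count P in eq | enumerate P
  ... | zero | E = 3 ∣0
  class-equation (suc m) P (s≤s P≤m) saturated divisible | suc p | E =
    ≡.subst (3 ∣_) (≡.trans (≡.sym split) eq) (∣m∣n⇒∣m+n (divisible i tᵢ)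
      (class-equation m P′ P′≤m
        (λ {j} {k} t j~k → let tP , t≁ = ∧-T (P j) t in
          T-∧ (saturated tP j~k) (not-T (λ i~k → T-not t≁ (~-trans i~k (~-sym j~k)))))
        (λ j t → divisible j (proj₁ (∧-T (P j) t)))))
    where
    i  = Enumeration.element E zero
    tᵢ = Enumeration.sound E zero
    P′ : Fin n → Bool
    P′ j = P j ∧ not (i ~ j)
    split : count P ≡ count (i ~_) + count P′
    split = ≡.trans (count-split P (i ~_)) (≡.cong (_+ count P′) (count-ext (λ j → ∧-absorb (P j) (i ~ j) (λ t → saturated tᵢ t))))
    P′≤m : count P′ ≤ m
    P′≤m = ℕ.≤-trans (ℕ.≤-pred (≡.subst (suc (count P′) ≤_) (≡.trans (≡.sym split) eq)
             (ℕ.+-monoˡ-≤ (count P′) (positive (i ~_) i (~-refl i))))) P≤m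

module _ {c ℓ : Level} (G : Group c ℓ) {n : ℕ} (order : HasOrder G n) where
  open Group G
  open Powers G
  open Inverse order using (to; from; to-cong; strictlyInverseˡ; strictlyInverseʳ)
  open import Relation.Binary.Reasoning.Setoid setoid

  to-injective : ∀ {x y} → to x ≡ to y → x ≈ y
  to-injective e = trans (sym (strictlyInverseʳ _)) (trans (reflexive (≡.cong from e)) (strictlyInverseʳ _))

  from-injective : ∀ {i j} → from i ≈ from j → i ≡ j
  from-injective e = ≡.trans (≡.sym (strictlyInverseˡ _)) (≡.trans (to-cong e) (strictlyInverseˡ _))

  _≈?_ : ∀ x y → Dec (x ≈ y)
  x ≈? y = map′ to-injective to-cong (to x Fin.≟ to y)

  record Transversal {ℓ′} (_~_ : Rel Carrier ℓ′) : Set (c ⊔ ℓ ⊔ ℓ′) where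
    field
      size       : ℕ
      class      : Carrier → Fin size
      rep        : Fin size → Carrier
      class-cong : ∀ {x y} → x ~ y → class x ≡ class y
      rep-class  : ∀ x → rep (class x) ~ x
      class-rep  : ∀ i → class (rep i) ≡ i

  module _ {ℓ′} {_~_ : Rel Carrier ℓ′} (~-equivalence : IsEquivalence _~_) (coarser : ∀ {x y} → x ≈ y → x ~ y) where

    private
      module ~ = IsEquivalence ~-equivalence

    transversal : (∀ x y → Dec (x ~ y)) → Transversal _~_
    transversal dec = record
      { size       = size
      ; class      = λ x → class (to x)
      ; rep        = λ i → from (rep i)
      ; class-cong = λ h → class-cong (~.trans (coarser (strictlyInverseʳ _)) (~.trans h (coarser (sym (strictlyInverseʳ _)))))
      ; rep-class  = λ x → ~.trans (rep-class (to x)) (coarser (strictlyInverseʳ x))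
      ; class-rep  = λ i → ≡.trans (≡.cong class (strictlyInverseˡ (rep i))) (class-rep i) }
      where
      indexClasses : Classes (λ i j → from i ~ from j)
      indexClasses = classes n (record { refl = ~.refl ; sym = ~.sym ; trans = ~.trans }) (λ i j → dec (from i) (from j))
      open Classes indexClasses

    -- Elements correspond to pairs of a class representative and an index into h. Only the
    -- translates of h matter, so the same count serves for centralisers, for ⟨x⟩ and for ⟨z⟩.
    lagrange : ∀ {d} (h : Fin d → Carrier) → (∀ {i j} → h i ≈ h j → i ≡ j) → (∀ x i → (x ∙ h i) ~ x) →
               (∀ {x y} → x ~ y → ∃ λ i → x ≈ y ∙ h i) → (t : Transversal _~_) → n ≡ Transversal.size t * d
    lagrange {d} h h-inj inside coset t = ℕ.≤-antisym
        (injective⇒≤ {f = λ i → combine (class (from i)) (position (from i))} λ {i} {j} e →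
          let ce , pe = combine-injective (class (from i)) (position (from i)) (class (from j)) (position (from j)) e
          in from-injective (trans (position-≈ (from i)) (trans (reflexive (≡.cong₂ (λ a b → rep a ∙ h b) ce pe)) (sym (position-≈ (from j))))))
        (injective⇒≤ {f = λ k → to (element (remQuot d k))} λ {k} {k′} e →
          ≡.trans (≡.sym (Fin.combine-remQuot {size} d k)) (≡.trans
            (≡.cong (λ (a , b) → combine a b) (element-injective (remQuot d k) (remQuot d k′) (to-injective e)))
            (Fin.combine-remQuot {size} d k′)))
      where
      open Transversal t
      position : Carrier → Fin d
      position x = proj₁ (coset (~.sym (rep-class x)))
      position-≈ : ∀ x → x ≈ rep (class x) ∙ h (position x)
      position-≈ x = proj₂ (coset (~.sym (rep-class x)))
      element : Fin size × Fin d → Carrier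
      element (a , b) = rep a ∙ h b
      element-injective : ∀ p q → element p ≈ element q → p ≡ q
      element-injective (a , b) (a′ , b′) e = ≡.cong₂ _,_ a≡ (h-inj (∙-cancelˡ (rep a) _ _
          (trans e (∙-congʳ (reflexive (≡.cong rep (≡.sym a≡)))))))
        where
        a≡ : a ≡ a′
        a≡ = ≡.trans (≡.sym (class-rep a)) (≡.trans (class-cong (~.trans (~.sym (inside (rep a) b))
               (~.trans (coarser e) (inside (rep a′) b′)))) (class-rep a′))

  private
    Conjugate : Rel (Fin n) ℓ
    Conjugate i j = ∃ λ g → from g ∙ from i ≈ from j ∙ from g

    conjugate? : ∀ i j → Dec (Conjugate i j)
    conjugate? i j = any? λ g → (from g ∙ from i) ≈? (from j ∙ from g)

    conjugate : ∀ {i j} g → g ∙ from i ≈ from j ∙ g → Conjugate i j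
    conjugate g e = to g , trans (∙-congʳ (strictlyInverseʳ g)) (trans e (∙-congˡ (sym (strictlyInverseʳ g))))

    _~ᵇ_ : Fin n → Fin n → Bool
    i ~ᵇ j = ⌊ conjugate? i j ⌋

    ~-sym : ∀ {i j} → Conjugate i j → Conjugate j i
    ~-sym {i} {j} (g , e) = conjugate (from g ⁻¹) (∙-cancelˡ (from g) _ _ (begin
      from g ∙ (from g ⁻¹ ∙ from j) ≈⟨ trans (sym (assoc _ _ _)) (trans (∙-congʳ (inverseʳ _)) (identityˡ _)) ⟩
      from j ≈⟨ trans (sym (identityʳ _)) (trans (∙-congˡ (sym (inverseʳ (from g)))) (sym (assoc _ _ _))) ⟩
      from j ∙ from g ∙ from g ⁻¹ ≈⟨ ∙-congʳ e ⟨
      from g ∙ from i ∙ from g ⁻¹ ≈⟨ assoc _ _ _ ⟩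
      from g ∙ (from i ∙ from g ⁻¹) ∎))

    ~-trans : ∀ {i j k} → Conjugate i j → Conjugate j k → Conjugate i k
    ~-trans {i} {j} {k} (g , e) (g′ , e′) = conjugate (from g′ ∙ from g) (begin
      from g′ ∙ from g ∙ from i ≈⟨ trans (assoc _ _ _) (∙-congˡ e) ⟩
      from g′ ∙ (from j ∙ from g) ≈⟨ trans (sym (assoc _ _ _)) (∙-congʳ e′) ⟩
      from k ∙ from g′ ∙ from g ≈⟨ assoc _ _ _ ⟩
      from k ∙ (from g′ ∙ from g) ∎)

  -- The conjugacy class of x corresponds to the cosets of the centraliser of x.
  central-or-divisible : ∀ k → n ≡ 3 ^ k → ∀ i → Central (from i) ⊎ 3 ∣ count (i ~ᵇ_)
  central-or-divisible k n≡ i = cases (∣3^ k (≡.subst (size ∣_) n≡ (divides s (≡.trans n≡qs (ℕ.*-comm size s)))))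
    where
    x = from i
    κ : Carrier → Carrier
    κ g = (g ∙ x) ∙ g ⁻¹
    κ-cong : ∀ {g h} → g ≈ h → κ g ≈ κ h
    κ-cong e = ∙-cong (∙-congʳ e) (⁻¹-cong e)
    κ-∙ : ∀ g → κ g ∙ g ≈ g ∙ x
    κ-∙ g = trans (assoc _ _ _) (trans (∙-congˡ (inverseˡ g)) (identityʳ _))
    P : Fin n → Bool
    P g = ⌊ (from g ∙ x) ≈? (x ∙ from g) ⌋
    s = count P
    open Enumeration (enumerate P)
    ~κ : IsEquivalence (λ g h → κ g ≈ κ h)
    ~κ = record { refl = refl ; sym = sym ; trans = trans }
    t : Transversal (λ g h → κ g ≈ κ h)
    t = transversal ~κ κ-cong (λ g h → κ g ≈? κ h)
    open Transversal t
    inside : ∀ g c → κ (g ∙ from (element c)) ≈ κ g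
    inside g c = ∙-cancelʳ (g ∙ h) _ _ (begin
      κ (g ∙ h) ∙ (g ∙ h) ≈⟨ κ-∙ (g ∙ h) ⟩
      g ∙ h ∙ x ≈⟨ trans (assoc _ _ _) (∙-congˡ (toWitness (sound c))) ⟩
      g ∙ (x ∙ h) ≈⟨ trans (sym (assoc _ _ _)) (∙-congʳ (sym (κ-∙ g))) ⟩
      κ g ∙ g ∙ h ≈⟨ assoc _ _ _ ⟩
      κ g ∙ (g ∙ h) ∎)
      where h = from (element c)
    coset : ∀ {g h} → κ g ≈ κ h → ∃ λ c → g ≈ h ∙ from (element c)
    coset {g} {h} e = proj₁ found , (begin
        g ≈⟨ trans (sym (identityˡ g)) (trans (∙-congʳ (sym (inverseʳ h))) (assoc _ _ _)) ⟩
        h ∙ (h ⁻¹ ∙ g) ≈⟨ ∙-congˡ (strictlyInverseʳ _) ⟨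
        h ∙ from (to (h ⁻¹ ∙ g)) ≈⟨ ∙-congˡ (reflexive (≡.cong from (≡.sym (proj₂ found)))) ⟩
        h ∙ from (element (proj₁ found)) ∎)
      where
      r = h ⁻¹ ∙ g
      hr : h ∙ r ≈ g
      hr = trans (sym (assoc _ _ _)) (trans (∙-congʳ (inverseʳ h)) (identityˡ g))
      commutes : r ∙ x ≈ x ∙ r
      commutes = ∙-cancelˡ h _ _ (begin
        h ∙ (r ∙ x) ≈⟨ trans (sym (assoc _ _ _)) (∙-congʳ hr) ⟩
        g ∙ x ≈⟨ κ-∙ g ⟨
        κ g ∙ g ≈⟨ ∙-cong e (sym hr) ⟩
        κ h ∙ (h ∙ r) ≈⟨ trans (sym (assoc _ _ _)) (∙-congʳ (κ-∙ h)) ⟩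
        h ∙ x ∙ r ≈⟨ assoc _ _ _ ⟩
        h ∙ (x ∙ r) ∎)
      found = complete (to r) (fromWitness (trans (∙-congʳ (strictlyInverseʳ r)) (trans commutes (∙-congˡ (sym (strictlyInverseʳ r))))))
    n≡qs : n ≡ size * s
    n≡qs = lagrange ~κ κ-cong (λ c → from (element c)) (λ e → distinct (from-injective e)) inside coset t
    class-enumeration : Enumeration (i ~ᵇ_) size
    class-enumeration = record
      { element  = λ c → to (κ (rep c))
      ; sound    = λ c → fromWitness (conjugate (rep c) (trans (sym (κ-∙ (rep c))) (∙-congʳ (sym (strictlyInverseʳ _)))))
      ; complete = λ j t → let g , e = toWitness t in class (from g) , ≡.trans (to-cong (trans (rep-class (from g))
          (∙-cancelʳ (from g) _ _ (trans (κ-∙ (from g)) e)))) (strictlyInverseˡ j)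
      ; distinct = λ {c} {c′} e → ≡.trans (≡.sym (class-rep c)) (≡.trans (class-cong (to-injective e)) (class-rep c′)) }
    cases : size ≡ 1 ⊎ 3 ∣ size → _
    cases (inj₂ 3∣q) = inj₂ (≡.subst (3 ∣_) (enumeration-size class-enumeration (enumerate (i ~ᵇ_))) 3∣q)
    cases (inj₁ q≡1) = inj₁ (λ g → sym (trans (sym (κ-∙ g)) (∙-congʳ (begin
      κ g ≈⟨ rep-class g ⟨
      κ (rep (class g)) ≈⟨ κ-cong (reflexive (≡.cong rep (one q≡1 (class g) (class ε)))) ⟩
      κ (rep (class ε)) ≈⟨ rep-class ε ⟩
      (ε ∙ x) ∙ ε ⁻¹ ≈⟨ ∙-cong (identityˡ x) (trans (sym (identityˡ _)) (inverseʳ ε)) ⟩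
      x ∙ ε ≈⟨ identityʳ x ⟩
      x ∎))))
      where
      one : ∀ {q} → q ≡ 1 → (a b : Fin q) → a ≡ b
      one ≡.refl zero zero = ≡.refl

  dichotomy : ∀ {a b} m {A : Fin m → Set a} {B : Fin m → Set b} → (∀ i → A i ⊎ B i) → ∃ A ⊎ (∀ i → B i)
  dichotomy zero    f = inj₂ λ ()
  dichotomy (suc m) f with f zero | dichotomy m (λ i → f (suc i))
  ... | inj₁ a | _            = inj₁ (zero , a)
  ... | inj₂ b | inj₁ (i , a) = inj₁ (suc i , a)
  ... | inj₂ b | inj₂ g       = inj₂ λ { zero → b ; (suc i) → g i }

  -- If ε were the only central element, every other conjugacy class would have size divisible by 3,
  -- and 3 would divide 3^(k+1) - 1.
  nontrivial-centre : ∀ k → n ≡ 3 ^ suc k → ∃ λ z → Central z × ¬ z ≈ ε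
  nontrivial-centre k n≡ = cases (dichotomy n (λ i → choose i (i Fin.≟ e) (central-or-divisible (suc k) n≡ i)))
    where
    e = to ε
    nontrivial : Fin n → Bool
    nontrivial i = not ⌊ i Fin.≟ e ⌋
    ≈ε⇒≡e : ∀ {i} → from i ≈ ε → i ≡ e
    ≈ε⇒≡e h = ≡.trans (≡.sym (strictlyInverseˡ _)) (to-cong h)
    choose : ∀ i → Dec (i ≡ e) → Central (from i) ⊎ 3 ∣ count (i ~ᵇ_) →
             (Central (from i) × ¬ from i ≈ ε) ⊎ (i ≢ e → 3 ∣ count (i ~ᵇ_))
    choose i (yes i≡e) _              = inj₂ λ i≢e → ⊥-elim (i≢e i≡e)
    choose i (no _)    (inj₂ 3∣)      = inj₂ λ _ → 3∣
    choose i (no i≢e)  (inj₁ central) = inj₁ (central , λ h → i≢e (≈ε⇒≡e h))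
    cases : (∃ λ i → Central (from i) × ¬ from i ≈ ε) ⊎ (∀ i → i ≢ e → 3 ∣ count (i ~ᵇ_)) → ∃ λ z → Central z × ¬ z ≈ ε
    cases (inj₁ (i , central , i≉ε)) = from i , central , i≉ε
    cases (inj₂ divisible) = ⊥-elim (3∤1 (∣m+n∣m⇒∣n {3} {count nontrivial} {1}
        (≡.subst (3 ∣_) (≡.trans (≡.sym n≡) (≡.trans (≡.sym (count-true n)) (≡.trans (count-split (λ _ → true) (λ i → ⌊ i Fin.≟ e ⌋))
          (≡.trans (≡.cong (_+ count nontrivial) one) (ℕ.+-comm 1 _))))) (m∣m*n (3 ^ k)))
        (class-equation _~ᵇ_ (λ i → fromWitness (conjugate {i} {i} ε (trans (identityˡ _) (sym (identityʳ _)))))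
          (λ t → fromWitness (~-sym (toWitness t))) (λ t t′ → fromWitness (~-trans (toWitness t) (toWitness t′)))
          (count nontrivial) nontrivial ℕ.≤-refl saturated (λ i t → divisible i (toWitnessFalse t)))))
      where
      3∤1 : ¬ 3 ∣ 1
      3∤1 3∣1 with ∣⇒≤ 3∣1
      ... | s≤s ()
      one : count (λ i → true ∧ ⌊ i Fin.≟ e ⌋) ≡ 1
      one = enumeration-size (enumerate (λ i → true ∧ ⌊ i Fin.≟ e ⌋)) (record
        { element = λ _ → e ; sound = λ _ → fromWitness {a? = e Fin.≟ e} ≡.refl
        ; complete = λ i t → zero , ≡.sym (toWitness {a? = i Fin.≟ e} t) ; distinct = λ { {zero} {zero} _ → ≡.refl } })
      conjugate-ε : ∀ {i} → Conjugate i e → from i ≈ ε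
      conjugate-ε (g , h) = ∙-cancelˡ (from g) _ _ (trans h (trans (∙-congʳ (strictlyInverseʳ ε)) (trans (identityˡ _) (sym (identityʳ _)))))
      saturated : ∀ {i j} → T (nontrivial i) → T (i ~ᵇ j) → T (nontrivial j)
      saturated {i} {j} t i~j = fromWitnessFalse λ j≡e → toWitnessFalse t
        (≈ε⇒≡e (conjugate-ε (≡.subst (Conjugate i) j≡e (toWitness {a? = conjugate? i j} i~j))))

-- Central elements of order 3 and the central series of a finite 3-group

least-positive : ∀ {p} {P : ℕ → Set p} → (∀ n → Dec (P n)) → ∀ n → Acc _<_ n → P n → ∃ λ m → P m × (∀ {i} → i < m → ¬ P i)
least-positive P? n (acc rec) p with ℕ.anyUpTo? P? n
... | yes (m , m<n , q) = least-positive P? m (rec m<n) q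
... | no none           = n , p , λ i<n q → none (_ , i<n , q)

module _ {c ℓ : Level} where

  module _ (G : Group c ℓ) {n : ℕ} (order : HasOrder G n) where
    open Group G
    open Powers G
    open Inverse order using (to; from; to-cong; strictlyInverseˡ; strictlyInverseʳ)

    finite-order : ∀ x → ∃ λ d → x ↑ suc d ≈ ε
    finite-order x with pigeonhole (ℕ.n<1+n n) (λ i → to (x ↑ toℕ i))
    ... | i , j , i<j , e = toℕ j ∸ suc (toℕ i) , ∙-cancelˡ (x ↑ toℕ i) _ _ (trans (sym (↑-+ x (toℕ i) _))
            (trans (↑-≡ x (≡.trans (ℕ.+-suc (toℕ i) _) (ℕ.m+[n∸m]≡n i<j))) (trans (sym (to-injective G order e)) (sym (identityʳ _)))))

    module _ {x : Carrier} {d : ℕ} (x-order : x ↑ suc d ≈ ε) (minimal : ∀ {i} → i < d → ¬ x ↑ suc i ≈ ε) where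

      private
        _~_ : Rel Carrier ℓ
        y ~ w = ∃ λ (i : Fin (suc d)) → y ≈ w ∙ x ↑ toℕ i

        power~ : ∀ {y w} k → y ≈ w ∙ x ↑ k → y ~ w
        power~ k e = fromℕ< (m%n<n k (suc d)) , trans e (∙-congˡ (trans (↑-% (suc d) k x-order)
                       (↑-≡ x (≡.sym (toℕ-fromℕ< (m%n<n k (suc d)))))))

        no-smaller : ∀ {i j} → i < j → j < suc d → ¬ x ↑ i ≈ x ↑ j
        no-smaller {i} {j} i<j (s≤s j≤d) e = minimal (ℕ.<-≤-trans (ℕ.∸-monoʳ-< {j} {suc i} {0} (s≤s z≤n) i<j) j≤d)
          (∙-cancelˡ (x ↑ i) _ _ (trans (sym (↑-+ x i _)) (trans (↑-≡ x (≡.trans (ℕ.+-suc i _) (ℕ.m+[n∸m]≡n i<j)))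
            (trans (sym e) (sym (identityʳ _))))))

        power-injective : ∀ {i j : Fin (suc d)} → x ↑ toℕ i ≈ x ↑ toℕ j → i ≡ j
        power-injective {i} {j} e with ℕ.<-cmp (toℕ i) (toℕ j)
        ... | tri< i<j _ _ = ⊥-elim (no-smaller i<j (toℕ<n j) e)
        ... | tri≈ _ i≡j _ = toℕ-injective i≡j
        ... | tri> _ _ j<i = ⊥-elim (no-smaller j<i (toℕ<n i) (sym e))

        ~-equivalence : IsEquivalence _~_
        ~-equivalence = record
          { refl  = power~ 0 (trans (sym (identityʳ _)) (∙-congˡ (sym (↑-0 x))))
          ; sym   = λ { {y} {w} (i , e) → power~ (toℕ i * d) (trans (sym (trans (∙-congˡ (trans (sym (↑-+ x (toℕ i) _))
                      (trans (↑-≡ x (≡.sym (ℕ.*-suc (toℕ i) d))) (↑-mult (suc d) (toℕ i) x-order)))) (identityʳ w)))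
                      (trans (sym (assoc _ _ _)) (∙-congʳ (sym e)))) }
          ; trans = λ { (i , e) (j , f) → power~ (toℕ j + toℕ i) (trans e (trans (∙-congʳ f) (trans (assoc _ _ _) (∙-congˡ (sym (↑-+ x (toℕ j) (toℕ i))))))) } }

      order-divides : suc d ∣ n
      order-divides = divides (Transversal.size t) (lagrange G order ~-equivalence coarser (λ i → x ↑ toℕ i) power-injective (λ y i → i , refl) (λ h → h) t)
        where
        coarser : ∀ {y w} → y ≈ w → y ~ w
        coarser e = power~ 0 (trans e (trans (sym (identityʳ _)) (∙-congˡ (sym (↑-0 x)))))
        t : Transversal G order _~_
        t = transversal G order ~-equivalence coarser (λ y w → any? λ i → _≈?_ G order y (w ∙ x ↑ toℕ i))

    -- The order of z divides 3^k and is not 1, so it is 3(q + 1) for some q, and z^(q + 1) has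
    -- order 3.
    prime-order-power : ∀ {z k d} → n ≡ 3 ^ k → Central z → ¬ z ≈ ε → z ↑ suc d ≈ ε → (∀ {i} → i < d → ¬ z ↑ suc i ≈ ε) →
                        ∃ λ z → IsCentral₃ G z × ¬ z ≈ ε
    prime-order-power {z} {k} {d} n≡ z-central z≉ε e minimal = cases (∣3^ k (≡.subst (suc d ∣_) n≡ (order-divides {z} {d} e minimal)))
      where
      cases : suc d ≡ 1 ⊎ 3 ∣ suc d → ∃ λ z → IsCentral₃ G z × ¬ z ≈ ε
      cases (inj₁ d≡0) = ⊥-elim (z≉ε (trans (sym (↑-1 z)) (trans (↑-≡ z (≡.sym d≡0)) e)))
      cases (inj₂ (divides (suc q) d≡)) = z ↑ suc q ,
        central₃ (central-↑ z-central (suc q)) (trans (sym (↑-*′ z (suc q) 3)) (trans (↑-≡ z (≡.sym d≡)) e)) ,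
        minimal (ℕ.≤-pred (≡.subst (suc (suc q) ≤_) (≡.sym d≡) (s≤s (s≤s (ℕ.≤-trans (ℕ.m≤m*n q 3) (ℕ.m≤n+m (q * 3) 1))))))

    central-order-3 : ∀ k → n ≡ 3 ^ suc k → ∃ λ z → IsCentral₃ G z × ¬ z ≈ ε
    central-order-3 k n≡ = from-centre (nontrivial-centre G order k n≡)
      where
      from-minimal : ∀ {z} → Central z → ¬ z ≈ ε → (∃ λ d → z ↑ suc d ≈ ε × (∀ {i} → i < d → ¬ z ↑ suc i ≈ ε)) →
                     ∃ λ z → IsCentral₃ G z × ¬ z ≈ ε
      from-minimal {z} z-central z≉ε (d , e , minimal) = prime-order-power {z} {suc k} {d} n≡ z-central z≉ε e minimal
      from-order : ∀ {z} → Central z → ¬ z ≈ ε → (∃ λ d → z ↑ suc d ≈ ε) → ∃ λ z → IsCentral₃ G z × ¬ z ≈ ε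
      from-order {z} z-central z≉ε (d , e) =
        from-minimal {z} z-central z≉ε (least-positive (λ i → _≈?_ G order (z ↑ suc i) ε) d (<-wellFounded d) e)
      from-centre : (∃ λ z → Central z × ¬ z ≈ ε) → ∃ λ z → IsCentral₃ G z × ¬ z ≈ ε
      from-centre (z , z-central , z≉ε) = from-order {z} z-central z≉ε (finite-order z)

    quotient-order : ∀ {k z} (hz : IsCentral₃ G z) → ¬ z ≈ ε → n ≡ 3 ^ suc k → HasOrder (quotient G hz) (3 ^ k)
    quotient-order {k} {z} hz z≉ε n≡ = ≡.subst (HasOrder (quotient G hz)) size≡ record
        { to = class ; from = rep
        ; to-cong = class-cong ; from-cong = λ { ≡.refl → Ḡ.refl {_} }
        ; inverse = (λ { {i} {x} h → ≡.trans (class-cong h) (class-rep i) }) , (λ { {x} ≡.refl → rep-class x }) }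
      where
      module Ḡ = Group (quotient G hz)
      open IsCentral₃ hz
      reduce : ∀ {x y} → _≈/_ G hz x y → ∃ λ (i : Fin 3) → x ≈ y ∙ z ↑ toℕ i
      reduce (m , e) = fromℕ< (m%n<n m 3) , trans e (∙-congˡ (trans (↑-% 3 m cube) (↑-≡ z (≡.sym (toℕ-fromℕ< (m%n<n m 3))))))
      t : Transversal G order (_≈/_ G hz)
      t = transversal G order Ḡ.isEquivalence (≈⇒≈/ G hz)
            (λ x y → map′ (λ (i , e) → toℕ i , e) reduce (any? λ i → _≈?_ G order x (y ∙ z ↑ toℕ i)))
      open Transversal t
      size≡ : size ≡ 3 ^ k
      size≡ = ℕ.*-cancelʳ-≡ size (3 ^ k) 3 (≡.trans (≡.sym (lagrange G order Ḡ.isEquivalence (≈⇒≈/ G hz) (λ i → z ↑ toℕ i)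
        (λ {i} {j} e → toℕ-injective (≡.trans (≡.sym (m<n⇒m%n≡m (toℕ<n i))) (≡.trans (order3-inj cube z≉ε (toℕ i) (toℕ j) e) (m<n⇒m%n≡m (toℕ<n j)))))
        (λ y i → toℕ i , refl) reduce t)) (≡.trans n≡ (ℕ.*-comm 3 (3 ^ k))))

    injective⇒surjective : ∀ {f : Carrier → Carrier} → Congruent _≈_ _≈_ f → Injective _≈_ _≈_ f → Surjective _≈_ _≈_ f
    injective⇒surjective {f} f-cong f-inj y = from (proj₁ preimage) , λ e → trans (f-cong e) (to-injective G order (proj₂ preimage))
      where
      surjective : ∀ {m} (g : Fin m → Fin m) → (∀ {i j} → g i ≡ g j → i ≡ j) → ∀ y → ∃ λ x → g x ≡ y
      surjective {suc m} g g-inj y with any? (λ x → g x Fin.≟ y)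
      ... | yes p = p
      ... | no ¬p = ⊥-elim (ℕ.1+n≰n (injective⇒≤ {f = λ x → punchOut {i = y} {j = g x} (λ e → ¬p (x , ≡.sym e))}
                      λ {i} {j} e → g-inj (punchOut-injective (λ e → ¬p (i , ≡.sym e)) (λ e → ¬p (j , ≡.sym e)) e)))
      preimage = surjective (λ i → to (f (from i))) (λ e → from-injective G order (f-inj (to-injective G order e))) (to y)

  order⇒Chain : ∀ k {n} → n ≡ 3 ^ k → (G : Group c ℓ) → HasOrder G n → Chain k G
  order⇒Chain zero ≡.refl G order x = to-injective G order (single (to x) (to ε))
    where
    open Group G
    open Inverse order using (to)
    single : (i j : Fin 1) → i ≡ j
    single zero zero = ≡.refl
  order⇒Chain (suc k) n≡ G order = step (central-order-3 G order k n≡)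
    where
    step : (∃ λ z → IsCentral₃ G z × ¬ Group._≈_ G z (Group.ε G)) → Chain (suc k) G
    step (z , hz , z≉ε) = z , hz , z≉ε , order⇒Chain k ≡.refl (quotient G hz) (quotient-order G order {k} hz z≉ε n≡)

  InjColouring⇒Colourable : (G : Group c ℓ) {n : ℕ} → HasOrder G n → InjColouring G → Colourable G
  InjColouring⇒Colourable G order colouring = σ , σ-cong , bijective σ-cong σ-inj ,
      bijective (λ e → ∙-cong (σ-cong e) e) Δ₁-inj ,
      bijective (λ e → ∙-cong (⁻¹-cong e) (σ-cong e)) Δ₂-inj ,
      bijective (λ e → ∙-cong (∙-cong (⁻¹-cong e) (σ-cong e)) e) Δ₃-inj
    where
    open Group G
    open InjColouring colouring
    bijective : ∀ {f} → Congruent _≈_ _≈_ f → Injective _≈_ _≈_ f → Injective _≈_ _≈_ f × Surjective _≈_ _≈_ f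
    bijective f-cong f-inj = f-inj , injective⇒surjective G order f-cong f-inj

theorem4p3 : {c ℓ : Level} (G : Group c ℓ) →
    IsFinite3Group G →
    ¬ IsCyclic G →
    ((r : ℕ) → 4 ≤ r → ¬ IsPresentedAsL G r) →
    Colourable G
theorem4p3 G (k , order) noncyclic not-L = conclude (colour k (<-wellFounded k) G (order⇒Chain k ≡.refl G order))
  where
  open Group G
  conclude : Cyclic G ⊎ Modular G ⊎ InjColouring G → Colourable G
  conclude (inj₁ (g , gen)) = ⊥-elim (noncyclic (g , λ x → let n , e = gen x in ℤ.+ n , trans e (sym (pow≈ G g n))))
  conclude (inj₂ (inj₁ modular)) = let r , 4≤r , presented = Modular⇒presented G modular in ⊥-elim (not-L r 4≤r presented)
  conclude (inj₂ (inj₂ colouring)) = InjColouring⇒Colourable G order colouring
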